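{- Let $k$ be a field with $\mathrm{char}\,k\neq3$, let $M\supset k$ be an infinite field, and let $a,b\in M$ with $a\neq b$, $a(4a+27)\ne0$ and $b(4b+27)\neq0$. Put $$H(a,b;X)=a(X^2+9X-3a)^3-b(X^3-2aX^2-9aX-2a^2-27a)^2\in M[X].$$ Let $L_a=\mathrm{Spl}_M(X^3+aX+a)$, $L_b=\mathrm{Spl}_M(X^3+bX+b)$, $G_a=\mathrm{Gal}(L_a/M)$, $G_b=\mathrm{Gal}(L_b/M)$. (A) Suppose that $X^3+aX+a$ is irreducible over $M$ and $\#G_a\ge\#G_b$. Then the list of degrees of the irreducible factors of $H(a,b;X)$ over $M$ is as follows. Case $G_a\cong\mathfrak S_3$: - $G_b\cong\mathfrak S_3$: $(6)$ if $L_a\cap L_b=M$; $(3)(3)$ if $[L_a\cap L_b:M]=2$; $(1)(2)(3)$ if $L_a=L_b$; - $G_b\cong C_3$ (then $L_a\cap L_b=M$): $(6)$; - $G_b\cong C_2$: $(6)$ if $L_a\not\supset L_b$; $(3)(3)$ if $L_a\supset L_b$; - $G_b=\{1\}$: $(6)$. Case $G_a\cong C_3$: - $G_b\cong C_3$: $(3)(3)$ if $L_a\neq L_b$; $(1)(1)(1)(3)$ if $L_a=L_b$; - $G_b\cong C_2$ (then $L_a\cap L_b=M$): $(6)$; - $G_b=\{1\}$: $(3)(3)$. (B) In particular, $L_a=L_b$ if and only if there exists $u\in M$ (with nonvanishing denominator below) such that $$b=\frac{a(u^2+9u-3a)^3}{(u^3-2au^2-9au-2a^2-27a)^2}.$$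
   Context: $\mathrm{Spl}_M f$ denotes the splitting field of $f$ over $M$ in a fixed algebraic closure of $M$. The notation $(d_1)(d_2)\cdots$ means that the irreducible factors over $M$ have degrees $d_1,d_2,\ldots$. The discriminant of $X^3+aX+a$ is $-a^2(4a+27)$. -}

module Defs where

open import Algebra.Apartness.Bundles using (HeytingField; HeytingCommutativeRing)
open import Algebra.Bundles using (CommutativeRing; Group; RawRing)
open import Algebra.Morphism.Structures using (IsRingHomomorphism; IsRingIsomorphism; IsGroupIsomorphism)
import Algebra.Definitions.RawSemiring as SemiringDefinitions
import Algebra.Morphism.Construct.Composition as Compose
import Algebra.Morphism.Construct.Identity as Identity
import Data.Fin.Permutation as Perm
open import Data.Fin.Base using (Fin)
open import Data.Integer.Base as ℤ using (ℤ; 0ℤ)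
import Data.Integer.Divisibility.Signed as ℤ∣
import Data.Integer.Properties as ℤₚ
open import Data.List.Base using (List; []; _∷_; map; foldr)
open import Data.List.Relation.Binary.Pointwise.Base using (Pointwise)
open import Data.Nat.Base as ℕ using (ℕ; zero; suc)
import Data.Nat.Divisibility as ℕ∣
open import Data.Product.Base using (Σ; ∃; ∃-syntax; _×_; _,_; proj₁; proj₂)
open import Data.Vec.Functional using (Vector)
open import Function.Base using (_∘_; id)
open import Function.Bundles using (Bijection; Injection; _⇔_)
open import Level using (Level; _⊔_; 0ℓ) renaming (suc to lsuc)
open import Relation.Binary.Bundles using (Setoid)
open import Relation.Binary.Definitions using (_Respects_)
open import Relation.Binary.PropositionalEquality as ≡ using (_≡_; refl)
open import Relation.Nullary.Negation using (¬_)
open import Relation.Unary using (Pred; _∈_; _∪_; _⊆_)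

private
  variable
    c ℓ ℓ₁ ℓ₂ c′ ℓ′ p q : Level

-- A field is a `HeytingField`.  Under excluded middle, tightness of the
-- apartness makes `x # y` the same as `¬ (x ≈ y)`, and a `HeytingField`
-- is exactly a field in the classical sense.

commutativeRing : HeytingField c ℓ₁ ℓ₂ → CommutativeRing c ℓ₁
commutativeRing K = HeytingCommutativeRing.commutativeRing (HeytingField.heytingCommutativeRing K)

rawRing : HeytingField c ℓ₁ ℓ₂ → RawRing c ℓ₁
rawRing K = CommutativeRing.rawRing (commutativeRing K)

setoid : HeytingField c ℓ₁ ℓ₂ → Setoid c ℓ₁
setoid K = CommutativeRing.setoid (commutativeRing K)

HasCharacteristic : HeytingField c ℓ₁ ℓ₂ → ℕ → Set ℓ₁
HasCharacteristic K r = ∀ n → (n · 1# ≈ 0#) ⇔ (r ℕ∣.∣ n)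
  where
  open HeytingField K
  open SemiringDefinitions (RawRing.rawSemiring (rawRing K)) using () renaming (_×_ to _·_)

Infinite : Setoid c ℓ → Set (c ⊔ ℓ)
Infinite S = ∀ n → ¬ Bijection (≡.setoid (Fin n)) S

module _ (K : HeytingField c ℓ₁ ℓ₂) where
  open HeytingField K

  -- `#⇒invertible` speaks of x - y; here y is 0#, so this is an inverse
  -- of x - 0# ≈ x.
  inverse : (x : Carrier) → x # 0# → Carrier
  inverse x x#0 = proj₁ (#⇒invertible x#0)

-- A polynomial is its list of coefficients, constant term first;
-- trailing zeros are allowed and are ignored by the equality.

module Polynomial (R : RawRing c ℓ) where
  open RawRing R

  Poly : Set c
  Poly = List Carrier

  coeff : Poly → ℕ → Carrier
  coeff []      _       = 0#
  coeff (x ∷ f) zero    = x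
  coeff (x ∷ f) (suc n) = coeff f n

  infixl 6 _+ₚ_
  _+ₚ_ : Poly → Poly → Poly
  []      +ₚ g       = g
  (x ∷ f) +ₚ []      = x ∷ f
  (x ∷ f) +ₚ (y ∷ g) = (x + y) ∷ (f +ₚ g)

  infixl 7 _*ₚ_
  _*ₚ_ : Poly → Poly → Poly
  []      *ₚ g = []
  (x ∷ f) *ₚ g = map (x *_) g +ₚ (0# ∷ f *ₚ g)

  polyRing : RawRing c ℓ
  polyRing = record
    { Carrier = Poly
    ; _≈_     = λ f g → ∀ n → coeff f n ≈ coeff g n
    ; _+_     = _+ₚ_
    ; _*_     = _*ₚ_
    ; -_      = map (-_)
    ; 0#      = []
    ; 1#      = 1# ∷ []
    }

  C : Carrier → Poly
  C x = x ∷ []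

  X : Poly
  X = 0# ∷ 1# ∷ []

  eval : Poly → Carrier → Carrier
  eval f x = foldr (λ y v → y + x * v) 0# f

module _ (K : HeytingField c ℓ₁ ℓ₂) where
  open HeytingField K
  open Polynomial (rawRing K)
  open SemiringDefinitions (RawRing.rawSemiring polyRing) using (Irreducible)

  HasDegree : Poly → ℕ → Set (ℓ₁ ⊔ ℓ₂)
  HasDegree f n = coeff f n # 0# × (∀ m → n ℕ.< m → coeff f m ≈ 0#)

  IrreducibleOver : Poly → Set (c ⊔ ℓ₁)
  IrreducibleOver = Irreducible

  -- f is a nonzero constant times a product of irreducible polynomials
  -- whose degrees are the entries of ds (with multiplicity).
  HasFactorDegrees : Poly → List ℕ → Set (c ⊔ ℓ₁ ⊔ ℓ₂)
  HasFactorDegrees f ds =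
    ∃[ e ] ∃[ gs ] e # 0#
      × RawRing._≈_ polyRing f (C e *ₚ foldr _*ₚ_ (C 1#) gs)
      × Pointwise (λ g d → Irreducible g × HasDegree g d) gs ds

record AlgebraicClosure (M : HeytingField c ℓ₁ ℓ₂) : Set (lsuc (c ⊔ ℓ₁ ⊔ ℓ₂)) where
  private
    module M = HeytingField M
    module P = Polynomial (rawRing M)
  field
    closure : HeytingField c ℓ₁ ℓ₂
  open HeytingField closure
  open Polynomial (rawRing closure)
  field
    ι : M.Carrier → Carrier
    isHomomorphism : IsRingHomomorphism (rawRing M) (rawRing closure) ι
    algebraic : ∀ x → ∃[ f ] (∃[ n ] P.coeff f n M.# M.0#) × eval (map ι f) x ≈ 0#
    algebraicallyClosed : ∀ f n → HasDegree closure f (suc n) → ∃[ x ] eval f x ≈ 0#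

  image : Pred Carrier (c ⊔ ℓ₁)
  image y = ∃[ x ] ι x ≈ y

  IsRoot : P.Poly → Pred Carrier ℓ₁
  IsRoot f x = eval (map ι f) x ≈ 0#

record Subfield (K : HeytingField c ℓ₁ ℓ₂) p : Set (c ⊔ ℓ₁ ⊔ lsuc p) where
  open HeytingField K
  field
    Member : Pred Carrier p
    resp   : Member Respects _≈_
    0∈     : 0# ∈ Member
    1∈     : 1# ∈ Member
    +∈     : ∀ {x y} → x ∈ Member → y ∈ Member → x + y ∈ Member
    *∈     : ∀ {x y} → x ∈ Member → y ∈ Member → x * y ∈ Member
    -∈     : ∀ {x} → x ∈ Member → - x ∈ Member
    ⁻¹∈    : ∀ {x y} → x * y ≈ 1# → x ∈ Member → y ∈ Member

  ring : RawRing (c ⊔ p) ℓ₁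
  ring = record
    { Carrier = Σ Carrier Member
    ; _≈_     = λ x y → proj₁ x ≈ proj₁ y
    ; _+_     = λ x y → proj₁ x + proj₁ y , +∈ (proj₂ x) (proj₂ y)
    ; _*_     = λ x y → proj₁ x * proj₁ y , *∈ (proj₂ x) (proj₂ y)
    ; -_      = λ x → - proj₁ x , -∈ (proj₂ x)
    ; 0#      = 0# , 0∈
    ; 1#      = 1# , 1∈
    }

module _ (K : HeytingField c ℓ₁ ℓ₂) where
  open HeytingField K

  data Generated (S : Pred Carrier p) : Pred Carrier (c ⊔ ℓ₁ ⊔ p) where
    gen  : ∀ {x} → x ∈ S → x ∈ Generated S
    resp : ∀ {x y} → x ≈ y → x ∈ Generated S → y ∈ Generated S
    0∈   : 0# ∈ Generated S
    1∈   : 1# ∈ Generated S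
    +∈   : ∀ {x y} → x ∈ Generated S → y ∈ Generated S → x + y ∈ Generated S
    *∈   : ∀ {x y} → x ∈ Generated S → y ∈ Generated S → x * y ∈ Generated S
    -∈   : ∀ {x} → x ∈ Generated S → - x ∈ Generated S
    ⁻¹∈  : ∀ {x y} → x * y ≈ 1# → x ∈ Generated S → y ∈ Generated S

  subfieldGeneratedBy : Pred Carrier p → Subfield K (c ⊔ ℓ₁ ⊔ p)
  subfieldGeneratedBy S = record
    { Member = Generated S
    ; resp = resp ; 0∈ = 0∈ ; 1∈ = 1∈ ; +∈ = +∈ ; *∈ = *∈ ; -∈ = -∈ ; ⁻¹∈ = ⁻¹∈
    }

  -- [L : F] = n, for subfields F ⊆ L of K: L has an F-basis of n vectors.
  HasExtensionDegree : Pred Carrier p → Pred Carrier q → ℕ → Set (c ⊔ ℓ₁ ⊔ p ⊔ q)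
  HasExtensionDegree L F n =
    ∃[ e ] (∀ i → e i ∈ L)
      × (∀ x → x ∈ L → ∃[ s ] (∀ i → s i ∈ F) × x ≈ combination s e)
      × (∀ s → (∀ i → s i ∈ F) → combination s e ≈ 0# → ∀ i → s i ≈ 0#)
    where
    open SemiringDefinitions (RawRing.rawSemiring (rawRing K)) using (sum)

    combination : Vector Carrier n → Vector Carrier n → Carrier
    combination s e = sum (λ i → s i * e i)

Spl : {M : HeytingField c ℓ₁ ℓ₂} (Ω : AlgebraicClosure M) →
      Polynomial.Poly (rawRing M) → Subfield (AlgebraicClosure.closure Ω) (c ⊔ ℓ₁)
Spl Ω f = subfieldGeneratedBy closure (image ∪ IsRoot f)
  where open AlgebraicClosure Ω

module _ {K : HeytingField c ℓ₁ ℓ₂} (L : Subfield K p) (F : Pred (HeytingField.Carrier K) q) where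
  private
    module K = HeytingField K
    module L = RawRing (Subfield.ring L)

  record Automorphism : Set (c ⊔ ℓ₁ ⊔ p ⊔ q) where
    field
      to                : L.Carrier → L.Carrier
      isRingIsomorphism : IsRingIsomorphism (Subfield.ring L) (Subfield.ring L) to
      fixes             : ∀ x → proj₁ x ∈ F → to x L.≈ x

    open IsRingIsomorphism isRingIsomorphism public

    from : L.Carrier → L.Carrier
    from y = proj₁ (surjective y)

    to-from : ∀ y → to (from y) L.≈ y
    to-from y = proj₂ (surjective y) K.refl

    from-to : ∀ x → from (to x) L.≈ x
    from-to x = injective (to-from (to x))

  open Automorphism

  private
    idA : Automorphism
    idA = record
      { to = id
      ; isRingIsomorphism = Identity.isRingIsomorphism (Subfield.ring L) K.refl
      ; fixes = λ _ _ → K.refl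
      }

    _∘A_ : Automorphism → Automorphism → Automorphism
    σ ∘A τ = record
      { to = to σ ∘ to τ
      ; isRingIsomorphism =
          Compose.isRingIsomorphism K.trans (isRingIsomorphism τ) (isRingIsomorphism σ)
      ; fixes = λ x x∈F → K.trans (⟦⟧-cong σ (fixes τ x x∈F)) (fixes σ x x∈F)
      }

    from-unique : ∀ σ {x y} → to σ x L.≈ y → from σ y L.≈ x
    from-unique σ {x} {y} eq = injective σ (K.trans (to-from σ y) (K.sym eq))

    from-cong : ∀ σ {x y} → x L.≈ y → from σ x L.≈ from σ y
    from-cong σ {x} {y} eq = from-unique σ (K.trans (to-from σ y) (K.sym eq))

    invA : Automorphism → Automorphism
    invA σ = record
      { to = from σ
      ; isRingIsomorphism = record
          { isRingMonomorphism = record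
              { isRingHomomorphism = record
                  { isSemiringHomomorphism = record
                      { isNearSemiringHomomorphism = record
                          { +-isMonoidHomomorphism = record
                              { isMagmaHomomorphism = record
                                  { isRelHomomorphism = record { cong = from-cong σ }
                                  ; homo = λ x y → from-unique σ
                                      (K.trans (+-homo σ (from σ x) (from σ y))
                                               (K.+-cong (to-from σ x) (to-from σ y)))
                                  }
                              ; ε-homo = from-unique σ (0#-homo σ)
                              }
                          ; *-homo = λ x y → from-unique σ
                              (K.trans (*-homo σ (from σ x) (from σ y))
                                       (K.*-cong (to-from σ x) (to-from σ y)))
                          }
                      ; 1#-homo = from-unique σ (1#-homo σ)
                      }
                  ; -‿homo = λ x → from-unique σ
                      (K.trans (-‿homo σ (from σ x)) (K.-‿cong (to-from σ x)))
                  }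
              ; injective = λ {x} {y} eq →
                  K.trans (K.sym (to-from σ x)) (K.trans (⟦⟧-cong σ eq) (to-from σ y))
              }
          ; surjective = λ y → to σ y , λ {z} eq → K.trans (from-cong σ eq) (from-to σ y)
          }
      ; fixes = λ x x∈F → from-unique σ (fixes σ x x∈F)
      }

  Gal : Group (c ⊔ ℓ₁ ⊔ p ⊔ q) (c ⊔ ℓ₁ ⊔ p)
  Gal = record
    { Carrier = Automorphism
    ; _≈_ = λ σ τ → ∀ x → to σ x L.≈ to τ x
    ; _∙_ = _∘A_
    ; ε = idA
    ; _⁻¹ = invA
    ; isGroup = record
        { isMonoid = record
            { isSemigroup = record
                { isMagma = record
                    { isEquivalence = record
                        { refl = λ _ → K.refl
                        ; sym = λ eq x → K.sym (eq x)
                        ; trans = λ eq eq′ x → K.trans (eq x) (eq′ x)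
                        }
                    ; ∙-cong = λ {σ} {σ′} {τ} {τ′} eq eq′ x →
                        K.trans (⟦⟧-cong σ (eq′ x)) (eq (to τ′ x))
                    }
                ; assoc = λ _ _ _ _ → K.refl
                }
            ; identity = (λ _ _ → K.refl) , (λ _ _ → K.refl)
            }
        ; inverse = from-to , to-from
        ; ⁻¹-cong = λ {σ} {τ} eq x →
            from-unique σ (K.trans (eq (from τ x)) (to-from τ x))
        }
    }

𝔖 : ℕ → Group 0ℓ 0ℓ
𝔖 n = record
  { Carrier = Perm.Permutation′ n
  ; _≈_ = Perm._≈_
  ; _∙_ = λ π ρ → ρ Perm.∘ₚ π
  ; ε = Perm.id
  ; _⁻¹ = Perm.flip
  ; isGroup = record
      { isMonoid = record
          { isSemigroup = record
              { isMagma = record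
                  { isEquivalence = record
                      { refl = λ _ → refl
                      ; sym = λ eq i → ≡.sym (eq i)
                      ; trans = λ eq eq′ i → ≡.trans (eq i) (eq′ i)
                      }
                  ; ∙-cong = λ {π} {π′} {ρ} {ρ′} eq eq′ i →
                      ≡.trans (≡.cong (π Perm.⟨$⟩ʳ_) (eq′ i)) (eq (ρ′ Perm.⟨$⟩ʳ i))
                  }
              ; assoc = λ _ _ _ _ → refl
              }
          ; identity = (λ _ _ → refl) , (λ _ _ → refl)
          }
      ; inverse = (λ π _ → Perm.inverseˡ π) , (λ π _ → Perm.inverseʳ π)
      ; ⁻¹-cong = λ {π} {ρ} eq i → ≡.trans
          (≡.cong (π Perm.⟨$⟩ˡ_)
            (≡.trans (≡.sym (Perm.inverseʳ ρ)) (≡.sym (eq (ρ Perm.⟨$⟩ˡ i)))))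
          (Perm.inverseˡ π)
      }
  }

-- The integers under addition, with congruence modulo n as equality.
Cyclic : ℕ → Group 0ℓ 0ℓ
Cyclic n = record
  { Carrier = ℤ
  ; _≈_ = _≡ₙ_
  ; _∙_ = ℤ._+_
  ; ε = 0ℤ
  ; _⁻¹ = ℤ.-_
  ; isGroup = record
      { isMonoid = record
          { isSemigroup = record
              { isMagma = record
                  { isEquivalence = record
                      { refl = λ {i} → reflexive {i} refl
                      ; sym = λ {i} {j} → symₙ {i} {j}
                      ; trans = λ {i} {j} {k} → transₙ {i} {j} {k}
                      }
                  ; ∙-cong = λ {i} {j} {k} {l} → +-congₙ {i} {j} {k} {l}
                  }
              ; assoc = λ i j k → reflexive (ℤₚ.+-assoc i j k)
              }
          ; identity = (λ i → reflexive (ℤₚ.+-identityˡ i)) , (λ i → reflexive (ℤₚ.+-identityʳ i))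
          }
      ; inverse = (λ i → reflexive (ℤₚ.+-inverseˡ i)) , (λ i → reflexive (ℤₚ.+-inverseʳ i))
      ; ⁻¹-cong = λ {i} {j} → negₙ {i} {j}
      }
  }
  where
  open import Data.Integer.Tactic.RingSolver using (solve-∀)

  _≡ₙ_ : ℤ → ℤ → Set
  i ≡ₙ j = ℤ.+ n ℤ∣.∣ i ℤ.- j

  reflexive : ∀ {i j} → i ≡ j → i ≡ₙ j
  reflexive {i} refl = ≡.subst (ℤ.+ n ℤ∣.∣_) (≡.sym (ℤₚ.+-inverseʳ i)) (ℤ∣.divides 0ℤ refl)

  negate : ∀ {k} → ℤ.+ n ℤ∣.∣ k → ℤ.+ n ℤ∣.∣ (ℤ.- k)
  negate (ℤ∣.divides q refl) = ℤ∣.divides (ℤ.- q) (ℤₚ.neg-distribˡ-* q (ℤ.+ n))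

  sym-lemma : ∀ i j → ℤ.- (i ℤ.- j) ≡ j ℤ.- i
  sym-lemma = solve-∀

  trans-lemma : ∀ i j k → (i ℤ.- j) ℤ.+ (j ℤ.- k) ≡ i ℤ.- k
  trans-lemma = solve-∀

  +-lemma : ∀ i j k l → (i ℤ.- j) ℤ.+ (k ℤ.- l) ≡ (i ℤ.+ k) ℤ.- (j ℤ.+ l)
  +-lemma = solve-∀

  neg-lemma : ∀ i j → ℤ.- (i ℤ.- j) ≡ (ℤ.- i) ℤ.- (ℤ.- j)
  neg-lemma = solve-∀

  symₙ : ∀ {i j} → i ≡ₙ j → j ≡ₙ i
  symₙ {i} {j} d = ≡.subst (ℤ.+ n ℤ∣.∣_) (sym-lemma i j) (negate d)

  transₙ : ∀ {i j k} → i ≡ₙ j → j ≡ₙ k → i ≡ₙ k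
  transₙ {i} {j} {k} d d′ = ≡.subst (ℤ.+ n ℤ∣.∣_) (trans-lemma i j k) (ℤ∣.∣m∣n⇒∣m+n d d′)

  +-congₙ : ∀ {i j k l} → i ≡ₙ j → k ≡ₙ l → (i ℤ.+ k) ≡ₙ (j ℤ.+ l)
  +-congₙ {i} {j} {k} {l} d d′ = ≡.subst (ℤ.+ n ℤ∣.∣_) (+-lemma i j k l) (ℤ∣.∣m∣n⇒∣m+n d d′)

  negₙ : ∀ {i j} → i ≡ₙ j → (ℤ.- i) ≡ₙ (ℤ.- j)
  negₙ {i} {j} d = ≡.subst (ℤ.+ n ℤ∣.∣_) (neg-lemma i j) (negate d)

infix 4 _≅_ _≼_

_≅_ : Group c ℓ → Group c′ ℓ′ → Set (c ⊔ ℓ ⊔ c′ ⊔ ℓ′)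
G ≅ H = ∃ (IsGroupIsomorphism (Group.rawGroup G) (Group.rawGroup H))

IsTrivial : Group c ℓ → Set (c ⊔ ℓ)
IsTrivial G = ∀ g → g ≈ ε
  where open Group G

-- #G ≤ #H, as cardinal numbers.
_≼_ : Group c ℓ → Group c′ ℓ′ → Set (c ⊔ ℓ ⊔ c′ ⊔ ℓ′)
G ≼ H = Injection (Group.setoid G) (Group.setoid H)

module Formulas (R : RawRing c ℓ) where
  open RawRing R
  open SemiringDefinitions rawSemiring public using (_^_) renaming (_×_ to _·_)

  infixl 6 _-_
  _-_ : Carrier → Carrier → Carrier
  x - y = x + (- y)

  δ : Carrier → Carrier
  δ a = a * (4 · a + 27 · 1#)

  num : Carrier → Carrier → Carrier
  num a x = x ^ 2 + 9 · x - 3 · a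

  den : Carrier → Carrier → Carrier
  den a x = x ^ 3 - 2 · (a * x ^ 2) - 9 · (a * x) - 2 · (a ^ 2) - 27 · a

module _ (M : HeytingField c ℓ₁ ℓ₂) where
  open HeytingField M using (Carrier)
  open Polynomial (rawRing M)
  open RawRing polyRing using (_+_; _*_)
  open Formulas polyRing

  cubic : Carrier → Poly
  cubic a = X ^ 3 + C a * X + C a

  H : Carrier → Carrier → Poly
  H a b = C a * num (C a) X ^ 3 - C b * den (C a) X ^ 2

-- Let xᵢ and yⱼ be the roots of X³ + aX + a and X³ + bX + b in Ω.  For every u the numbers
-- θᵢ = 3xᵢ² + u xᵢ + 2a are the roots of T³ + a num(u) T + a den(u), so H(a,b;u) = 0 means that
-- a common multiple of the θᵢ are the yⱼ in some order.  Since a ≠ b, every bijection π from the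
-- xᵢ to the yⱼ arises in this way from exactly one u = u_π.  Hence H is a - b times the product of
-- the six distinct factors X - u_π, which the Galois group of L_a L_b permutes through
-- (σ , τ) · π = τ π σ⁻¹.  The irreducible factors of H correspond to the orbits of this action, and
-- L_a = L_b exactly when some π is fixed, that is, when some u_π lies in M.
--
-- The Galois group of L_a L_b is taken to be the group G of the pairs of permutations of the xᵢ
-- and the yⱼ that preserve all polynomial relations over M.  It has fixed field M and maps onto
-- the Galois groups of L_a and L_b because a homomorphism over M from a subring of Ω to Ω (a
-- specialization) extends to one more root at a time.

module Submission where

open import Defs
open import Algebra.Apartness.Bundles using (HeytingField)
open import Algebra.Morphism.Structures using (IsRingHomomorphism)
open import Axiom.ExcludedMiddle using (ExcludedMiddle)
open import Data.List.Base using (List; []; _∷_)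
open import Data.Nat.Base using (ℕ)
open import Data.Product.Base using (Σ-syntax; ∃-syntax; _×_)
open import Function.Bundles using (_⇔_)
open import Level using (_⊔_)
open import Relation.Nullary.Negation using (¬_)
open import Relation.Unary using (_≐_; _∩_; _⊆_)

open import Algebra.Bundles using (CommutativeRing; Group; RawRing)
import Algebra.Construct.DirectProduct as DirectProduct
import Algebra.Definitions.RawMagma as RawMagmaDefinitions
import Algebra.Definitions.RawSemiring as SemiringDefinitions
open import Algebra.Morphism.Structures using (IsGroupIsomorphism)
import Algebra.Properties.AbelianGroup
import Algebra.Properties.Ring
import Algebra.Properties.Semiring.Exp
import Algebra.Properties.Semiring.Mult.TCOptimised
import Algebra.Solver.Ring
open import Algebra.Solver.Ring.AlmostCommutativeRing using (fromCommutativeRing; _-Raw-AlmostCommutative⟶_)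
open import Data.Bool.Base using (Bool; true; false)
import Data.Bool.Properties as Bool
open import Data.Empty using (⊥; ⊥-elim)
open import Data.Fin.Base as Fin using (Fin; toℕ)
open import Data.Fin.Patterns
open import Data.Fin.Permutation using (transpose; _⟨$⟩ʳ_)
import Data.Fin.Properties as Finₚ
open import Data.Integer.Base as ℤ using (ℤ; -[1+_]; 0ℤ; 1ℤ; _⊖_)
import Data.Integer.Divisibility.Signed as ℤ∣
import Data.Integer.Properties as ℤₚ
open import Data.Integer.Tactic.RingSolver using (solve-∀)
open import Data.List.Base as List using (map; length)
import Data.List.Membership.DecPropositional as DecMembership
open import Data.List.Membership.Propositional using (_∈_)
open import Data.List.Membership.Propositional.Properties using (∈-map⁺; ∈-map⁻)
import Data.List.Properties as Listₚ
open import Data.List.Relation.Binary.Pointwise.Base using (Pointwise; []; _∷_)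
open import Data.List.Relation.Unary.All as All using (All; []; _∷_)
import Data.List.Relation.Unary.All.Properties as Allₚ
open import Data.List.Relation.Unary.AllPairs using (AllPairs; []; _∷_; allPairs?)
open import Data.List.Relation.Unary.Any using (here; there)
import Data.Maybe.Base as Maybe
open import Data.Nat.Base as ℕ using (zero; suc; z≤n; s≤s)
import Data.Nat.Divisibility as ℕ∣
open import Data.Nat.Induction using (<-rec)
import Data.Nat.Properties as ℕₚ
open import Data.Product.Base using (∃; _,_; _,′_; proj₁; proj₂)
import Data.Sum.Base as Sum
open import Data.Sum.Base using (_⊎_; inj₁; inj₂; [_,_]′)
open import Data.Unit.Base using (⊤; tt)
open import Data.Vec.Base using (Vec; []; _∷_; lookup)
open import Data.Vec.N-ary using (N-ary; Eq; Eqʰ; curryⁿ)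
open import Function.Base using (id; _∘_)
open import Function.Bundles using (mk⇔)
open import Level using (Lift; lift; lower)
import Relation.Binary.Definitions as Tri
open import Relation.Binary.PropositionalEquality as ≡ using (_≡_; _≢_)
import Relation.Binary.Reasoning.Setoid as SetoidReasoning
import Relation.Binary.Reflection
open import Relation.Nullary.Decidable using (Dec; yes; no; map′; decidable-stable; dec⇒maybe; from-yes; _×-dec_; _⊎-dec_; _→-dec_; ¬?)
open import Relation.Nullary.Negation using (contradiction)

-- Why 3x² + ux + 2a: the roots of X³ + aX + a have sum 0 and sum of squares -2a, so for invertible
-- 3 the expressions of degree at most 2 in x with trace 0 are spanned by x and 3x² + 2a, and every
-- triple of y's is interpolated by such an expression. A cubic T³ + pT + q takes the shape T³ + bT
-- + b after scaling T by p/q, and then b = p³/q²; with p = a num(u) and q = a den(u) this is the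
-- equation H(a,b;u) = 0 and the formula in (B). The many cases reduce to two questions about G.
-- Irreducibility puts a pair with a 3-cycle as first component into G. Either some π is fixed, and
-- the orbits are those of the first projection of G acting on S₃ by conjugation; or G contains
-- (3-cycle, id), and then the six π form one orbit or two orbits of three, according to whether the
-- two components of some element of G differ in parity. Each row of the table is decided by
-- translating its hypothesis on fields into these terms. The group theory takes place in S₃ × S₃
-- and is settled by running through the elements.

-- Polynomial identities with integer coefficients in a commutative ring.

module IntegerSolver {c ℓ} (R : CommutativeRing c ℓ) where
  open CommutativeRing R
  open Algebra.Properties.Ring ring using (-‿distribˡ-*; -‿distribʳ-*; -0#≈0#; -‿involutive)
  open Algebra.Properties.AbelianGroup +-abelianGroup using (⁻¹-∙-comm)
  open Algebra.Properties.Semiring.Mult.TCOptimised semiring using (1+×; ×-homo-+; ×1-homo-*) renaming (_×_ to _·_)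
  open SetoidReasoning (CommutativeRing.setoid R)

  -- Integers serve as coefficients because their equality is decidable, so that the solver can
  -- cancel terms in a ring whose own equality need not be.
  fromℤ : ℤ → Carrier
  fromℤ (ℤ.+ n)  = n · 1#
  fromℤ -[1+ n ] = - (suc n · 1#)

  private
    cancel : ∀ x y z → (x + y) - (x + z) ≈ y - z
    cancel x y z = begin
      (x + y) - (x + z)       ≈⟨ +-cong (+-comm x y) (sym (⁻¹-∙-comm x z)) ⟩
      (y + x) + (- x + - z)   ≈⟨ +-assoc y x _ ⟩
      y + (x + (- x + - z))   ≈⟨ +-congˡ (sym (+-assoc x (- x) (- z))) ⟩
      y + ((x - x) - z)       ≈⟨ +-congˡ (+-congʳ (-‿inverseʳ x)) ⟩
      y + (0# - z)            ≈⟨ +-congˡ (+-identityˡ (- z)) ⟩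
      y - z                   ∎

    ⊖-homo : ∀ m n → fromℤ (m ⊖ n) ≈ m · 1# - n · 1#
    ⊖-homo zero    zero    = sym (-‿inverseʳ 0#)
    ⊖-homo zero    (suc n) = sym (+-identityˡ _)
    ⊖-homo (suc m) zero    = sym (trans (+-congˡ -0#≈0#) (+-identityʳ _))
    ⊖-homo (suc m) (suc n) = begin
      fromℤ (suc m ⊖ suc n)           ≡⟨ ≡.cong fromℤ (ℤₚ.[1+m]⊖[1+n]≡m⊖n m n) ⟩
      fromℤ (m ⊖ n)                   ≈⟨ ⊖-homo m n ⟩
      m · 1# - n · 1#                 ≈⟨ sym (cancel 1# _ _) ⟩
      (1# + m · 1#) - (1# + n · 1#)   ≈⟨ +-cong (sym (1+× m 1#)) (-‿cong (sym (1+× n 1#))) ⟩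
      suc m · 1# - suc n · 1#         ∎

    neg-homo : ∀ i → fromℤ (ℤ.- i) ≈ - fromℤ i
    neg-homo (ℤ.+ zero)  = sym -0#≈0#
    neg-homo (ℤ.+ suc n) = refl
    neg-homo -[1+ n ]    = sym (-‿involutive _)

    +-homo′ : ∀ i j → fromℤ (i ℤ.+ j) ≈ fromℤ i + fromℤ j
    +-homo′ (ℤ.+ m)  (ℤ.+ n)  = ×-homo-+ 1# m n
    +-homo′ (ℤ.+ m)  -[1+ n ] = ⊖-homo m (suc n)
    +-homo′ -[1+ m ] (ℤ.+ n)  = trans (⊖-homo n (suc m)) (+-comm _ _)
    +-homo′ -[1+ m ] -[1+ n ] = begin
      - (suc (suc (m ℕ.+ n)) · 1#)        ≡⟨ ≡.cong (λ k → - (k · 1#)) (≡.cong suc (≡.sym (ℕₚ.+-suc m n))) ⟩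
      - ((suc m ℕ.+ suc n) · 1#)          ≈⟨ -‿cong (×-homo-+ 1# (suc m) (suc n)) ⟩
      - (suc m · 1# + suc n · 1#)         ≈⟨ sym (⁻¹-∙-comm _ _) ⟩
      - (suc m · 1#) - suc n · 1#         ∎

    pos-*-homo : ∀ m n → fromℤ (ℤ.+ m ℤ.* ℤ.+ n) ≈ fromℤ (ℤ.+ m) * fromℤ (ℤ.+ n)
    pos-*-homo m n = begin
      fromℤ (ℤ.+ m ℤ.* ℤ.+ n) ≡⟨ ≡.cong fromℤ (≡.sym (ℤₚ.pos-* m n)) ⟩
      (m ℕ.* n) · 1#          ≈⟨ ×1-homo-* m n ⟩
      m · 1# * (n · 1#)       ∎

    pos-*-neg-homo : ∀ m n → fromℤ (ℤ.+ m ℤ.* -[1+ n ]) ≈ fromℤ (ℤ.+ m) * fromℤ -[1+ n ]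
    pos-*-neg-homo m n = begin
      fromℤ (ℤ.+ m ℤ.* -[1+ n ])           ≡⟨ ≡.cong fromℤ (≡.sym (ℤₚ.neg-distribʳ-* (ℤ.+ m) (ℤ.+ suc n))) ⟩
      fromℤ (ℤ.- (ℤ.+ m ℤ.* ℤ.+ suc n))    ≈⟨ neg-homo (ℤ.+ m ℤ.* ℤ.+ suc n) ⟩
      - fromℤ (ℤ.+ m ℤ.* ℤ.+ suc n)        ≈⟨ -‿cong (pos-*-homo m (suc n)) ⟩
      - (m · 1# * (suc n · 1#))            ≈⟨ -‿distribʳ-* _ _ ⟩
      m · 1# * - (suc n · 1#)              ∎

    pos-*-any-homo : ∀ m j → fromℤ (ℤ.+ m ℤ.* j) ≈ fromℤ (ℤ.+ m) * fromℤ j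
    pos-*-any-homo m (ℤ.+ n)  = pos-*-homo m n
    pos-*-any-homo m -[1+ n ] = pos-*-neg-homo m n

    *-homo′ : ∀ i j → fromℤ (i ℤ.* j) ≈ fromℤ i * fromℤ j
    *-homo′ (ℤ.+ m)  j = pos-*-any-homo m j
    *-homo′ -[1+ m ] j = begin
      fromℤ (-[1+ m ] ℤ.* j)               ≡⟨ ≡.cong fromℤ (≡.sym (ℤₚ.neg-distribˡ-* (ℤ.+ suc m) j)) ⟩
      fromℤ (ℤ.- (ℤ.+ suc m ℤ.* j))        ≈⟨ neg-homo (ℤ.+ suc m ℤ.* j) ⟩
      - fromℤ (ℤ.+ suc m ℤ.* j)            ≈⟨ -‿cong (pos-*-any-homo (suc m) j) ⟩
      - (suc m · 1# * fromℤ j)             ≈⟨ -‿distribˡ-* _ _ ⟩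
      - (suc m · 1#) * fromℤ j             ∎

    morphism : CommutativeRing.rawRing ℤₚ.+-*-commutativeRing -Raw-AlmostCommutative⟶ fromCommutativeRing R
    morphism = record
      { ⟦_⟧    = fromℤ
      ; +-homo = +-homo′
      ; *-homo = *-homo′
      ; -‿homo = neg-homo
      ; 0-homo = refl
      -- Definitional because this multiple sends 1 to `1#` itself and not to a sum with `0#`.
      ; 1-homo = refl
      }

  private
    module Solver = Algebra.Solver.Ring (CommutativeRing.rawRing ℤₚ.+-*-commutativeRing) (fromCommutativeRing R) morphism
      (λ i j → Maybe.map (λ i≡j → reflexive (≡.cong fromℤ i≡j)) (dec⇒maybe (i ℤₚ.≟ j)))

  open Solver public hiding (solve; prove)
  open Relation.Binary.Reflection (CommutativeRing.setoid R) Solver.var Solver.⟦_⟧ Solver.⟦_⟧↓ Solver.correct using (close)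

  -- Proofs are kept from unfolding: with-abstraction would normalise them.
  abstract
    solve : ∀ n (f : N-ary n (Polynomial n) (Polynomial n × Polynomial n)) →
            Eqʰ n _≈_ (curryⁿ ⟦ proj₁ (close n f) ⟧↓) (curryⁿ ⟦ proj₂ (close n f) ⟧↓) →
            Eq n _≈_ (curryⁿ ⟦ proj₁ (close n f) ⟧) (curryⁿ ⟦ proj₂ (close n f) ⟧)
    solve = Solver.solve

-- Identities behind Horner evaluation and linear combinations.

module RingIdentities {c ℓ} (R : CommutativeRing c ℓ) where
  open CommutativeRing R
  open IntegerSolver R

  horner-+ : ∀ x y z f g → x + y + z * (f + g) ≈ x + z * f + (y + z * g)
  horner-+ = solve 5 (λ x y z f g → x :+ y :+ z :* (f :+ g) := x :+ z :* f :+ (y :+ z :* g)) refl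

  horner-scale : ∀ x y z f → x * y + z * (x * f) ≈ x * (y + z * f)
  horner-scale = solve 4 (λ x y z f → x :* y :+ z :* (x :* f) := x :* (y :+ z :* f)) refl

  horner-neg : ∀ y z f → - y + z * - f ≈ - (y + z * f)
  horner-neg = solve 3 (λ y z f → :- y :+ z :* :- f := :- (y :+ z :* f)) refl

  horner-* : ∀ x z f g → x * g + (0# + z * (f * g)) ≈ (x + z * f) * g
  horner-* = solve 4 (λ x z f g → x :* g :+ (con 0ℤ :+ z :* (f :* g)) := (x :+ z :* f) :* g) refl

  horner-quotient : ∀ y w z q f → y + w * ((w - z) * q + f) ≈ (w - z) * (f + w * q) + (y + z * f)
  horner-quotient = solve 5 (λ y w z q f → y :+ w :* ((w :- z) :* q :+ f) := (w :- z) :* (f :+ w :* q) :+ (y :+ z :* f)) refl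

  horner-linear : ∀ z w → - z + w * (1# + w * 0#) ≈ w - z
  horner-linear = solve 2 (λ z w → :- z :+ w :* (con 1ℤ :+ w :* con 0ℤ) := w :- z) refl

  horner-root : ∀ z y e → y ≈ - z * e + (y + z * e)
  horner-root = solve 3 (λ z y e → y := :- z :* e :+ (y :+ z :* e)) refl

  difference-+ : ∀ x y → x ≈ (x - y) + y
  difference-+ = solve 2 (λ x y → x := (x :- y) :+ y) refl

  difference-0-* : ∀ x y → x * y ≈ (x - 0#) * y
  difference-0-* = solve 2 (λ x y → x :* y := (x :- con 0ℤ) :* y) refl

  *-rotate : ∀ x y z → x * z * y ≈ z * (x * y)
  *-rotate = solve 3 (λ x y z → x :* z :* y := z :* (x :* y)) refl

  *-distrib-difference : ∀ x y z → x * (y - z) ≈ x * y - x * z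
  *-distrib-difference = solve 3 (λ x y z → x :* (y :- z) := x :* y :- x :* z) refl

  zero-combination : ∀ g → 0# ≈ 0# + 0# * g
  zero-combination = solve 1 (λ g → con 0ℤ := con 0ℤ :+ con 0ℤ :* g) refl

  unit-combination : ∀ g → g ≈ 0# + 1# * g
  unit-combination = solve 1 (λ g → g := con 0ℤ :+ con 1ℤ :* g) refl

  combination-+ : ∀ w s w′ s′ g → w + s * g + (w′ + s′ * g) ≈ w + w′ + (s + s′) * g
  combination-+ = solve 5 (λ w s w′ s′ g → w :+ s :* g :+ (w′ :+ s′ :* g) := w :+ w′ :+ (s :+ s′) :* g) refl

  combination-scale : ∀ s w s′ g → s * (w + s′ * g) ≈ s * w + s * s′ * g
  combination-scale = solve 4 (λ s w s′ g → s :* (w :+ s′ :* g) := s :* w :+ s :* s′ :* g) refl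

  combination-shift : ∀ γ w s g → γ * (w + s * g) ≈ γ * w + s * (γ * g)
  combination-shift = solve 4 (λ γ w s g → γ :* (w :+ s :* g) := γ :* w :+ s :* (γ :* g)) refl

  combination-* : ∀ w s g y → (w + s * g) * y ≈ w * y + s * (g * y)
  combination-* = solve 4 (λ w s g y → (w :+ s :* g) :* y := w :* y :+ s :* (g :* y)) refl

  neg-one-* : ∀ x → - 1# * x ≈ - x
  neg-one-* = solve 1 (λ x → :- con 1ℤ :* x := :- x) refl

-- The symmetric group on three letters and the subgroups of its square.

module S₃ where

  open DecMembership (Finₚ._≟_ {6}) using (_∈?_)

  -- 0, 1, 2 are the rotations i ↦ i + k and 3, 4, 5 the reflections i ↦ k - i of ℤ/3.
  S₃ : Set
  S₃ = Fin 6

  act : S₃ → Fin 3 → Fin 3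
  act σ i = lookup (lookup table σ) i
    where
    table : Vec (Vec (Fin 3) 3) 6
    table = (0F ∷ 1F ∷ 2F ∷ []) ∷ (1F ∷ 2F ∷ 0F ∷ []) ∷ (2F ∷ 0F ∷ 1F ∷ [])
          ∷ (0F ∷ 2F ∷ 1F ∷ []) ∷ (1F ∷ 0F ∷ 2F ∷ []) ∷ (2F ∷ 1F ∷ 0F ∷ []) ∷ []

  infixl 7 _∙_
  _∙_ : S₃ → S₃ → S₃
  σ ∙ τ = lookup (lookup table σ) τ
    where
    table : Vec (Vec S₃ 6) 6
    table = (0F ∷ 1F ∷ 2F ∷ 3F ∷ 4F ∷ 5F ∷ []) ∷ (1F ∷ 2F ∷ 0F ∷ 4F ∷ 5F ∷ 3F ∷ [])
          ∷ (2F ∷ 0F ∷ 1F ∷ 5F ∷ 3F ∷ 4F ∷ []) ∷ (3F ∷ 5F ∷ 4F ∷ 0F ∷ 2F ∷ 1F ∷ [])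
          ∷ (4F ∷ 3F ∷ 5F ∷ 1F ∷ 0F ∷ 2F ∷ []) ∷ (5F ∷ 4F ∷ 3F ∷ 2F ∷ 1F ∷ 0F ∷ []) ∷ []

  inv : S₃ → S₃
  inv σ = lookup (0F ∷ 2F ∷ 1F ∷ 3F ∷ 4F ∷ 5F ∷ []) σ

  odd : S₃ → Bool
  odd σ = lookup (false ∷ false ∷ false ∷ true ∷ true ∷ true ∷ []) σ

  infixr 8 _^ˢ_
  _^ˢ_ : S₃ → ℕ → S₃
  σ ^ˢ zero  = 0F
  σ ^ˢ suc n = σ ∙ σ ^ˢ n

  IsRotation : S₃ → Set
  IsRotation σ = σ ≡ 1F ⊎ σ ≡ 2F

  isRotation? : ∀ σ → Dec (IsRotation σ)
  isRotation? σ = σ Finₚ.≟ 1F ⊎-dec σ Finₚ.≟ 2F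

  abstract
    -- Like most statements about `S₃` below, this is finite and is verified on all elements.
    act-∙ : ∀ σ τ i → act (σ ∙ τ) i ≡ act σ (act τ i)
    act-∙ = from-yes (Finₚ.all? λ σ → Finₚ.all? λ τ → Finₚ.all? λ i → act (σ ∙ τ) i Finₚ.≟ act σ (act τ i))

    act-inv : ∀ σ i → act σ (act (inv σ) i) ≡ i
    act-inv = from-yes (Finₚ.all? λ σ → Finₚ.all? λ i → act σ (act (inv σ) i) Finₚ.≟ i)

    inv-act : ∀ σ i → act (inv σ) (act σ i) ≡ i
    inv-act = from-yes (Finₚ.all? λ σ → Finₚ.all? λ i → act (inv σ) (act σ i) Finₚ.≟ i)

    act-id : ∀ i → act 0F i ≡ i
    act-id = from-yes (Finₚ.all? λ i → act 0F i Finₚ.≟ i)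

    act-faithful : ∀ σ τ → (∀ i → act σ i ≡ act τ i) → σ ≡ τ
    act-faithful = from-yes (Finₚ.all? λ σ → Finₚ.all? λ τ → (Finₚ.all? λ i → act σ i Finₚ.≟ act τ i) →-dec (σ Finₚ.≟ τ))

    act-surjective : ∀ i j k → i ≢ j → j ≢ k → k ≢ i →
                     ∃[ σ ] (act σ 0F ≡ i × act σ 1F ≡ j × act σ 2F ≡ k)
    act-surjective = from-yes (Finₚ.all? λ i → Finₚ.all? λ j → Finₚ.all? λ k →
      ¬? (i Finₚ.≟ j) →-dec ¬? (j Finₚ.≟ k) →-dec ¬? (k Finₚ.≟ i) →-dec
      Finₚ.any? λ σ → act σ 0F Finₚ.≟ i ×-dec act σ 1F Finₚ.≟ j ×-dec act σ 2F Finₚ.≟ k)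

  -- (σ , τ) acts on the bijections π from the roots of f_a to those of f_b by π ↦ τ π σ⁻¹.
  move : S₃ → S₃ → S₃ → S₃
  move σ τ π = τ ∙ π ∙ inv σ

  act-move : ∀ σ τ π i → act (move σ τ π) (act σ i) ≡ act τ (act π i)
  act-move σ τ π i =
    ≡.trans (act-∙ (τ ∙ π) (inv σ) (act σ i))
      (≡.trans (≡.cong (act (τ ∙ π)) (inv-act σ i)) (act-∙ τ π i))

  rotations reflections : List S₃
  rotations   = 0F ∷ 1F ∷ 2F ∷ []
  reflections = 3F ∷ 4F ∷ 5F ∷ []

  abstract
    fixes⇒move : ∀ π σ τ → τ ∙ π ≡ π ∙ σ → move σ τ π ≡ π
    fixes⇒move = from-yes (Finₚ.all? λ π → Finₚ.all? λ σ → Finₚ.all? λ τ → τ ∙ π Finₚ.≟ π ∙ σ →-dec move σ τ π Finₚ.≟ π)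

    move⇒fixes : ∀ π σ τ → move σ τ π ≡ π → τ ∙ π ≡ π ∙ σ
    move⇒fixes = from-yes (Finₚ.all? λ π → Finₚ.all? λ σ → Finₚ.all? λ τ → move σ τ π Finₚ.≟ π →-dec τ ∙ π Finₚ.≟ π ∙ σ)

    fixes-swap : ∀ π σ τ → τ ∙ π ≡ π ∙ σ → σ ∙ inv π ≡ inv π ∙ τ
    fixes-swap = from-yes (Finₚ.all? λ π → Finₚ.all? λ σ → Finₚ.all? λ τ → τ ∙ π Finₚ.≟ π ∙ σ →-dec σ ∙ inv π Finₚ.≟ inv π ∙ τ)

    fixes-parity : ∀ π σ τ → τ ∙ π ≡ π ∙ σ → odd σ ≡ odd τ
    fixes-parity = from-yes (Finₚ.all? λ π → Finₚ.all? λ σ → Finₚ.all? λ τ → τ ∙ π Finₚ.≟ π ∙ σ →-dec odd σ Bool.≟ odd τ)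

    -- None of the three is the identity. If all are transpositions they are not all equal, since a
    -- transposition fixes one of the three points, and two different transpositions multiply to a
    -- 3-cycle.
    transitive⇒rotation : ∀ ρ σ τ → act ρ 0F ≢ 0F → act σ 1F ≢ 1F → act τ 2F ≢ 2F →
      (IsRotation ρ ⊎ IsRotation σ ⊎ IsRotation τ) ⊎ (IsRotation (ρ ∙ σ) ⊎ IsRotation (σ ∙ τ) ⊎ IsRotation (ρ ∙ τ))
    transitive⇒rotation = from-yes (Finₚ.all? λ ρ → Finₚ.all? λ σ → Finₚ.all? λ τ →
      ¬? (act ρ 0F Finₚ.≟ 0F) →-dec ¬? (act σ 1F Finₚ.≟ 1F) →-dec ¬? (act τ 2F Finₚ.≟ 2F) →-dec
      ((isRotation? ρ ⊎-dec isRotation? σ ⊎-dec isRotation? τ) ⊎-dec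
       (isRotation? (ρ ∙ σ) ⊎-dec isRotation? (σ ∙ τ) ⊎-dec isRotation? (ρ ∙ τ))))

    noncommuting⇒odd : ∀ σ τ → σ ∙ τ ≢ τ ∙ σ → odd σ ≡ true ⊎ odd τ ≡ true
    noncommuting⇒odd = from-yes (Finₚ.all? λ σ → Finₚ.all? λ τ → ¬? (σ ∙ τ Finₚ.≟ τ ∙ σ) →-dec (odd σ Bool.≟ true ⊎-dec odd τ Bool.≟ true))

    involution⇒odd : ∀ σ → σ ∙ σ ≡ 0F → σ ≢ 0F → odd σ ≡ true
    involution⇒odd = from-yes (Finₚ.all? λ σ → σ ∙ σ Finₚ.≟ 0F →-dec ¬? (σ Finₚ.≟ 0F) →-dec odd σ Bool.≟ true)

    -- Two different transpositions multiply to a 3-cycle, so a subgroup of exponent 2 has at most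
    -- one nontrivial element.
    involution-product : ∀ σ τ → σ ∙ σ ≡ 0F → τ ∙ τ ≡ 0F → (σ ∙ τ) ∙ (σ ∙ τ) ≡ 0F → σ ≢ 0F → τ ≢ 0F → σ ≡ τ
    involution-product = from-yes (Finₚ.all? λ σ → Finₚ.all? λ τ → σ ∙ σ Finₚ.≟ 0F →-dec τ ∙ τ Finₚ.≟ 0F →-dec (σ ∙ τ) ∙ (σ ∙ τ) Finₚ.≟ 0F →-dec ¬? (σ Finₚ.≟ 0F) →-dec ¬? (τ Finₚ.≟ 0F) →-dec σ Finₚ.≟ τ)

    order-3⇒even : ∀ σ → σ ∙ (σ ∙ σ) ≡ 0F → odd σ ≡ false
    order-3⇒even = from-yes (Finₚ.all? λ σ → σ ∙ (σ ∙ σ) Finₚ.≟ 0F →-dec odd σ Bool.≟ false)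

    even⇒power : ∀ σ → odd σ ≡ false → ∃[ i ] 1F ^ˢ toℕ {3} i ≡ σ
    even⇒power = from-yes (Finₚ.all? λ σ → odd σ Bool.≟ false →-dec Finₚ.any? λ i → 1F ^ˢ toℕ {3} i Finₚ.≟ σ)

    -- Cubing a pair makes its even components trivial and leaves its odd components alone. This is
    -- how a component is cleared when the parities differ.
    cube : ∀ σ → (odd σ ≡ true × σ ^ˢ 3 ≡ σ) ⊎ (odd σ ≡ false × σ ^ˢ 3 ≡ 0F)
    cube = from-yes (Finₚ.all? λ σ → (odd σ Bool.≟ true ×-dec σ ^ˢ 3 Finₚ.≟ σ) ⊎-dec (odd σ Bool.≟ false ×-dec σ ^ˢ 3 Finₚ.≟ 0F))

    -- An even exponent kills `τ`; 4 works for `1F` and 2 for `2F`.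
    rotation-power : ∀ σ τ → IsRotation σ → τ ∙ τ ≡ 0F → ∃[ n ] (σ ^ˢ toℕ {6} n ≡ 1F × τ ^ˢ toℕ {6} n ≡ 0F)
    rotation-power = from-yes (Finₚ.all? λ σ → Finₚ.all? λ τ → isRotation? σ →-dec τ ∙ τ Finₚ.≟ 0F →-dec
      Finₚ.any? λ n → σ ^ˢ toℕ {6} n Finₚ.≟ 1F ×-dec τ ^ˢ toℕ {6} n Finₚ.≟ 0F)

    rotation-moves : ∀ σ → IsRotation σ → act σ 0F ≢ 0F × act (σ ∙ σ) 0F ≢ 0F × act σ 0F ≢ act (σ ∙ σ) 0F
    rotation-moves = from-yes (Finₚ.all? λ σ → isRotation? σ →-dec
      ¬? (act σ 0F Finₚ.≟ 0F) ×-dec ¬? (act (σ ∙ σ) 0F Finₚ.≟ 0F) ×-dec ¬? (act σ 0F Finₚ.≟ act (σ ∙ σ) 0F))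

    -- The rotations and one transposition generate `S₃`. When the generators occur in pairs with
    -- trivial second component, this clears a first component without touching the second.
    odd-clears : ∀ σ ρ → odd σ ≡ true → ∃[ i ] ∃[ j ] 1F ^ˢ toℕ {3} i ∙ (σ ^ˢ toℕ {2} j ∙ ρ) ≡ 0F
    odd-clears = from-yes (Finₚ.all? λ σ → Finₚ.all? λ ρ → odd σ Bool.≟ true →-dec
      Finₚ.any? λ i → Finₚ.any? λ j → 1F ^ˢ toℕ {3} i ∙ (σ ^ˢ toℕ {2} j ∙ ρ) Finₚ.≟ 0F)

    0F-power : ∀ (i : Fin 3) → 0F ^ˢ toℕ i ≡ 0F
    0F-power = from-yes (Finₚ.all? λ i → 0F ^ˢ toℕ {3} i Finₚ.≟ 0F)

    identity-word : ∀ (i : Fin 3) (j : Fin 2) σ → 0F ^ˢ toℕ i ∙ (0F ^ˢ toℕ j ∙ σ) ≡ σ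
    identity-word = from-yes (Finₚ.all? λ i → Finₚ.all? λ j → Finₚ.all? λ σ → 0F ^ˢ toℕ {3} i ∙ (0F ^ˢ toℕ {2} j ∙ σ) Finₚ.≟ σ)

    -- `S₃` has exponent 6, so the fifth power is the inverse; in this form the inverse stays in
    -- anything closed under products.
    recompose : ∀ σ ρ → σ ∙ (σ ^ˢ 5 ∙ ρ) ≡ ρ
    recompose = from-yes (Finₚ.all? λ σ → Finₚ.all? λ ρ → σ ∙ (σ ^ˢ 5 ∙ ρ) Finₚ.≟ ρ)

    odd-quotient : ∀ σ ρ → odd σ ≡ true → odd ρ ≡ true → odd (σ ^ˢ 5 ∙ ρ) ≡ false
    odd-quotient = from-yes (Finₚ.all? λ σ → Finₚ.all? λ ρ → odd σ Bool.≟ true →-dec odd ρ Bool.≟ true →-dec odd (σ ^ˢ 5 ∙ ρ) Bool.≟ false)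

  Pairwise≢ : List S₃ → Set
  Pairwise≢ = AllPairs _≢_

  distinct? : ∀ O → Dec (Pairwise≢ O)
  distinct? = allPairs? λ π ρ → ¬? (π Finₚ.≟ ρ)

  -- Disjointness only; that the blocks exhaust the six elements is checked by counting in
  -- `degrees-from-orbits`.
  IsPartition : List (List S₃) → Set
  IsPartition Os = All Pairwise≢ Os × Pairwise≢ (List.concat Os)

  isPartition? : ∀ Os → Dec (IsPartition Os)
  isPartition? Os = All.all? distinct? Os ×-dec distinct? (List.concat Os)

  abstract
    all-partition : IsPartition ((rotations List.++ reflections) ∷ [])
    all-partition = from-yes (isPartition? ((rotations List.++ reflections) ∷ []))

    parity-partition : IsPartition (rotations ∷ reflections ∷ [])
    parity-partition = from-yes (isPartition? (rotations ∷ reflections ∷ []))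

    conjugacy-partition : ∀ π → IsPartition (List.map (List.map (π ∙_)) ((0F ∷ []) ∷ (1F ∷ 2F ∷ []) ∷ reflections ∷ []))
    conjugacy-partition = from-yes (Finₚ.all? λ π → isPartition? (List.map (List.map (π ∙_)) ((0F ∷ []) ∷ (1F ∷ 2F ∷ []) ∷ reflections ∷ [])))

    -- Up to the translation by `π`, these are the orbits of conjugation by the rotations alone:
    -- they commute with each other but still permute the three transpositions transitively. For
    -- conjugation by all of `S₃` the two 3-cycles fall together, as in `conjugacy-partition`.
    centralizer-partition : ∀ π → IsPartition (List.map (List.map (π ∙_)) ((0F ∷ []) ∷ (1F ∷ []) ∷ (2F ∷ []) ∷ reflections ∷ []))
    centralizer-partition = from-yes (Finₚ.all? λ π → isPartition? (List.map (List.map (π ∙_)) ((0F ∷ []) ∷ (1F ∷ []) ∷ (2F ∷ []) ∷ reflections ∷ [])))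

  -- In a finite group inverses are powers, so closure under products makes `G` a subgroup.
  module Subgroup {g} (G : S₃ → S₃ → Set g) (G? : ∀ σ τ → Dec (G σ τ))
    (G-id : G 0F 0F)
    (G-∙ : ∀ {σ τ σ′ τ′} → G σ τ → G σ′ τ′ → G (σ ∙ σ′) (τ ∙ τ′)) where

    G-^ : ∀ {σ τ} n → G σ τ → G (σ ^ˢ n) (τ ^ˢ n)
    G-^ zero    gστ = G-id
    G-^ (suc n) gστ = G-∙ gστ (G-^ n gστ)

    private
      -- Words in two generators, long enough to contain conjugates and commutators; the two
      -- searches below succeed within this length.
      word : S₃ → S₃ → Fin 3 → Fin 3 → Fin 3 → Fin 3 → S₃
      word σ σ′ i j k l = (σ ^ˢ toℕ i ∙ σ′ ^ˢ toℕ j) ∙ (σ ^ˢ toℕ k ∙ σ′ ^ˢ toℕ l)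

      G-word : ∀ {σ τ σ′ τ′} → G σ τ → G σ′ τ′ → ∀ i j k l →
               G (word σ σ′ i j k l) (word τ τ′ i j k l)
      G-word g h i j k l =
        G-∙ (G-∙ (G-^ (toℕ i) g) (G-^ (toℕ j) h)) (G-∙ (G-^ (toℕ k) g) (G-^ (toℕ l) h))

    -- No nontrivial element of G has a trivial component exactly when G is the
    -- graph of an isomorphism between its two projections.
    IsDefect : S₃ → S₃ → Set
    IsDefect σ τ = (σ ≡ 0F × τ ≢ 0F) ⊎ (σ ≢ 0F × τ ≡ 0F)

    isDefect? : ∀ σ τ → Dec (IsDefect σ τ)
    isDefect? σ τ = (σ Finₚ.≟ 0F ×-dec ¬? (τ Finₚ.≟ 0F)) ⊎-dec (¬? (σ Finₚ.≟ 0F) ×-dec τ Finₚ.≟ 0F)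

    Fixes : S₃ → S₃ → S₃ → Set
    Fixes π σ τ = τ ∙ π ≡ π ∙ σ

    private
      abstract
        -- If `τ` is a transposition, squaring the first pair clears it. If `τ` is a 3-cycle, a
        -- defect consisting of a 3-cycle can be used directly to clear `τ` or as the rotation
        -- sought, and a defect consisting of a transposition inverts by conjugation the 3-cycle in
        -- its own component only, which separates `σ` from `τ`.
        rotation-from-defect : ∀ σ τ σ′ τ′ → IsRotation σ → IsDefect σ′ τ′ →
          ∃[ i ] ∃[ j ] ∃[ k ] ∃[ l ] (word σ σ′ i j k l ≡ 1F × word τ τ′ i j k l ≡ 0F)
        rotation-from-defect = from-yes (Finₚ.all? λ σ → Finₚ.all? λ τ → Finₚ.all? λ σ′ → Finₚ.all? λ τ′ →
          isRotation? σ →-dec isDefect? σ′ τ′ →-dec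
          Finₚ.any? λ i → Finₚ.any? λ j → Finₚ.any? λ k → Finₚ.any? λ l →
          word σ σ′ i j k l Finₚ.≟ 1F ×-dec word τ τ′ i j k l Finₚ.≟ 0F)

        -- By Goursat's lemma a subgroup without defects is the graph of an isomorphism between two
        -- subgroups of `S₃`. Any such isomorphism is conjugation by some `π`: isomorphic subgroups
        -- of `S₃` are conjugate, and each automorphism of a subgroup comes from conjugation.
        defect-or-fixed : ∀ σ τ σ′ τ′ →
          (∃[ π ] (Fixes π σ τ × Fixes π σ′ τ′)) ⊎
          (∃[ i ] ∃[ j ] ∃[ k ] ∃[ l ] IsDefect (word σ σ′ i j k l) (word τ τ′ i j k l))
        defect-or-fixed = from-yes (Finₚ.all? λ σ → Finₚ.all? λ τ → Finₚ.all? λ σ′ → Finₚ.all? λ τ′ →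
          Finₚ.any? (λ π → τ ∙ π Finₚ.≟ π ∙ σ ×-dec τ′ ∙ π Finₚ.≟ π ∙ σ′) ⊎-dec
          Finₚ.any? λ i → Finₚ.any? λ j → Finₚ.any? λ k → Finₚ.any? λ l →
          isDefect? (word σ σ′ i j k l) (word τ τ′ i j k l))

        assoc : ∀ ρ σ τ → ρ ∙ σ ∙ τ ≡ ρ ∙ (σ ∙ τ)
        assoc = from-yes (Finₚ.all? λ ρ → Finₚ.all? λ σ → Finₚ.all? λ τ → ρ ∙ σ ∙ τ Finₚ.≟ ρ ∙ (σ ∙ τ))

        rightInverse-unique : ∀ σ τ → σ ∙ τ ≡ 0F → σ ≡ inv τ
        rightInverse-unique = from-yes (Finₚ.all? λ σ → Finₚ.all? λ τ → σ ∙ τ Finₚ.≟ 0F →-dec σ Finₚ.≟ inv τ)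

        Fixes-id : ∀ π → Fixes π 0F 0F
        Fixes-id = from-yes (Finₚ.all? λ π → 0F ∙ π Finₚ.≟ π ∙ 0F)

        Fixes-inv : ∀ π σ τ → Fixes π (inv σ) (inv τ) → Fixes π σ τ
        Fixes-inv = from-yes (Finₚ.all? λ π → Finₚ.all? λ σ → Finₚ.all? λ τ →
          inv τ ∙ π Finₚ.≟ π ∙ inv σ →-dec τ ∙ π Finₚ.≟ π ∙ σ)

      Fixes-∙ : ∀ π σ τ σ′ τ′ → Fixes π σ τ → Fixes π σ′ τ′ → Fixes π (σ ∙ σ′) (τ ∙ τ′)
      Fixes-∙ π σ τ σ′ τ′ f f′ = begin
        τ ∙ τ′ ∙ π    ≡⟨ assoc τ τ′ π ⟩
        τ ∙ (τ′ ∙ π)  ≡⟨ ≡.cong (τ ∙_) f′ ⟩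
        τ ∙ (π ∙ σ′)  ≡⟨ ≡.sym (assoc τ π σ′) ⟩
        τ ∙ π ∙ σ′    ≡⟨ ≡.cong (_∙ σ′) f ⟩
        π ∙ σ ∙ σ′    ≡⟨ assoc π σ σ′ ⟩
        π ∙ (σ ∙ σ′)  ∎
        where open ≡.≡-Reasoning

      Fixes-^ : ∀ π σ τ n → Fixes π σ τ → Fixes π (σ ^ˢ n) (τ ^ˢ n)
      Fixes-^ π σ τ zero    f = Fixes-id π
      Fixes-^ π σ τ (suc n) f = Fixes-∙ π σ τ _ _ f (Fixes-^ π σ τ n f)

      abstract
        -- The transposition `σ₂`, needed only for odd `σ`, makes it even, and the 3-cycle `σ₃`
        -- removes the rotation that may remain. So two elements generate the first projection.
        clear-first : ∀ σ₃ σ₂ σ → (odd σ ≡ true → odd σ₂ ≡ true) →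
          (IsRotation σ ⊎ IsRotation (σ₂ ∙ σ) → IsRotation σ₃) →
          ∃[ i ] ∃[ j ] σ₃ ^ˢ toℕ {3} i ∙ (σ₂ ^ˢ toℕ {3} j ∙ σ) ≡ 0F
        clear-first = from-yes (Finₚ.all? λ σ₃ → Finₚ.all? λ σ₂ → Finₚ.all? λ σ →
          (odd σ Bool.≟ true →-dec odd σ₂ Bool.≟ true) →-dec
          ((isRotation? σ ⊎-dec isRotation? (σ₂ ∙ σ)) →-dec isRotation? σ₃) →-dec
          Finₚ.any? λ i → Finₚ.any? λ j → σ₃ ^ˢ toℕ {3} i ∙ (σ₂ ^ˢ toℕ {3} j ∙ σ) Finₚ.≟ 0F)

    private
      -- The identity is the default when no first component satisfies `P`; the implication is then
      -- vacuous.
      pick : (P : S₃ → Set) → (∀ σ → Dec (P σ)) →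
             ∃[ σ ] ∃[ τ ] (G σ τ × (∀ {σ′ τ′} → G σ′ τ′ → P σ′ → P σ))
      pick P P? with Finₚ.any? (λ σ → Finₚ.any? λ τ → G? σ τ ×-dec P? σ)
      ... | yes (σ , τ , gστ , p) = σ , τ , gστ , λ _ _ → p
      ... | no ¬p = 0F , 0F , G-id , λ g p → contradiction (_ , _ , g , p) ¬p

    -- Without defects the second component is determined by the first, so a `π` that is compatible
    -- with generators of the first projection is compatible with all of `G`.
    fixed-or-defect : (∃[ π ] (∀ {σ τ} → G σ τ → Fixes π σ τ)) ⊎ (∃[ σ ] ∃[ τ ] (G σ τ × IsDefect σ τ))
    fixed-or-defect with Finₚ.any? (λ σ → Finₚ.any? λ τ → G? σ τ ×-dec isDefect? σ τ)
    ... | yes d = inj₂ d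
    ... | no ¬d with pick IsRotation isRotation? | pick (λ σ → odd σ ≡ true) (λ σ → odd σ Bool.≟ true)
    ...   | σ₃ , τ₃ , g₃ , rot | σ₂ , τ₂ , g₂ , odd₂ with defect-or-fixed σ₃ τ₃ σ₂ τ₂
    ...     | inj₂ (i , j , k , l , d) = contradiction (_ , _ , G-word g₃ g₂ i j k l , d) ¬d
    ...     | inj₁ (π , f₃ , f₂) = inj₁ (π , λ {σ} {τ} → fixed σ τ)
      where
      fixed : ∀ σ τ → G σ τ → Fixes π σ τ
      fixed σ τ g with clear-first σ₃ σ₂ σ (odd₂ g) [ rot g , rot (G-∙ g₂ g) ]′
      ... | i , j , cleared = Fixes-inv π σ τ (≡.subst₂ (Fixes π)
              (rightInverse-unique (σ₃ ^ˢ toℕ i ∙ σ₂ ^ˢ toℕ j) σ (≡.trans (assoc (σ₃ ^ˢ toℕ i) (σ₂ ^ˢ toℕ j) σ) cleared))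
              (rightInverse-unique (τ₃ ^ˢ toℕ i ∙ τ₂ ^ˢ toℕ j) τ (≡.trans (assoc (τ₃ ^ˢ toℕ i) (τ₂ ^ˢ toℕ j) τ) cleared′))
              (Fixes-∙ π (σ₃ ^ˢ toℕ i) (τ₃ ^ˢ toℕ i) (σ₂ ^ˢ toℕ j) (τ₂ ^ˢ toℕ j)
                (Fixes-^ π σ₃ τ₃ (toℕ i) f₃) (Fixes-^ π σ₂ τ₂ (toℕ j) f₂)))
        where
        cleared′ : τ₃ ^ˢ toℕ i ∙ (τ₂ ^ˢ toℕ j ∙ τ) ≡ 0F
        cleared′ with τ₃ ^ˢ toℕ i ∙ (τ₂ ^ˢ toℕ j ∙ τ) Finₚ.≟ 0F
        ... | yes eq = eq
        -- The product has trivial first component, so a nontrivial second one would be a defect.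
        ... | no neq = contradiction
          (_ , _ , G-∙ (G-^ (toℕ i) g₃) (G-∙ (G-^ (toℕ j) g₂) g) , inj₁ (cleared , neq)) ¬d

    -- The dichotomy behind all cases: `La` and `Lb` turn out equal in the first alternative, and in
    -- the second the x's can be rotated while the y's stay fixed.
    fixed-or-rotation : ∀ {σ τ} → G σ τ → IsRotation σ →
                        (∃[ π ] (∀ {σ τ} → G σ τ → Fixes π σ τ)) ⊎ G 1F 0F
    fixed-or-rotation {σ} {τ} g rot with fixed-or-defect
    ... | inj₁ fixed = inj₁ fixed
    ... | inj₂ (σ′ , τ′ , g′ , d) with rotation-from-defect σ τ σ′ τ′ rot d
    ...   | i , j , k , l , eq , eq′ = inj₂ (≡.subst₂ G eq eq′ (G-word g g′ i j k l))

    IsOrbit : List S₃ → Set g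
    IsOrbit O = (∀ {σ τ π} → G σ τ → π ∈ O → move σ τ π ∈ O)
              × (∃[ π₀ ] (π₀ ∈ O × (∀ {π} → π ∈ O → ∃[ σ ] ∃[ τ ] (G σ τ × move σ τ π₀ ≡ π))))

    private
      transitive-from : ∀ {σ τ} O π₀ → G 1F 0F → G σ τ →
        (∀ π → π ∈ O → ∃[ i ] ∃[ j ] move (1F ^ˢ toℕ {3} i ∙ σ ^ˢ toℕ {2} j) (0F ^ˢ toℕ {3} i ∙ τ ^ˢ toℕ {2} j) π₀ ≡ π) →
        ∀ {π} → π ∈ O → ∃[ σ ] ∃[ τ ] (G σ τ × move σ τ π₀ ≡ π)
      transitive-from O π₀ r g reach π∈O with reach _ π∈O
      ... | i , j , eq = _ , _ , G-∙ (G-^ (toℕ i) r) (G-^ (toℕ j) g) , eq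

      all-bijections : List S₃
      all-bijections = rotations List.++ reflections

      abstract
        ∈-all : ∀ π → π ∈ all-bijections
        ∈-all = from-yes (Finₚ.all? λ π → π ∈? all-bijections)

    -- Multiplication by rotations on the right is transitive on the bijections of one parity, and a
    -- pair whose components differ in parity exchanges the two parities.
    orbit-all : ∀ {σ τ} → G 1F 0F → G σ τ → odd σ ≢ odd τ → IsOrbit (rotations List.++ reflections)
    orbit-all {σ} {τ} r g odd≢ = (λ _ _ → ∈-all _) , 0F , ∈-all 0F ,
      transitive-from all-bijections 0F r g (λ π _ → reach σ τ odd≢ π)
      where
      abstract
        reach : ∀ σ τ → odd σ ≢ odd τ → ∀ π →
          ∃[ i ] ∃[ j ] move (1F ^ˢ toℕ {3} i ∙ σ ^ˢ toℕ {2} j) (0F ^ˢ toℕ {3} i ∙ τ ^ˢ toℕ {2} j) 0F ≡ π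
        reach = from-yes (Finₚ.all? λ σ → Finₚ.all? λ τ → ¬? (odd σ Bool.≟ odd τ) →-dec (Finₚ.all? λ π →
          Finₚ.any? λ i → Finₚ.any? λ j → move (1F ^ˢ toℕ {3} i ∙ σ ^ˢ toℕ {2} j) (0F ^ˢ toℕ {3} i ∙ τ ^ˢ toℕ {2} j) 0F Finₚ.≟ π))

    -- When the parities agree, `τ π σ⁻¹` has the parity of `π`, so the two cosets of the rotations
    -- cannot merge.
    orbits-parity : G 1F 0F → (∀ {σ τ} → G σ τ → odd σ ≡ odd τ) → IsOrbit rotations × IsOrbit reflections
    orbits-parity r odd≡ =
      ( (λ {σ} {τ} {π} g → proj₁ (stable σ τ (odd≡ g) π))
      , 0F , from-yes (0F ∈? rotations) , transitive-from rotations 0F r G-id (proj₁ reach)) ,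
      ( (λ {σ} {τ} {π} g → proj₂ (stable σ τ (odd≡ g) π))
      , 3F , from-yes (3F ∈? reflections) , transitive-from reflections 3F r G-id (proj₂ reach))
      where
      abstract
        stable : ∀ σ τ → odd σ ≡ odd τ → ∀ π → (π ∈ rotations → move σ τ π ∈ rotations)
                                             × (π ∈ reflections → move σ τ π ∈ reflections)
        stable = from-yes (Finₚ.all? λ σ → Finₚ.all? λ τ → odd σ Bool.≟ odd τ →-dec (Finₚ.all? λ π →
          (π ∈? rotations →-dec move σ τ π ∈? rotations) ×-dec
          (π ∈? reflections →-dec move σ τ π ∈? reflections)))

      Reach : List S₃ → S₃ → Set
      Reach O π₀ = ∀ π → π ∈ O →
        ∃[ i ] ∃[ j ] move (1F ^ˢ toℕ {3} i ∙ 0F ^ˢ toℕ {2} j) (0F ^ˢ toℕ {3} i ∙ 0F ^ˢ toℕ {2} j) π₀ ≡ π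

      reach? : ∀ O π₀ → Dec (Reach O π₀)
      reach? O π₀ = Finₚ.all? λ π → π ∈? O →-dec Finₚ.any? λ i → Finₚ.any? λ j →
        move (1F ^ˢ toℕ {3} i ∙ 0F ^ˢ toℕ {2} j) (0F ^ˢ toℕ {3} i ∙ 0F ^ˢ toℕ {2} j) π₀ Finₚ.≟ π

      abstract
        reach : Reach rotations 0F × Reach reflections 3F
        reach = from-yes (reach? rotations 0F) , from-yes (reach? reflections 3F)

    module _ (π : S₃) (fixed : ∀ {σ τ} → G σ τ → Fixes π σ τ) where
      private
        conj : S₃ → S₃ → S₃
        conj σ ρ = σ ∙ ρ ∙ inv σ

        abstract
          -- Here `τ = π σ π⁻¹`, so that writing the bijections as `π ∙ ρ` turns the action into
          -- conjugation of `ρ` by `σ`.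
          move-fixed : ∀ π σ τ → Fixes π σ τ → ∀ ρ → move σ τ (π ∙ ρ) ≡ π ∙ conj σ ρ
          move-fixed = from-yes (Finₚ.all? λ π → Finₚ.all? λ σ → Finₚ.all? λ τ → τ ∙ π Finₚ.≟ π ∙ σ →-dec
            (Finₚ.all? λ ρ → move σ τ (π ∙ ρ) Finₚ.≟ π ∙ conj σ ρ))

        orbit-conj : ∀ O ρ₀ → ρ₀ ∈ O → (∀ {σ τ} → G σ τ → ∀ {ρ} → ρ ∈ O → conj σ ρ ∈ O) →
          (∀ {ρ} → ρ ∈ O → ∃[ σ ] ∃[ τ ] (G σ τ × conj σ ρ₀ ≡ ρ)) → IsOrbit (List.map (π ∙_) O)
        orbit-conj O ρ₀ ρ₀∈O stable transitive =
          stable′ , π ∙ ρ₀ , ∈-map⁺ (π ∙_) ρ₀∈O , transitive′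
          where
          stable′ : ∀ {σ τ π′} → G σ τ → π′ ∈ List.map (π ∙_) O → move σ τ π′ ∈ List.map (π ∙_) O
          stable′ {σ} {τ} g π′∈ with ∈-map⁻ (π ∙_) π′∈
          ... | ρ , ρ∈O , ≡.refl = ≡.subst (_∈ List.map (π ∙_) O) (≡.sym (move-fixed π σ τ (fixed g) ρ))
                                   (∈-map⁺ (π ∙_) (stable g ρ∈O))

          transitive′ : ∀ {π′} → π′ ∈ List.map (π ∙_) O → ∃[ σ ] ∃[ τ ] (G σ τ × move σ τ (π ∙ ρ₀) ≡ π′)
          transitive′ π′∈ with ∈-map⁻ (π ∙_) π′∈
          ... | ρ , ρ∈O , ≡.refl with transitive ρ∈O
          ...   | σ , τ , g , ≡.refl = σ , τ , g , move-fixed π σ τ (fixed g) ρ₀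

        conj-closed : (O : List S₃) (P : S₃ → Set) → (∀ σ → Dec (P σ)) → Set
        conj-closed O P _ = ∀ σ → P σ → ∀ ρ → ρ ∈ O → conj σ ρ ∈ O

        conj-closed? : ∀ O P P? → Dec (conj-closed O P P?)
        conj-closed? O P P? = Finₚ.all? λ σ → P? σ →-dec (Finₚ.all? λ ρ → ρ ∈? O →-dec conj σ ρ ∈? O)

        always : (σ : S₃) → Dec ⊤
        always _ = yes tt

        even? : ∀ σ → Dec (odd σ ≡ false)
        even? σ = odd σ Bool.≟ false

      orbit-fixed : IsOrbit (List.map (π ∙_) (0F ∷ []))
      orbit-fixed = orbit-conj _ 0F (from-yes (0F ∈? (0F ∷ [])))
        (λ {σ} _ {ρ} → from-yes (conj-closed? (0F ∷ []) _ always) σ tt ρ)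
        (λ { (here ≡.refl) → 0F , 0F , G-id , ≡.refl })

      orbit-reflections : ∀ {σ τ} → G σ τ → IsRotation σ → IsOrbit (List.map (π ∙_) reflections)
      orbit-reflections {σ} g rot = orbit-conj _ 3F (from-yes (3F ∈? reflections))
        (λ {σ} _ {ρ} → from-yes (conj-closed? reflections _ always) σ tt ρ)
        (λ {ρ} ρ∈ → let i , eq = reach σ rot ρ ρ∈ in _ , _ , G-^ (toℕ i) g , eq)
        where
        abstract
          reach : ∀ σ → IsRotation σ → ∀ ρ → ρ ∈ reflections → ∃[ i ] conj (σ ^ˢ toℕ {3} i) 3F ≡ ρ
          reach = from-yes (Finₚ.all? λ σ → isRotation? σ →-dec (Finₚ.all? λ ρ → ρ ∈? reflections →-dec
            Finₚ.any? λ i → conj (σ ^ˢ toℕ {3} i) 3F Finₚ.≟ ρ))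

      orbit-rotations : ∀ {σ τ} → G σ τ → odd σ ≡ true → IsOrbit (List.map (π ∙_) (1F ∷ 2F ∷ []))
      orbit-rotations {σ} {τ} g odd-σ = orbit-conj _ 1F (from-yes (1F ∈? (1F ∷ 2F ∷ [])))
        (λ {σ} _ {ρ} → from-yes (conj-closed? (1F ∷ 2F ∷ []) _ always) σ tt ρ)
        (λ { (here ≡.refl) → 0F , 0F , G-id , ≡.refl
           ; (there (here ≡.refl)) → σ , τ , g , swap σ odd-σ })
        where
        abstract
          swap : ∀ σ → odd σ ≡ true → conj σ 1F ≡ 2F
          swap = from-yes (Finₚ.all? λ σ → odd σ Bool.≟ true →-dec conj σ 1F Finₚ.≟ 2F)

      orbits-even : (∀ {σ τ} → G σ τ → odd σ ≡ false) →
        IsOrbit (List.map (π ∙_) (1F ∷ [])) × IsOrbit (List.map (π ∙_) (2F ∷ []))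
      orbits-even even =
        orbit-conj _ 1F (from-yes (1F ∈? (1F ∷ [])))
          (λ {σ} g {ρ} → from-yes (conj-closed? (1F ∷ []) _ even?) σ (even g) ρ)
          (λ { (here ≡.refl) → 0F , 0F , G-id , ≡.refl }) ,
        orbit-conj _ 2F (from-yes (2F ∈? (2F ∷ [])))
          (λ {σ} g {ρ} → from-yes (conj-closed? (2F ∷ []) _ even?) σ (even g) ρ)
          (λ { (here ≡.refl) → 0F , 0F , G-id , ≡.refl })

-- Coefficients, degrees and roots of polynomials.

module PolynomialProperties {c ℓ} (R : CommutativeRing c ℓ) where
  open CommutativeRing R
  open Algebra.Properties.Ring ring using (-0#≈0#)
  open Polynomial (CommutativeRing.rawRing R)
  open SetoidReasoning (CommutativeRing.setoid R)

  infix 4 _≋_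
  _≋_ : Poly → Poly → Set ℓ
  f ≋ g = ∀ n → coeff f n ≈ coeff g n

  coeff-+ : ∀ f g n → coeff (f +ₚ g) n ≈ coeff f n + coeff g n
  coeff-+ []      g       n       = sym (+-identityˡ _)
  coeff-+ (x ∷ f) []      n       = sym (+-identityʳ _)
  coeff-+ (x ∷ f) (y ∷ g) zero    = refl
  coeff-+ (x ∷ f) (y ∷ g) (suc n) = coeff-+ f g n

  coeff-scale : ∀ x f n → coeff (map (x *_) f) n ≈ x * coeff f n
  coeff-scale x []      n       = sym (zeroʳ x)
  coeff-scale x (y ∷ f) zero    = refl
  coeff-scale x (y ∷ f) (suc n) = coeff-scale x f n

  coeff-neg : ∀ f n → coeff (map (-_) f) n ≈ - coeff f n
  coeff-neg []      n       = sym -0#≈0#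
  coeff-neg (y ∷ f) zero    = refl
  coeff-neg (y ∷ f) (suc n) = coeff-neg f n

  DegreeBelow : Poly → ℕ → Set ℓ
  DegreeBelow f n = ∀ m → n ℕ.≤ m → coeff f m ≈ 0#

  -- The coefficient `x` may be zero, in which case `n` is only a bound for the degree. This makes
  -- sums and products work over every commutative ring.
  Leading : Poly → ℕ → Carrier → Set ℓ
  Leading f n x = coeff f n ≈ x × DegreeBelow f (suc n)

  zero-*ₚ : ∀ f g → f ≋ [] → f *ₚ g ≋ []
  zero-*ₚ []      g f≋0 n = refl
  zero-*ₚ (x ∷ f) g f≋0 n = begin
    coeff (map (x *_) g +ₚ (0# ∷ f *ₚ g)) n       ≈⟨ coeff-+ (map (x *_) g) _ n ⟩
    coeff (map (x *_) g) n + coeff (0# ∷ f *ₚ g) n ≈⟨ +-cong (coeff-scale x g n) (tail n) ⟩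
    x * coeff g n + 0#                             ≈⟨ +-identityʳ _ ⟩
    x * coeff g n                                  ≈⟨ *-congʳ (f≋0 0) ⟩
    0# * coeff g n                                 ≈⟨ zeroˡ _ ⟩
    0#                                             ∎
    where
    tail : ∀ n → coeff (0# ∷ f *ₚ g) n ≈ 0#
    tail zero    = refl
    tail (suc n) = zero-*ₚ f g (f≋0 ∘ suc) n

  -- The asymmetric bounds avoid subtraction: degrees at most m - 1 and n add up to at most m + n -
  -- 1.
  DegreeBelow-* : ∀ f g m n → DegreeBelow f m → DegreeBelow g (suc n) → DegreeBelow (f *ₚ g) (m ℕ.+ n)
  DegreeBelow-* []      g m       n f< g< k       m+n≤k = refl
  DegreeBelow-* (x ∷ f) g zero    n f< g< k       m+n≤k = zero-*ₚ (x ∷ f) g (λ j → f< j z≤n) k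
  DegreeBelow-* (x ∷ f) g (suc m) n f< g< (suc k) (s≤s m+n≤k) = begin
    coeff (map (x *_) g +ₚ (0# ∷ f *ₚ g)) (suc k)   ≈⟨ coeff-+ (map (x *_) g) _ (suc k) ⟩
    coeff (map (x *_) g) (suc k) + coeff (f *ₚ g) k ≈⟨ +-cong (coeff-scale x g (suc k)) (DegreeBelow-* f g m n (λ j m≤j → f< (suc j) (s≤s m≤j)) g< k m+n≤k) ⟩
    x * coeff g (suc k) + 0#                        ≈⟨ +-identityʳ _ ⟩
    x * coeff g (suc k)                             ≈⟨ *-congˡ (g< (suc k) (s≤s (ℕₚ.≤-trans (ℕₚ.m≤n+m n m) m+n≤k))) ⟩
    x * 0#                                          ≈⟨ zeroʳ x ⟩
    0#                                              ∎

  Leading-* : ∀ f g {m n x y} → Leading f m x → Leading g n y → Leading (f *ₚ g) (m ℕ.+ n) (x * y)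
  Leading-* f g {m} {n} {x} {y} lf lg = top f m lf , DegreeBelow-* f g (suc m) n (proj₂ lf) (proj₂ lg)
    where
    top : ∀ f m → Leading f m x → coeff (f *ₚ g) (m ℕ.+ n) ≈ x * y
    top []      m       (0≈x , _) = sym (trans (*-congʳ (sym 0≈x)) (zeroˡ y))
    top (z ∷ f) zero    (z≈x , f<) = begin
      coeff (map (z *_) g +ₚ (0# ∷ f *ₚ g)) n        ≈⟨ coeff-+ (map (z *_) g) _ n ⟩
      coeff (map (z *_) g) n + coeff (0# ∷ f *ₚ g) n ≈⟨ +-cong (coeff-scale z g n) (tail n) ⟩
      z * coeff g n + 0#                             ≈⟨ +-identityʳ _ ⟩
      z * coeff g n                                  ≈⟨ *-cong z≈x (proj₁ lg) ⟩
      x * y                                          ∎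
      where
      tail : ∀ n → coeff (0# ∷ f *ₚ g) n ≈ 0#
      tail zero    = refl
      tail (suc n) = zero-*ₚ f g (λ j → f< (suc j) (s≤s z≤n)) n
    top (z ∷ f) (suc m) (f≈x , f<) = begin
      coeff (map (z *_) g +ₚ (0# ∷ f *ₚ g)) (suc (m ℕ.+ n))             ≈⟨ coeff-+ (map (z *_) g) _ _ ⟩
      coeff (map (z *_) g) (suc (m ℕ.+ n)) + coeff (f *ₚ g) (m ℕ.+ n)   ≈⟨ +-cong (coeff-scale z g _) (top f m (f≈x , λ j m<j → f< (suc j) (s≤s m<j))) ⟩
      z * coeff g (suc (m ℕ.+ n)) + x * y                               ≈⟨ +-congʳ (*-congˡ (proj₂ lg _ (s≤s (ℕₚ.m≤n+m n m)))) ⟩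
      z * 0# + x * y                                                    ≈⟨ +-congʳ (zeroʳ z) ⟩
      0# + x * y                                                        ≈⟨ +-identityˡ _ ⟩
      x * y                                                             ∎

  Leading-+ : ∀ f g {n x y} → Leading f n x → Leading g n y → Leading (f +ₚ g) n (x + y)
  Leading-+ f g {n} (f≈ , f<) (g≈ , g<) =
    trans (coeff-+ f g n) (+-cong f≈ g≈) ,
    λ m n<m → trans (coeff-+ f g m) (trans (+-cong (f< m n<m) (g< m n<m)) (+-identityʳ 0#))

  Leading-neg : ∀ f {n x} → Leading f n x → Leading (map (-_) f) n (- x)
  Leading-neg f (f≈ , f<) =
    trans (coeff-neg f _) (-‿cong f≈) , λ m n<m → trans (coeff-neg f m) (trans (-‿cong (f< m n<m)) -0#≈0#)

  Leading-C : ∀ x → Leading (C x) 0 x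
  Leading-C x = refl , λ { (suc m) _ → refl }

  Leading-resp : ∀ f g {n x y} → f ≋ g → x ≈ y → Leading f n x → Leading g n y
  Leading-resp f g f≋g x≈y (eq , above) =
    trans (sym (f≋g _)) (trans eq x≈y) , λ m n<m → trans (sym (f≋g m)) (above m n<m)

  Leading-+-lower : ∀ f g {n x} → Leading f n x → DegreeBelow g n → Leading (f +ₚ g) n x
  Leading-+-lower f g (eq , above) g< =
    trans (coeff-+ f g _) (trans (+-cong eq (g< _ ℕₚ.≤-refl)) (+-identityʳ _)) ,
    λ m n<m → trans (coeff-+ f g m) (trans (+-cong (above m n<m) (g< m (ℕₚ.<⇒≤ n<m))) (+-identityʳ _))

  DegreeBelow-neg : ∀ f {n} → DegreeBelow f n → DegreeBelow (map (-_) f) n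
  DegreeBelow-neg f f< m n≤m = trans (coeff-neg f m) (trans (-‿cong (f< m n≤m)) -0#≈0#)

  open SemiringDefinitions (RawRing.rawSemiring polyRing) using () renaming (_^_ to _^ₚ_; _×_ to _·ₚ_)

  DegreeBelow-· : ∀ k f {n} → DegreeBelow f n → DegreeBelow (k ·ₚ f) n
  DegreeBelow-· zero    f f< m n≤m = refl
  DegreeBelow-· (suc k) f f< m n≤m =
    trans (coeff-+ f (k ·ₚ f) m) (trans (+-cong (f< m n≤m) (DegreeBelow-· k f f< m n≤m)) (+-identityʳ _))

  Leading-X : Leading X 1 1#
  Leading-X = refl , λ { (suc zero) (s≤s ()) ; (suc (suc m)) _ → refl }

  Leading-monic-^ : ∀ f k {m} → Leading f m 1# → Leading (f ^ₚ k) (k ℕ.* m) 1#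
  Leading-monic-^ f zero    lf = Leading-C 1#
  Leading-monic-^ f (suc k) lf =
    Leading-resp (f *ₚ f ^ₚ k) (f *ₚ f ^ₚ k) (λ _ → refl) (*-identityˡ 1#) (Leading-* f (f ^ₚ k) lf (Leading-monic-^ f k lf))

  eval-zero : ∀ f z → f ≋ [] → eval f z ≈ 0#
  eval-zero []      z f≋0 = refl
  eval-zero (y ∷ f) z f≋0 = begin
    y + z * eval f z  ≈⟨ +-cong (f≋0 0) (*-congˡ (eval-zero f z (f≋0 ∘ suc))) ⟩
    0# + z * 0#       ≈⟨ +-identityˡ _ ⟩
    z * 0#            ≈⟨ zeroʳ z ⟩
    0#                ∎

  eval-+ : ∀ f g z → eval (f +ₚ g) z ≈ eval f z + eval g z
  eval-+ []      g       z = sym (+-identityˡ _)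
  eval-+ (x ∷ f) []      z = sym (+-identityʳ _)
  eval-+ (x ∷ f) (y ∷ g) z = begin
    x + y + z * eval (f +ₚ g) z           ≈⟨ +-congˡ (*-congˡ (eval-+ f g z)) ⟩
    x + y + z * (eval f z + eval g z)     ≈⟨ RingIdentities.horner-+ R x y z _ _ ⟩
    x + z * eval f z + (y + z * eval g z) ∎

  eval-scale : ∀ x f z → eval (map (x *_) f) z ≈ x * eval f z
  eval-scale x []      z = sym (zeroʳ x)
  eval-scale x (y ∷ f) z = begin
    x * y + z * eval (map (x *_) f) z ≈⟨ +-congˡ (*-congˡ (eval-scale x f z)) ⟩
    x * y + z * (x * eval f z)        ≈⟨ RingIdentities.horner-scale R x y z _ ⟩
    x * (y + z * eval f z)            ∎

  eval-neg : ∀ f z → eval (map (-_) f) z ≈ - eval f z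
  eval-neg []      z = sym -0#≈0#
  eval-neg (y ∷ f) z = begin
    - y + z * eval (map (-_) f) z  ≈⟨ +-congˡ (*-congˡ (eval-neg f z)) ⟩
    - y + z * - eval f z           ≈⟨ RingIdentities.horner-neg R y z _ ⟩
    - (y + z * eval f z)           ∎

  eval-* : ∀ f g z → eval (f *ₚ g) z ≈ eval f z * eval g z
  eval-* []      g z = sym (zeroˡ _)
  eval-* (x ∷ f) g z = begin
    eval (map (x *_) g +ₚ (0# ∷ f *ₚ g)) z          ≈⟨ eval-+ (map (x *_) g) _ z ⟩
    eval (map (x *_) g) z + (0# + z * eval (f *ₚ g) z) ≈⟨ +-cong (eval-scale x g z) (+-congˡ (*-congˡ (eval-* f g z))) ⟩
    x * eval g z + (0# + z * (eval f z * eval g z)) ≈⟨ RingIdentities.horner-* R x z _ _ ⟩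
    (x + z * eval f z) * eval g z                   ∎

  eval-cong : ∀ f g {z w} → f ≋ g → z ≈ w → eval f z ≈ eval g w
  eval-cong []      g       {w = w} f≋g z≈w = sym (eval-zero g w (λ n → sym (f≋g n)))
  eval-cong (x ∷ f) []      {z} f≋g z≈w = eval-zero (x ∷ f) z f≋g
  eval-cong (x ∷ f) (y ∷ g) f≋g z≈w = +-cong (f≋g 0) (*-cong z≈w (eval-cong f g (f≋g ∘ suc) z≈w))

  -- Synthetic division by X - z: the coefficients of the quotient are the values at `z` of the
  -- tails of `f`.
  quotient : Carrier → Poly → Poly
  quotient z []      = []
  quotient z (y ∷ f) = eval f z ∷ quotient z f

  eval-quotient : ∀ z f w → eval f w ≈ (w - z) * eval (quotient z f) w + eval f z
  eval-quotient z []      w = sym (trans (+-identityʳ _) (zeroʳ _))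
  eval-quotient z (y ∷ f) w = begin
    y + w * eval f w                                ≈⟨ +-congˡ (*-congˡ (eval-quotient z f w)) ⟩
    y + w * ((w - z) * eval (quotient z f) w + eval f z)
      ≈⟨ RingIdentities.horner-quotient R y w z _ _ ⟩
    (w - z) * (eval f z + w * eval (quotient z f) w) + (y + z * eval f z) ∎

  quotient-zero : ∀ z f → f ≋ [] → quotient z f ≋ []
  quotient-zero z []      f≋0 n       = refl
  quotient-zero z (y ∷ f) f≋0 zero    = eval-zero f z (f≋0 ∘ suc)
  quotient-zero z (y ∷ f) f≋0 (suc n) = quotient-zero z f (f≋0 ∘ suc) n

  quotient-degree : ∀ z f n → DegreeBelow f (suc n) → DegreeBelow (quotient z f) n
  quotient-degree z []      n       f< m       n≤m = refl
  quotient-degree z (y ∷ f) zero    f< zero    n≤m = eval-zero f z (λ n → f< (suc n) (s≤s z≤n))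
  quotient-degree z (y ∷ f) zero    f< (suc m) n≤m = quotient-zero z f (λ n → f< (suc n) (s≤s z≤n)) m
  quotient-degree z (y ∷ f) (suc n) f< (suc m) (s≤s n≤m) =
    quotient-degree z f n (λ j n<j → f< (suc j) (s≤s n<j)) m n≤m

  quotient-reflects-zero : ∀ z f → eval f z ≈ 0# → quotient z f ≋ [] → f ≋ []
  quotient-reflects-zero z []      _    q≋0 n       = refl
  quotient-reflects-zero z (y ∷ f) fz≈0 q≋0 (suc n) =
    quotient-reflects-zero z f (q≋0 0) (q≋0 ∘ suc) n
  quotient-reflects-zero z (y ∷ f) fz≈0 q≋0 zero    = begin
    y                ≈⟨ sym (+-identityʳ y) ⟩
    y + 0#           ≈⟨ +-congˡ (sym (trans (*-congˡ (q≋0 0)) (zeroʳ z))) ⟩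
    y + z * eval f z ≈⟨ fz≈0 ⟩
    0#               ∎

  rootsPoly : List Carrier → Poly
  rootsPoly []       = 1# ∷ []
  rootsPoly (z ∷ zs) = (- z ∷ 1# ∷ []) *ₚ rootsPoly zs

  Leading-linear : ∀ z → Leading (- z ∷ 1# ∷ []) 1 1#
  Leading-linear z = refl , λ { (suc (suc m)) _ → refl ; (suc zero) (s≤s ()) }

  Leading-rootsPoly : ∀ zs → Leading (rootsPoly zs) (length zs) 1#
  Leading-rootsPoly []       = Leading-C 1#
  Leading-rootsPoly (z ∷ zs) =
    let eq , below = Leading-* (- z ∷ 1# ∷ []) (rootsPoly zs)
                       (Leading-linear z)
                       (Leading-rootsPoly zs)
    in trans eq (*-identityˡ 1#) , below

  eval-linear : ∀ z w → eval (- z ∷ 1# ∷ []) w ≈ w - z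
  eval-linear z w = RingIdentities.horner-linear R z w

  eval-rootsPoly : ∀ z zs w → eval (rootsPoly (z ∷ zs)) w ≈ (w - z) * eval (rootsPoly zs) w
  eval-rootsPoly z zs w = trans (eval-* (- z ∷ 1# ∷ []) (rootsPoly zs) w) (*-congʳ (eval-linear z w))

  rootsPoly-vanishes : ∀ zs → All (λ z → eval (rootsPoly zs) z ≈ 0#) zs
  rootsPoly-vanishes []       = []
  rootsPoly-vanishes (z ∷ zs) =
    trans (eval-rootsPoly z zs z) (trans (*-congʳ (-‿inverseʳ z)) (zeroˡ _)) ∷
    All.map (λ {w} eq → trans (eval-rootsPoly z zs w) (trans (*-congˡ eq) (zeroʳ _))) (rootsPoly-vanishes zs)

  Distinct : List Carrier → Set (c ⊔ ℓ)
  Distinct = AllPairs (λ x y → ¬ (x ≈ y))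

  coeff-linear-zero : ∀ z q → coeff ((- z ∷ 1# ∷ []) *ₚ q) 0 ≈ - z * coeff q 0
  coeff-linear-zero z q = trans (coeff-+ (map (- z *_) q) _ 0)
    (trans (+-identityʳ _) (coeff-scale (- z) q 0))

  coeff-linear-suc : ∀ z q n → coeff ((- z ∷ 1# ∷ []) *ₚ q) (suc n) ≈ - z * coeff q (suc n) + coeff q n
  coeff-linear-suc z q n = trans (coeff-+ (map (- z *_) q) _ (suc n))
    (+-cong (coeff-scale (- z) q (suc n)) (trans (coeff-+ (map (1# *_) q) _ n)
      (trans (+-cong (trans (coeff-scale 1# q n) (*-identityˡ _)) (zeroes n)) (+-identityʳ _))))
    where
    zeroes : ∀ n → coeff (0# ∷ []) n ≈ 0#
    zeroes zero    = refl
    zeroes (suc n) = refl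

  coeff-quotient : ∀ z f n → coeff f n ≈ - z * coeff (quotient z f) n + coeff (eval f z ∷ quotient z f) n
  coeff-quotient z []      zero    = sym (trans (+-identityʳ _) (zeroʳ _))
  coeff-quotient z []      (suc n) = sym (trans (+-identityʳ _) (zeroʳ _))
  coeff-quotient z (y ∷ f) zero    = RingIdentities.horner-root R z y (eval f z)
  coeff-quotient z (y ∷ f) (suc n) = coeff-quotient z f n

  factor-root : ∀ z f → eval f z ≈ 0# → (- z ∷ 1# ∷ []) *ₚ quotient z f ≋ f
  factor-root z f fz≈0 zero    = trans (coeff-linear-zero z (quotient z f))
    (sym (trans (coeff-quotient z f 0) (trans (+-congˡ fz≈0) (+-identityʳ _))))
  factor-root z f fz≈0 (suc n) = trans (coeff-linear-suc z (quotient z f) n) (sym (coeff-quotient z f (suc n)))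

  x-y≈0⇒x≈y : ∀ x y → x - y ≈ 0# → x ≈ y
  x-y≈0⇒x≈y x y eq = begin
    x           ≈⟨ RingIdentities.difference-+ R x y ⟩
    (x - y) + y ≈⟨ +-congʳ eq ⟩
    0# + y      ≈⟨ +-identityˡ y ⟩
    y           ∎

  module Domain (cancel : ∀ {x y} → x * y ≈ 0# → ¬ (x ≈ 0#) → y ≈ 0#) where

    -- Dividing by X - z lowers the degree bound by one and keeps the other roots, because `w - z`
    -- can be cancelled there.
    zero-of-roots : ∀ f zs → Distinct zs → DegreeBelow f (length zs) →
                    All (λ z → eval f z ≈ 0#) zs → f ≋ []
    zero-of-roots f []       _          f< _             = λ n → f< n z≤n
    zero-of-roots f (z ∷ zs) (z≉ ∷ dis) f< (fz≈0 ∷ roots) =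
      quotient-reflects-zero z f fz≈0
        (zero-of-roots (quotient z f) zs dis (quotient-degree z f (length zs) f<)
          (All.zipWith (λ {w} (z≉w , fw≈0) → cancel {w - z}
              (begin
                (w - z) * eval (quotient z f) w             ≈⟨ sym (+-identityʳ _) ⟩
                (w - z) * eval (quotient z f) w + 0#        ≈⟨ +-congˡ (sym fz≈0) ⟩
                (w - z) * eval (quotient z f) w + eval f z  ≈⟨ sym (eval-quotient z f w) ⟩
                eval f w                                    ≈⟨ fw≈0 ⟩
                0#                                          ∎)
              (λ w-z≈0 → z≉w (sym (x-y≈0⇒x≈y w z w-z≈0))))
            (z≉ , roots)))

    -- The leading terms cancel in the difference, which is left with more roots than its degree
    -- allows. Products of linear factors are identified in this way without reordering them.
    determined-by-roots : ∀ f g x zs → Distinct zs → Leading f (length zs) x → Leading g (length zs) x →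
                          All (λ z → eval f z ≈ 0#) zs → All (λ z → eval g z ≈ 0#) zs → f ≋ g
    determined-by-roots f g x zs dis lf lg rf rg n = x-y≈0⇒x≈y _ _ (begin
      coeff f n - coeff g n         ≈⟨ +-congˡ (sym (coeff-neg g n)) ⟩
      coeff f n + coeff (map -_ g) n ≈⟨ sym (coeff-+ f _ n) ⟩
      coeff (f +ₚ map -_ g) n        ≈⟨ zero-of-roots (f +ₚ map -_ g) zs dis below
                                         (All.zipWith (λ {z} (fz , gz) → vanish z fz gz) (rf , rg)) n ⟩
      0#                             ∎)
      where
      lead : Leading (f +ₚ map -_ g) (length zs) (x - x)
      lead = Leading-+ f (map -_ g) lf (Leading-neg g lg)

      below : DegreeBelow (f +ₚ map -_ g) (length zs)
      below m n≤m with ℕₚ.m≤n⇒m<n∨m≡n n≤m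
      ... | inj₁ n<m  = proj₂ lead m n<m
      ... | inj₂ ≡.refl = trans (proj₁ lead) (-‿inverseʳ x)

      vanish : ∀ z → eval f z ≈ 0# → eval g z ≈ 0# → eval (f +ₚ map -_ g) z ≈ 0#
      vanish z fz gz = begin
        eval (f +ₚ map -_ g) z         ≈⟨ eval-+ f _ z ⟩
        eval f z + eval (map -_ g) z   ≈⟨ +-cong fz (trans (eval-neg g z) (-‿cong gz)) ⟩
        0# - 0#                        ≈⟨ -‿inverseʳ 0# ⟩
        0#                             ∎

-- Base change of polynomials along a ring homomorphism.

module PolynomialHomomorphism {c ℓ c′ ℓ′} (R : CommutativeRing c ℓ) (S : CommutativeRing c′ ℓ′)
  (φ : CommutativeRing.Carrier R → CommutativeRing.Carrier S)
  (φ-hom : IsRingHomomorphism (CommutativeRing.rawRing R) (CommutativeRing.rawRing S) φ) where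
  private
    module R = CommutativeRing R
    module S = CommutativeRing S
    module PR = Polynomial R.rawRing
    module PS = Polynomial S.rawRing
    module QS = PolynomialProperties S
  open IsRingHomomorphism φ-hom
  open import Algebra.Definitions.RawSemiring (RawRing.rawSemiring PR.polyRing) using () renaming (_^_ to _^ₚ_)
  open import Algebra.Definitions.RawSemiring (RawRing.rawSemiring S.rawRing) using (_^_)
  open PR using (_+ₚ_; _*ₚ_)
  open PS using (eval)
  open SetoidReasoning S.setoid

  coeff-map : ∀ f n → PS.coeff (map φ f) n S.≈ φ (PR.coeff f n)
  coeff-map []      n       = S.sym 0#-homo
  coeff-map (x ∷ f) zero    = S.refl
  coeff-map (x ∷ f) (suc n) = coeff-map f n

  map-+ₚ : ∀ f g → map φ (f +ₚ g) QS.≋ map φ f PS.+ₚ map φ g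
  map-+ₚ []      g       n       = S.refl
  map-+ₚ (x ∷ f) []      n       = S.refl
  map-+ₚ (x ∷ f) (y ∷ g) zero    = +-homo x y
  map-+ₚ (x ∷ f) (y ∷ g) (suc n) = map-+ₚ f g n

  map-scale : ∀ x f → map φ (map (x R.*_) f) QS.≋ map (φ x S.*_) (map φ f)
  map-scale x []      n       = S.refl
  map-scale x (y ∷ f) zero    = *-homo x y
  map-scale x (y ∷ f) (suc n) = map-scale x f n

  map-neg : ∀ f → map φ (map R.-_ f) QS.≋ map S.-_ (map φ f)
  map-neg []      n       = S.refl
  map-neg (y ∷ f) zero    = -‿homo y
  map-neg (y ∷ f) (suc n) = map-neg f n

  map-*ₚ : ∀ f g → map φ (f *ₚ g) QS.≋ map φ f PS.*ₚ map φ g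
  map-*ₚ []      g n = S.refl
  map-*ₚ (x ∷ f) g n = begin
    PS.coeff (map φ (map (x R.*_) g +ₚ (R.0# ∷ f *ₚ g))) n     ≈⟨ map-+ₚ (map (x R.*_) g) _ n ⟩
    PS.coeff (map φ (map (x R.*_) g) PS.+ₚ (φ R.0# ∷ map φ (f *ₚ g))) n ≈⟨ QS.coeff-+ (map φ (map (x R.*_) g)) _ n ⟩
    PS.coeff (map φ (map (x R.*_) g)) n S.+ PS.coeff (φ R.0# ∷ map φ (f *ₚ g)) n
      ≈⟨ S.+-cong (map-scale x g n) (tail n) ⟩
    PS.coeff (map (φ x S.*_) (map φ g)) n S.+ PS.coeff (S.0# ∷ map φ f PS.*ₚ map φ g) n
      ≈⟨ S.sym (QS.coeff-+ (map (φ x S.*_) (map φ g)) _ n) ⟩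
    PS.coeff (map (φ x S.*_) (map φ g) PS.+ₚ (S.0# ∷ map φ f PS.*ₚ map φ g)) n ∎
    where
    tail : ∀ n → PS.coeff (φ R.0# ∷ map φ (f *ₚ g)) n S.≈ PS.coeff (S.0# ∷ map φ f PS.*ₚ map φ g) n
    tail zero    = 0#-homo
    tail (suc n) = map-*ₚ f g n

  ev : PR.Poly → S.Carrier → S.Carrier
  ev f z = eval (map φ f) z

  ev-+ : ∀ f g z → ev (f +ₚ g) z S.≈ ev f z S.+ ev g z
  ev-+ f g z = S.trans (QS.eval-cong (map φ (f +ₚ g)) (map φ f PS.+ₚ map φ g) (map-+ₚ f g) S.refl) (QS.eval-+ (map φ f) (map φ g) z)

  ev-* : ∀ f g z → ev (f *ₚ g) z S.≈ ev f z S.* ev g z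
  ev-* f g z = S.trans (QS.eval-cong (map φ (f *ₚ g)) (map φ f PS.*ₚ map φ g) (map-*ₚ f g) S.refl) (QS.eval-* (map φ f) (map φ g) z)

  ev-neg : ∀ f z → ev (map R.-_ f) z S.≈ S.- ev f z
  ev-neg f z = S.trans (QS.eval-cong (map φ (map R.-_ f)) (map S.-_ (map φ f)) (map-neg f) S.refl) (QS.eval-neg (map φ f) z)

  ev-C : ∀ x z → ev (PR.C x) z S.≈ φ x
  ev-C x z = S.trans (S.+-congˡ (S.zeroʳ z)) (S.+-identityʳ _)

  ev-X : ∀ z → ev PR.X z S.≈ z
  ev-X z = begin
    φ R.0# S.+ z S.* (φ R.1# S.+ z S.* S.0#) ≈⟨ S.+-cong 0#-homo (S.*-congˡ (S.trans (S.+-congˡ (S.zeroʳ z)) (S.trans (S.+-identityʳ _) 1#-homo))) ⟩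
    S.0# S.+ z S.* S.1#                      ≈⟨ S.+-identityˡ _ ⟩
    z S.* S.1#                               ≈⟨ S.*-identityʳ z ⟩
    z                                        ∎

  ev-isRingHomomorphism : ∀ z → IsRingHomomorphism PR.polyRing S.rawRing (λ f → ev f z)
  ev-isRingHomomorphism z = record
    { isSemiringHomomorphism = record
      { isNearSemiringHomomorphism = record
        { +-isMonoidHomomorphism = record
          { isMagmaHomomorphism = record
            { isRelHomomorphism = record { cong = λ {f} {g} f≋g → QS.eval-cong (map φ f) (map φ g)
                (λ n → S.trans (coeff-map f n) (S.trans (⟦⟧-cong (f≋g n)) (S.sym (coeff-map g n)))) S.refl }
            ; homo = λ f g → ev-+ f g z
            }
          ; ε-homo = S.refl
          }
        ; *-homo = λ f g → ev-* f g z
        }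
      ; 1#-homo = S.trans (ev-C R.1# z) 1#-homo
      }
    ; -‿homo = λ f → ev-neg f z
    }

  ev-^ : ∀ f n z {w} → ev f z S.≈ w → ev (f ^ₚ n) z S.≈ w ^ n
  ev-^ f zero    z eq = S.trans (ev-C R.1# z) 1#-homo
  ev-^ f (suc n) z eq = S.trans (ev-* f (f ^ₚ n) z) (S.*-cong eq (ev-^ f n z eq))

-- Fields under excluded middle.

module FieldProperties {c ℓ₁ ℓ₂} (em : ExcludedMiddle (c ⊔ ℓ₁ ⊔ ℓ₂)) (K : HeytingField c ℓ₁ ℓ₂) where
  open HeytingField K hiding (setoid)
  open SetoidReasoning (CommutativeRing.setoid (commutativeRing K))

  infix 4 _≟_
  _≟_ : ∀ x y → Dec (x ≈ y)
  x ≟ y = map′ lower lift (em {Lift (c ⊔ ℓ₂) (x ≈ y)})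

  #⇒≉ : ∀ {x y} → x # y → ¬ (x ≈ y)
  #⇒≉ {x} {y} x#y x≈y = proj₂ (tight x y) x≈y x#y

  ≉⇒# : ∀ {x y} → ¬ (x ≈ y) → x # y
  ≉⇒# {x} {y} x≉y with em {Lift (c ⊔ ℓ₁) (x # y)}
  ... | yes (lift x#y) = x#y
  ... | no ¬x#y = ⊥-elim (x≉y (proj₁ (tight x y) (¬x#y ∘ lift)))

  inverseOf : ∀ {x} → ¬ (x ≈ 0#) → ∃[ y ] x * y ≈ 1#
  inverseOf {x} x≉0 with #⇒invertible (≉⇒# x≉0)
  ... | y , _ , eq = y , trans (RingIdentities.difference-0-* (commutativeRing K) x y) eq

  inverse-law : ∀ x (x#0 : x # 0#) → x * inverse K x x#0 ≈ 1#
  inverse-law x x#0 = trans (RingIdentities.difference-0-* (commutativeRing K) x (inverse K x x#0)) (proj₂ (proj₂ (#⇒invertible x#0)))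

  1≉0 : ¬ (1# ≈ 0#)
  -- If `1#` were `0#`, then `0#` would be an inverse of `0# - 0#`, and `0#` would be apart from
  -- itself.
  1≉0 1≈0 = #⇒≉ (invertible⇒# {0#} {0#} (0# , trans (zeroˡ _) (sym 1≈0) , trans (zeroʳ _) (sym 1≈0))) refl

  *-cancel : ∀ {x y} → x * y ≈ 0# → ¬ (x ≈ 0#) → y ≈ 0#
  *-cancel {x} {y} xy≈0 x≉0 with inverseOf x≉0
  ... | z , xz≈1 = begin
    y           ≈⟨ sym (*-identityˡ y) ⟩
    1# * y      ≈⟨ *-congʳ (sym xz≈1) ⟩
    x * z * y   ≈⟨ RingIdentities.*-rotate (commutativeRing K) x y z ⟩
    z * (x * y) ≈⟨ *-congˡ xy≈0 ⟩
    z * 0#      ≈⟨ zeroʳ z ⟩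
    0#          ∎

  *-cancelˡ : ∀ {x y z} → ¬ (x ≈ 0#) → x * y ≈ x * z → y ≈ z
  *-cancelˡ {x} {y} {z} x≉0 eq = PolynomialProperties.x-y≈0⇒x≈y (commutativeRing K) y z (*-cancel (begin
    x * (y - z)     ≈⟨ RingIdentities.*-distrib-difference (commutativeRing K) x y z ⟩
    x * y - x * z   ≈⟨ +-congʳ eq ⟩
    x * z - x * z   ≈⟨ -‿inverseʳ _ ⟩
    0#              ∎) x≉0)

  *-nonzero : ∀ {x y} → ¬ (x ≈ 0#) → ¬ (y ≈ 0#) → ¬ (x * y ≈ 0#)
  *-nonzero x≉0 y≉0 xy≈0 = y≉0 (*-cancel xy≈0 x≉0)

  invertible-nonzero : ∀ {x y} → x * y ≈ 1# → ¬ (x ≈ 0#)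
  invertible-nonzero xy≈1 x≈0 = 1≉0 (trans (sym xy≈1) (trans (*-congʳ x≈0) (zeroˡ _)))

  open PolynomialProperties (commutativeRing K) public
  open Polynomial (rawRing K) using (Poly; coeff)
  open Domain *-cancel public

  degree-of-nonzero : ∀ f → ¬ (f ≋ []) → ∃[ n ] HasDegree K f n
  degree-of-nonzero []      f≉0 = contradiction (λ _ → refl) f≉0
  degree-of-nonzero (x ∷ f) f≉0 with em {Lift (c ⊔ ℓ₁ ⊔ ℓ₂) (f ≋ [])}
  ... | no f≉[] with degree-of-nonzero f (f≉[] ∘ lift)
  ...   | n , top , above = suc n , top , λ { (suc m) (s≤s n<m) → above m n<m }
  degree-of-nonzero (x ∷ f) f≉0 | yes (lift f≋[]) = 0 , ≉⇒# x≉0 , λ { (suc m) _ → f≋[] m }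
    where
    x≉0 : ¬ (x ≈ 0#)
    x≉0 x≈0 = f≉0 λ { zero → x≈0 ; (suc n) → f≋[] n }

  HasDegree⇒Leading : ∀ f {n} → HasDegree K f n → ∃[ x ] (¬ (x ≈ 0#) × Leading f n x)
  HasDegree⇒Leading f (top , above) = _ , #⇒≉ top , refl , above

  Leading-unique : ∀ f {m n x y} → ¬ (x ≈ 0#) → ¬ (y ≈ 0#) → Leading f m x → Leading f n y → m ≡ n
  Leading-unique f {m} {n} x≉0 y≉0 (eq , above) (eq′ , above′) with ℕₚ.<-cmp m n
  ... | Tri.tri< m<n _ _ = contradiction (trans (sym eq′) (above n m<n)) y≉0
  ... | Tri.tri≈ _ m≡n _ = m≡n
  ... | Tri.tri> _ _ n<m = contradiction (trans (sym eq) (above′ m n<m)) x≉0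

-- Subrings and the adjunction of an integral element.

record IsSubring {c ℓ p} (R : CommutativeRing c ℓ) (S : CommutativeRing.Carrier R → Set p) : Set (c ⊔ ℓ ⊔ p) where
  open CommutativeRing R
  field
    ≈-closed : ∀ {x y} → x ≈ y → S x → S y
    0-closed : S 0#
    1-closed : S 1#
    +-closed : ∀ {x y} → S x → S y → S (x + y)
    *-closed : ∀ {x y} → S x → S y → S (x * y)
    neg-closed : ∀ {x} → S x → S (- x)

-- To be applied to Ω and to Ω × Ω alike: adjoining the pair (α , β) to the graph of a homomorphism
-- extends it by α ↦ β.
module Adjunction {c ℓ} (R : CommutativeRing c ℓ) where
  open CommutativeRing R
  open import Algebra.Properties.Semiring.Exp semiring using (_^_)

  infixl 5 _⊕_[_]

  data Span {p} (S : Carrier → Set p) (γ : Carrier) : ℕ → Carrier → Set (c ⊔ ℓ ⊔ p) where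
    empty  : ∀ {z} → z ≈ 0# → Span S γ 0 z
    _⊕_[_] : ∀ {n w s z} → Span S γ n w → S s → z ≈ w + s * γ ^ n → Span S γ (suc n) z

  module _ {p} {S : Carrier → Set p} {γ : Carrier} (S-subring : IsSubring R S) where
    open IsSubring S-subring

    Span-resp : ∀ {n x y} → x ≈ y → Span S γ n x → Span S γ n y
    Span-resp x≈y (empty x≈0)    = empty (trans (sym x≈y) x≈0)
    Span-resp x≈y (w ⊕ s [ eq ]) = w ⊕ s [ trans (sym x≈y) eq ]

    Span-0 : ∀ n → Span S γ n 0#
    Span-0 zero    = empty refl
    Span-0 (suc n) = Span-0 n ⊕ 0-closed [ RingIdentities.zero-combination R _ ]

    Span-+ : ∀ {n x y} → Span S γ n x → Span S γ n y → Span S γ n (x + y)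
    Span-+ (empty x≈0)    (empty y≈0)      = empty (trans (+-cong x≈0 y≈0) (+-identityʳ 0#))
    Span-+ (w ⊕ s [ eq ]) (w′ ⊕ s′ [ eq′ ]) = Span-+ w w′ ⊕ +-closed s s′
      [ trans (+-cong eq eq′) (RingIdentities.combination-+ R _ _ _ _ _) ]

    Span-scale : ∀ {n s x} → S s → Span S γ n x → Span S γ n (s * x)
    Span-scale s (empty x≈0)     = empty (trans (*-congˡ x≈0) (zeroʳ _))
    Span-scale s (w ⊕ s′ [ eq ]) = Span-scale s w ⊕ *-closed s s′
      [ trans (*-congˡ eq) (RingIdentities.combination-scale R _ _ _ _) ]

    Span-shift : ∀ {n x} → Span S γ n x → Span S γ (suc n) (γ * x)
    Span-shift (empty x≈0)    = Span-resp (sym (trans (*-congˡ x≈0) (zeroʳ γ))) (Span-0 1)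
    Span-shift (w ⊕ s [ eq ]) = Span-shift w ⊕ s
      [ trans (*-congˡ eq) (RingIdentities.combination-shift R _ _ _ _) ]

    Span-suc : ∀ {n x} → Span S γ n x → Span S γ (suc n) x
    Span-suc w = w ⊕ 0-closed [ sym (trans (+-congˡ (zeroˡ _)) (+-identityʳ _)) ]

    Span-≤ : ∀ {m n x} → m ℕ.≤ n → Span S γ m x → Span S γ n x
    Span-≤ {n = n} m≤n w with ℕₚ.≤⇒≤′ m≤n
    ... | m≤′n = go m≤′n w
      where
      go : ∀ {m n x} → m ℕ.≤′ n → Span S γ m x → Span S γ n x
      go ℕ.≤′-refl       w = w
      go (ℕ.≤′-step m≤n) w = Span-suc (go m≤n w)

    Span-power : ∀ n → Span S γ (suc n) (γ ^ n)
    Span-power n = Span-0 n ⊕ 1-closed [ RingIdentities.unit-combination R _ ]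

    -- A monic relation of degree d makes the combinations of length d a ring.
    module _ {d} (relation : Span S γ d (γ ^ d)) where
      Span-γ : ∀ {x} → Span S γ d x → Span S γ d (γ * x)
      Span-γ w with Span-shift w
      ... | w′ ⊕ s [ eq ] = Span-resp (sym eq) (Span-+ w′ (Span-scale s relation))

      Span-γ^ : ∀ n {x} → Span S γ d x → Span S γ d (γ ^ n * x)
      Span-γ^ zero    w = Span-resp (sym (*-identityˡ _)) w
      Span-γ^ (suc n) w = Span-resp (sym (*-assoc γ (γ ^ n) _)) (Span-γ (Span-γ^ n w))

      Span-* : ∀ {n x y} → Span S γ n x → Span S γ d y → Span S γ d (x * y)
      Span-* (empty x≈0)    y = Span-resp (sym (trans (*-congʳ x≈0) (zeroˡ _))) (Span-0 d)
      Span-* {suc n} (w ⊕ s [ eq ]) y = Span-resp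
        (sym (trans (*-congʳ eq) (RingIdentities.combination-* R _ _ _ _)))
        (Span-+ (Span-* w y) (Span-scale s (Span-γ^ n y)))

      Span-1 : Span S γ d 1#
      Span-1 with d ℕₚ.≟ 0
      -- In degree 0 the relation itself presents `1#` as the empty combination.
      ... | yes ≡.refl = relation
      ... | no d≢0     = Span-≤ (ℕₚ.n≢0⇒n>0 d≢0) (Span-power 0)

      Span-isSubring : IsSubring R (Span S γ d)
      Span-isSubring = record
        { ≈-closed = Span-resp ; 0-closed = Span-0 d ; 1-closed = Span-1 ; +-closed = Span-+ ; *-closed = Span-*
        ; neg-closed = λ w → Span-resp (RingIdentities.neg-one-* R _)
                               (Span-scale (neg-closed 1-closed) w)
        }

      Span-⊇ : ∀ {s} → S s → Span S γ d s
      Span-⊇ s = Span-resp (*-identityʳ _) (Span-scale s Span-1)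

      Span-generator : Span S γ d γ
      Span-generator = Span-resp (*-identityʳ γ) (Span-γ Span-1)

-- The Tschirnhausen transformation of X³ + aX + a.

module Tschirnhausen {c ℓ} (R : CommutativeRing c ℓ) where
  open CommutativeRing R
  open Formulas (CommutativeRing.rawRing R) using (num; den; δ; _·_; _^_)
  private module Z = IntegerSolver R
  open Z using (_:=_; _:+_; _:*_; :-_; _:-_; _:×_; _:^_)
  open SetoidReasoning (CommutativeRing.setoid R)

  e₁ e₂ e₃ : Carrier → Carrier → Carrier → Carrier
  e₁ x y z = x + y + z
  e₂ x y z = x * y + y * z + z * x
  e₃ x y z = x * y * z

  e₁-cong : ∀ {x x′ y y′ z z′} → x ≈ x′ → y ≈ y′ → z ≈ z′ → e₁ x y z ≈ e₁ x′ y′ z′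
  e₁-cong p q r = +-cong (+-cong p q) r

  e₂-cong : ∀ {x x′ y y′ z z′} → x ≈ x′ → y ≈ y′ → z ≈ z′ → e₂ x y z ≈ e₂ x′ y′ z′
  e₂-cong p q r = +-cong (+-cong (*-cong p q) (*-cong q r)) (*-cong r p)

  e₃-cong : ∀ {x x′ y y′ z z′} → x ≈ x′ → y ≈ y′ → z ≈ z′ → e₃ x y z ≈ e₃ x′ y′ z′
  e₃-cong p q r = *-cong (*-cong p q) r

  -- The Tschirnhausen transformation; for x a root of X³ + aX + a, its conjugates
  -- are the roots of X³ + a num(u) X + a den(u).
  θ : Carrier → Carrier → Carrier → Carrier
  θ a u x = 3 · (x * x) + u * x + 2 · a

  ·-cong : ∀ n {x y} → x ≈ y → n · x ≈ n · y
  ·-cong zero    eq = refl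
  ·-cong (suc n) eq = +-cong eq (·-cong n eq)

  θ-cong : ∀ {a a′ u u′ x x′} → a ≈ a′ → u ≈ u′ → x ≈ x′ → θ a u x ≈ θ a′ u′ x′
  θ-cong p q r = +-cong (+-cong (·-cong 3 (*-cong r r)) (*-cong q r)) (·-cong 2 p)

  last-root : ∀ {x y z} → e₁ x y z ≈ 0# → z ≈ - (x + y)
  last-root {x} {y} {z} eq = begin
    z                     ≈⟨ Z.solve 3 (λ x y z → z := x :+ y :+ z :- (x :+ y)) refl x y z ⟩
    x + y + z - (x + y)   ≈⟨ trans (+-congʳ eq) (+-identityˡ _) ⟩
    - (x + y)             ∎

  private
    θᴾ : ∀ {n} → (_ _ _ : Z.Polynomial n) → Z.Polynomial n
    θᴾ a u x = 3 :× (x :* x) :+ u :* x :+ 2 :× a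

    e₂ᴾ e₃ᴾ : ∀ {n} → (_ _ _ : Z.Polynomial n) → Z.Polynomial n
    e₂ᴾ x y z = x :* y :+ y :* z :+ z :* x
    e₃ᴾ x y z = x :* y :* z

  module _ {a x y z} (s₁ : e₁ x y z ≈ 0#) (s₂ : e₂ x y z ≈ a) (s₃ : e₃ x y z ≈ - a) (u : Carrier) where
    private
      z≈ : z ≈ - (x + y)
      z≈ = last-root s₁
      -- The parameter `a` is both coefficients of the cubic X³ + pX + q. The formulas below are
      -- polynomial identities for independent p = e₂ and q = -e₃, so each occurrence of `a` has to
      -- be read as the right one of the two.
      a≈e₂ : a ≈ e₂ x y (- (x + y))
      a≈e₂ = trans (sym s₂) (e₂-cong refl refl z≈)
      a≈-e₃ : a ≈ - e₃ x y (- (x + y))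
      a≈-e₃ = trans (Z.solve 1 (λ a → a := :- (:- a)) refl a) (-‿cong (trans (sym s₃) (e₃-cong refl refl z≈)))
      θ≈ : ∀ {w w′} → w ≈ w′ → θ a u w ≈ θ (e₂ x y (- (x + y))) u w′
      θ≈ = θ-cong a≈e₂ refl

    θ-e₁ : e₁ (θ a u x) (θ a u y) (θ a u z) ≈ 0#
    θ-e₁ = trans (e₁-cong (θ≈ refl) (θ≈ refl) (θ≈ z≈))
      (Z.solve 3 (λ x y u → let z = :- (x :+ y) ; a = e₂ᴾ x y z in
         θᴾ a u x :+ θᴾ a u y :+ θᴾ a u z := Z.con 0ℤ) refl x y u)

    θ-e₂ : e₂ (θ a u x) (θ a u y) (θ a u z) ≈ a * num a u
    θ-e₂ = begin
      e₂ (θ a u x) (θ a u y) (θ a u z)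
        ≈⟨ e₂-cong (θ≈ refl) (θ≈ refl) (θ≈ z≈) ⟩
      e₂ (θ a₂ u x) (θ a₂ u y) (θ a₂ u (- (x + y)))
        ≈⟨ Z.solve 3 (λ x y u → let z = :- (x :+ y) ; a = e₂ᴾ x y z in
             e₂ᴾ (θᴾ a u x) (θᴾ a u y) (θᴾ a u z) := a :* (u :* u) :+ 9 :× (:- e₃ᴾ x y z :* u) :- 3 :× (a :* a)) refl x y u ⟩
      a₂ * (u * u) + 9 · (a₃ * u) - 3 · (a₂ * a₂)
        ≈⟨ sym (+-cong (+-cong (*-congʳ a≈e₂) (·-cong 9 (*-congʳ a≈-e₃))) (-‿cong (·-cong 3 (*-cong a≈e₂ a≈e₂)))) ⟩
      a * (u * u) + 9 · (a * u) - 3 · (a * a)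
        ≈⟨ Z.solve 2 (λ a u → a :* (u :* u) :+ 9 :× (a :* u) :- 3 :× (a :* a) := a :* (u :^ 2 :+ 9 :× u :- 3 :× a)) refl a u ⟩
      a * num a u ∎
      where
      a₂ = e₂ x y (- (x + y))
      a₃ = - e₃ x y (- (x + y))

    θ-e₃ : e₃ (θ a u x) (θ a u y) (θ a u z) ≈ - (a * den a u)
    θ-e₃ = begin
      e₃ (θ a u x) (θ a u y) (θ a u z)
        ≈⟨ e₃-cong (θ≈ refl) (θ≈ refl) (θ≈ z≈) ⟩
      e₃ (θ a₂ u x) (θ a₂ u y) (θ a₂ u (- (x + y)))
        ≈⟨ Z.solve 3 (λ x y u → let z = :- (x :+ y) ; a = e₂ᴾ x y z ; t = :- e₃ᴾ x y z in
             e₃ᴾ (θᴾ a u x) (θᴾ a u y) (θᴾ a u z) :=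
             :- (t :* (u :* (u :* u)) :- 2 :× (a :* a :* (u :* u)) :- 9 :× (a :* t :* u) :- 2 :× (a :* (a :* a)) :- 27 :× (t :* t))) refl x y u ⟩
      - (a₃ * (u * (u * u)) - 2 · (a₂ * a₂ * (u * u)) - 9 · (a₂ * a₃ * u) - 2 · (a₂ * (a₂ * a₂)) - 27 · (a₃ * a₃))
        ≈⟨ sym (-‿cong (+-cong (+-cong (+-cong (+-cong (*-congʳ a≈-e₃) (-‿cong (·-cong 2 (*-congʳ (*-cong a≈e₂ a≈e₂)))))
             (-‿cong (·-cong 9 (*-congʳ (*-cong a≈e₂ a≈-e₃))))) (-‿cong (·-cong 2 (*-cong a≈e₂ (*-cong a≈e₂ a≈e₂))))) (-‿cong (·-cong 27 (*-cong a≈-e₃ a≈-e₃))))) ⟩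
      - (a * (u * (u * u)) - 2 · (a * a * (u * u)) - 9 · (a * a * u) - 2 · (a * (a * a)) - 27 · (a * a))
        ≈⟨ Z.solve 2 (λ a u → :- (a :* (u :* (u :* u)) :- 2 :× (a :* a :* (u :* u)) :- 9 :× (a :* a :* u) :- 2 :× (a :* (a :* a)) :- 27 :× (a :* a))
              := :- (a :* (u :^ 3 :- 2 :× (a :* u :^ 2) :- 9 :× (a :* u) :- 2 :× (a :^ 2) :- 27 :× a))) refl a u ⟩
      - (a * den a u) ∎
      where
      a₂ = e₂ x y (- (x + y))
      a₃ = - e₃ x y (- (x + y))

  -- With y = α x² + β x + γ on three points, κ = α V and μ = β V.
  κ μ : (x₀ x₁ x₂ y₀ y₁ y₂ : Carrier) → Carrier
  κ x₀ x₁ x₂ y₀ y₁ y₂ = y₀ * (x₁ - x₂) + y₁ * (x₂ - x₀) + y₂ * (x₀ - x₁)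
  μ x₀ x₁ x₂ y₀ y₁ y₂ = x₀ * y₀ * (x₁ - x₂) + x₁ * y₁ * (x₂ - x₀) + x₂ * y₂ * (x₀ - x₁)

  V : (x₀ x₁ x₂ : Carrier) → Carrier
  V x₀ x₁ x₂ = (x₀ - x₁) * ((x₁ - x₂) * (x₀ - x₂))

  -- Lagrange interpolation with cleared denominators. Summing αx² + βx + γ over the three points
  -- gives 3γ = 2aα, as the sums of the x, the x² and the y are 0, -2a and 0; tripling y therefore
  -- eliminates γ.
  interpolate : ∀ {a} x₀ x₁ x₂ y₀ y₁ y₂ → e₁ x₀ x₁ x₂ ≈ 0# → e₂ x₀ x₁ x₂ ≈ a → e₁ y₀ y₁ y₂ ≈ 0# →
                V x₀ x₁ x₂ * (3 · y₀) ≈ κ x₀ x₁ x₂ y₀ y₁ y₂ * (3 · (x₀ * x₀) + 2 · a) + 3 · (μ x₀ x₁ x₂ y₀ y₁ y₂ * x₀)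
  interpolate {a} x₀ x₁ x₂ y₀ y₁ y₂ s₁ s₂ t₁ = begin
    V x₀ x₁ x₂ * (3 · y₀)
      ≈⟨ *-congʳ (*-congˡ (*-cong (+-congˡ (-‿cong x₂≈)) (+-congˡ (-‿cong x₂≈)))) ⟩
    V x₀ x₁ (- (x₀ + x₁)) * (3 · y₀)
      ≈⟨ Z.solve 4 (λ x₀ x₁ y₀ y₁ → let x₂ = :- (x₀ :+ x₁) ; y₂ = :- (y₀ :+ y₁) in
            (x₀ :- x₁) :* ((x₁ :- x₂) :* (x₀ :- x₂)) :* (3 :× y₀) :=
            (y₀ :* (x₁ :- x₂) :+ y₁ :* (x₂ :- x₀) :+ y₂ :* (x₀ :- x₁)) :* (3 :× (x₀ :* x₀) :+ 2 :× e₂ᴾ x₀ x₁ x₂)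
              :+ 3 :× ((x₀ :* y₀ :* (x₁ :- x₂) :+ x₁ :* y₁ :* (x₂ :- x₀) :+ x₂ :* y₂ :* (x₀ :- x₁)) :* x₀)) refl x₀ x₁ y₀ y₁ ⟩
    κ x₀ x₁ (- (x₀ + x₁)) y₀ y₁ (- (y₀ + y₁)) * (3 · (x₀ * x₀) + 2 · e₂ x₀ x₁ (- (x₀ + x₁)))
      + 3 · (μ x₀ x₁ (- (x₀ + x₁)) y₀ y₁ (- (y₀ + y₁)) * x₀)
      ≈⟨ sym (+-cong (*-cong
           (+-cong (+-cong (*-congˡ (+-congˡ (-‿cong x₂≈))) (*-congˡ (+-congʳ x₂≈))) (*-congʳ y₂≈))
           (+-congˡ (·-cong 2 (trans (sym s₂) (e₂-cong refl refl x₂≈)))))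
           (·-cong 3 (*-congʳ (+-cong (+-cong (*-congˡ (+-congˡ (-‿cong x₂≈))) (*-congˡ (+-congʳ x₂≈))) (*-congʳ (*-cong x₂≈ y₂≈)))))) ⟩
    κ x₀ x₁ x₂ y₀ y₁ y₂ * (3 · (x₀ * x₀) + 2 · a) + 3 · (μ x₀ x₁ x₂ y₀ y₁ y₂ * x₀) ∎
    where
    x₂≈ = last-root s₁
    y₂≈ = last-root t₁

  -- From u = v follow w = -2u, p = -3u² and p = 2u³. So 2u³ + 3u² vanishes, and δ(p) = -9u²(9 -
  -- 4u²) is a multiple of it.
  double-root : ∀ {p u v w} → e₁ u v w ≈ 0# → e₂ u v w ≈ p → e₃ u v w ≈ - p → u ≈ v → δ p ≈ 0#
  double-root {p} {u} {v} {w} s₁ s₂ s₃ u≈v = begin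
    p * (4 · p + 27 · 1#)
      ≈⟨ *-cong p≈ (+-congʳ (·-cong 4 p≈)) ⟩
    - (3 · (u * u)) * (4 · - (3 · (u * u)) + 27 · 1#)
      ≈⟨ Z.solve 1 (λ u → :- (3 :× (u :* u)) :* (4 :× :- (3 :× (u :* u)) :+ 27 :× Z.con 1ℤ)
            := (:- (3 :× Z.con 1ℤ) :* (9 :× Z.con 1ℤ :- 6 :× u)) :* (2 :× (u :* (u :* u)) :+ 3 :× (u :* u))) refl u ⟩
    - (3 · 1#) * (9 · 1# - 6 · u) * (2 · (u * (u * u)) + 3 · (u * u))
      ≈⟨ *-congˡ (trans (+-cong cubed (trans (Z.solve 1 (λ q → q := :- (:- q)) refl _) (-‿cong (sym p≈)))) (-‿inverseʳ p)) ⟩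
    - (3 · 1#) * (9 · 1# - 6 · u) * 0#
      ≈⟨ zeroʳ _ ⟩
    0# ∎
    where
    w≈ : w ≈ - (u + u)
    w≈ = trans (last-root s₁) (-‿cong (+-congˡ (sym u≈v)))

    p≈ : p ≈ - (3 · (u * u))
    p≈ = trans (sym s₂) (trans (e₂-cong refl (sym u≈v) w≈)
      (Z.solve 1 (λ u → u :* u :+ u :* :- (u :+ u) :+ :- (u :+ u) :* u := :- (3 :× (u :* u))) refl u))

    cubed : 2 · (u * (u * u)) ≈ p
    cubed = begin
      2 · (u * (u * u))     ≈⟨ Z.solve 1 (λ u → 2 :× (u :* (u :* u)) := :- (u :* u :* :- (u :+ u))) refl u ⟩
      - e₃ u u (- (u + u))  ≈⟨ -‿cong (sym (e₃-cong refl (sym u≈v) w≈)) ⟩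
      - e₃ u v w            ≈⟨ -‿cong s₃ ⟩
      - - p                 ≈⟨ Z.solve 1 (λ p → :- (:- p) := p) refl p ⟩
      p                     ∎

-- Compatibility of the formulas with homomorphisms, including evaluation of polynomials.

module FormulaHomomorphism {a ℓa c ℓ} (R : RawRing a ℓa) (S : CommutativeRing c ℓ)
  (g : RawRing.Carrier R → CommutativeRing.Carrier S)
  (g-hom : IsRingHomomorphism R (CommutativeRing.rawRing S) g) where
  open CommutativeRing S
  open IsRingHomomorphism g-hom
  private
    module R = RawRing R
    module FR = Formulas R
    module FS = Formulas (CommutativeRing.rawRing S)

  ·-hom : ∀ n {x z} → g x ≈ z → g (n FR.· x) ≈ n FS.· z
  ·-hom zero    eq = 0#-homo
  ·-hom (suc n) eq = trans (+-homo _ _) (+-cong eq (·-hom n eq))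

  ^-hom : ∀ n {x z} → g x ≈ z → g (x FR.^ n) ≈ z FS.^ n
  ^-hom zero    eq = 1#-homo
  ^-hom (suc n) eq = trans (*-homo _ _) (*-cong eq (^-hom n eq))

  sub-hom : ∀ {x y z w} → g x ≈ z → g y ≈ w → g (x FR.- y) ≈ z - w
  sub-hom p q = trans (+-homo _ _) (+-cong p (trans (-‿homo _) (-‿cong q)))

  *-hom : ∀ {x y z w} → g x ≈ z → g y ≈ w → g (x R.* y) ≈ z * w
  *-hom p q = trans (*-homo _ _) (*-cong p q)

  δ-hom : ∀ {x z} → g x ≈ z → g (FR.δ x) ≈ FS.δ z
  δ-hom eq = *-hom eq (trans (+-homo _ _) (+-cong (·-hom 4 eq) (·-hom 27 1#-homo)))

  num-hom : ∀ {x u z w} → g x ≈ z → g u ≈ w → g (FR.num x u) ≈ FS.num z w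
  num-hom p q = sub-hom (trans (+-homo _ _) (+-cong (^-hom 2 q) (·-hom 9 q))) (·-hom 3 p)

  den-hom : ∀ {x u z w} → g x ≈ z → g u ≈ w → g (FR.den x u) ≈ FS.den z w
  den-hom p q = sub-hom (sub-hom (sub-hom (sub-hom (^-hom 3 q) (·-hom 2 (*-hom p (^-hom 2 q))))
    (·-hom 9 (*-hom p q))) (·-hom 2 (^-hom 2 p))) (·-hom 27 p)

  resolvent-hom : ∀ p q u {p′ q′ u′} → g p ≈ p′ → g q ≈ q′ → g u ≈ u′ →
    g ((p R.* FR.num p u FR.^ 3) FR.- (q R.* FR.den p u FR.^ 2)) ≈ p′ * FS.num p′ u′ FS.^ 3 - q′ * FS.den p′ u′ FS.^ 2
  resolvent-hom p q u p≈ q≈ u≈ = sub-hom (*-hom p≈ (^-hom 3 (num-hom p≈ u≈))) (*-hom q≈ (^-hom 2 (den-hom p≈ u≈)))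

-- The characteristic.

module _ {c ℓ₁ ℓ₂} (em : ExcludedMiddle (c ⊔ ℓ₁ ⊔ ℓ₂)) (k M : HeytingField c ℓ₁ ℓ₂)
  (φ : HeytingField.Carrier k → HeytingField.Carrier M) (φ-hom : IsRingHomomorphism (rawRing k) (rawRing M) φ) where
  private
    module k where
      open HeytingField k public hiding (setoid)
      open FieldProperties em k public
      open Formulas (rawRing k) public using (_·_)
    module M where
      open HeytingField M public hiding (setoid)
      open FieldProperties em M public
      open Formulas (rawRing M) public using (_·_)
    open IsRingHomomorphism φ-hom

  -- If 3 vanishes in `M` it vanishes in `k`, for otherwise its inverse would be mapped to an
  -- inverse of 0. Then the multiples of 3 vanish in `k`, while 1 and 2 do not, as 2 = 0 = 3 would
  -- give 1 = 0.
  three-nonzero : ¬ HasCharacteristic k 3 → ¬ (3 M.· M.1# M.≈ M.0#)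
  three-nonzero not-3 3≈0 = not-3 λ n → mk⇔ (divides n) (vanishes n)
    where
    φ-3 : φ (3 k.· k.1#) M.≈ M.0#
    φ-3 = M.trans (·-hom 3 1#-homo) 3≈0
      where open FormulaHomomorphism (rawRing k) (commutativeRing M) φ φ-hom

    3≈0′ : 3 k.· k.1# k.≈ k.0#
    3≈0′ with (3 k.· k.1#) k.≟ k.0#
    ... | yes eq = eq
    ... | no neq =
      let z , inv = k.inverseOf neq in
      contradiction (M.trans (M.sym 1#-homo) (M.trans (⟦⟧-cong (k.sym inv)) (M.trans (*-homo (3 k.· k.1#) z) (M.trans (M.*-congʳ φ-3) (M.zeroˡ _))))) M.1≉0

    add-3 : ∀ n → (3 ℕ.+ n) k.· k.1# k.≈ n k.· k.1#
    add-3 n = k.trans (Z.solve 1 (λ x → Z.con 1ℤ :+ (Z.con 1ℤ :+ (Z.con 1ℤ :+ x)) := 3 :× Z.con 1ℤ :+ x) k.refl (n k.· k.1#))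
      (k.trans (k.+-congʳ 3≈0′) (k.+-identityˡ _))
      where
      module Z = IntegerSolver (commutativeRing k)
      open Z using (_:=_; _:+_; _:×_)

    divides : ∀ n → n k.· k.1# k.≈ k.0# → 3 ℕ∣.∣ n
    divides 0 _ = 3 ℕ∣.∣0
    divides 1 eq = contradiction (k.trans (k.sym (k.+-identityʳ k.1#)) eq) k.1≉0
    divides 2 eq = contradiction (k.trans (k.sym (k.+-identityʳ k.1#)) (k.trans (k.sym (k.+-congˡ eq)) 3≈0′)) k.1≉0
    divides (suc (suc (suc n))) eq = ℕ∣.∣m∣n⇒∣m+n (ℕ∣.∣-refl {3}) (divides n (k.trans (k.sym (add-3 n)) eq))

    vanishes : ∀ n → 3 ℕ∣.∣ n → n k.· k.1# k.≈ k.0#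
    vanishes _ (ℕ∣.divides q ≡.refl) = multiple q
      where
      multiple : ∀ q → (q ℕ.* 3) k.· k.1# k.≈ k.0#
      multiple zero    = k.refl
      multiple (suc q) = k.trans (add-3 (q ℕ.* 3)) (multiple q)

-- The base field inside its algebraic closure.

module Development {c ℓ₁ ℓ₂} (em : ExcludedMiddle (c ⊔ ℓ₁ ⊔ ℓ₂))
  (M : HeytingField c ℓ₁ ℓ₂) (Ω : AlgebraicClosure M) where
  open AlgebraicClosure Ω
  open IsRingHomomorphism isHomomorphism

  module M where
    open HeytingField M public hiding (setoid)
    open FieldProperties em M public
    ring : CommutativeRing c ℓ₁
    ring = commutativeRing M
    open Polynomial (rawRing M) public

  K : CommutativeRing c ℓ₁
  K = commutativeRing closure

  module K = CommutativeRing K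
  open HeytingField closure hiding (setoid)
  open Polynomial (rawRing closure) using (eval)
  open FieldProperties em closure
  open PolynomialHomomorphism M.ring K ι isHomomorphism
  open import Algebra.Properties.Semiring.Exp K.semiring using (_^_)
  module Z = IntegerSolver K
  open Z using (_:=_; _:+_; _:*_; :-_; _:-_; _:×_; _:^_)
  open SetoidReasoning K.setoid
  open S₃ using (S₃; act; move; odd; inv; _∙_; _^ˢ_; IsRotation; rotations; reflections)

  decide : (P : Set (c ⊔ ℓ₁)) → Dec P
  decide P = map′ lower lift (em {Lift ℓ₂ P})

  ι-injective : ∀ {x y} → ι x ≈ ι y → x M.≈ y
  ι-injective {x} {y} eq with x M.≟ y
  ... | yes x≈y = x≈y
  ... | no x≉y with M.inverseOf {x M.- y} (λ x-y≈0 → x≉y (M.x-y≈0⇒x≈y x y x-y≈0))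
  ...   | z , inv = contradiction (begin
    1#                       ≈⟨ sym 1#-homo ⟩
    ι M.1#                   ≈⟨ ⟦⟧-cong (M.sym inv) ⟩
    ι ((x M.- y) M.* z)      ≈⟨ *-homo _ _ ⟩
    ι (x M.- y) * ι z        ≈⟨ *-congʳ (trans (+-homo x _) (+-cong eq (-‿homo y))) ⟩
    (ι y - ι y) * ι z        ≈⟨ trans (*-congʳ (-‿inverseʳ _)) (zeroˡ _) ⟩
    0#                       ∎) 1≉0

  ι-nonzero : ∀ {x} → ¬ (x M.≈ M.0#) → ¬ (ι x ≈ 0#)
  ι-nonzero x≉0 ιx≈0 = x≉0 (ι-injective (trans ιx≈0 (sym 0#-homo)))

  image-isSubring : IsSubring K image
  image-isSubring = record
    { ≈-closed   = λ x≈y (m , eq) → m , trans eq x≈y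
    ; 0-closed   = M.0# , 0#-homo
    ; 1-closed   = M.1# , 1#-homo
    ; +-closed   = λ (m , eq) (n , eq′) → m M.+ n , trans (+-homo m n) (+-cong eq eq′)
    ; *-closed   = λ (m , eq) (n , eq′) → m M.* n , trans (*-homo m n) (*-cong eq eq′)
    ; neg-closed = λ (m , eq) → M.- m , trans (-‿homo m) (-‿cong eq)
    }

  -- The constant term of a polynomial equation for x gives the inverse as a polynomial in x.
  inverse-polynomial : ∀ {x} → ¬ (x ≈ 0#) → ∃[ h ] x * ev h x ≈ 1#
  inverse-polynomial {x} x≉0 with algebraic x
  ... | f , nonzero , root = go f nonzero root
    where
    go : ∀ f → (∃[ n ] M.coeff f n M.# M.0#) → ev f x ≈ 0# → ∃[ h ] x * ev h x ≈ 1#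
    go []      (n , 0#0) root = contradiction M.refl (M.#⇒≉ 0#0)
    go (y ∷ f) (n , fn#0) root with y M.≟ M.0#
    go (y ∷ f) (zero  , y#0)  root | yes y≈0 = contradiction y≈0 (M.#⇒≉ y#0)
    go (y ∷ f) (suc n , fn#0) root | yes y≈0 = go f (n , fn#0) (*-cancel (begin
      x * ev f x        ≈⟨ sym (+-identityˡ _) ⟩
      0# + x * ev f x   ≈⟨ +-congʳ (sym (trans (⟦⟧-cong y≈0) 0#-homo)) ⟩
      ι y + x * ev f x  ≈⟨ root ⟩
      0#                ∎) x≉0)
    ... | no y≉0 with inverseOf (ι-nonzero y≉0) | M.inverseOf y≉0
    ...   | _ | z , yz≈1 = M.C (M.- z) M.*ₚ f , (begin
      x * ev (M.C (M.- z) M.*ₚ f) x                ≈⟨ *-congˡ (trans (ev-* (M.C (M.- z)) f x) (*-congʳ (trans (ev-C (M.- z) x) (-‿homo z)))) ⟩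
      x * (- ι z * ev f x)                         ≈⟨ Z.solve 4 (λ x y z f → x :* (:- z :* f) := z :* y :- z :* (y :+ x :* f)) refl x (ι y) (ι z) (ev f x) ⟩
      ι z * ι y - ι z * (ι y + x * ev f x)         ≈⟨ +-cong (trans (*-comm _ _) (sym (*-homo y z))) (-‿cong (trans (*-congˡ root) (zeroʳ _))) ⟩
      ι (y M.* z) - 0#                             ≈⟨ +-cong (trans (⟦⟧-cong yz≈1) 1#-homo) (Z.solve 0 (:- Z.con 0ℤ := Z.con 0ℤ) refl) ⟩
      1# + 0#                                      ≈⟨ +-identityʳ 1# ⟩
      1#                                           ∎)

  module _ {p} {S : Carrier → Set p} (S-subring : IsSubring K S) (image⊆S : ∀ m → S (ι m)) where
    open IsSubring S-subring
    ev-closed : ∀ f {x} → S x → S (ev f x)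
    ev-closed []      x = 0-closed
    ev-closed (y ∷ f) x = +-closed (image⊆S y) (*-closed x (ev-closed f x))

    inverse-closed : ∀ {x} → S x → ¬ (x ≈ 0#) → ∃[ y ] (S y × x * y ≈ 1#)
    inverse-closed x x≉0 with inverse-polynomial x≉0
    ... | h , eq = _ , ev-closed h x , eq

  -- Homomorphisms over M between subrings of Ω, as subrings of Ω × Ω.

  K² : CommutativeRing c ℓ₁
  K² = DirectProduct.commutativeRing K K

  module K² = CommutativeRing K²

  -- The graph of a ring homomorphism over M from a subring of Ω to Ω.
  record IsSpecialization (S : K².Carrier → Set (c ⊔ ℓ₁)) : Set (c ⊔ ℓ₁) where
    field
      isSubring : IsSubring K² S
      constant  : ∀ m → S (ι m , ι m)
      zero-zero : ∀ {x x′} → S (x , x′) → x ≈ 0# → x′ ≈ 0#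
    open IsSubring isSubring public

    ev-related : ∀ f {x x′} → S (x , x′) → S (ev f x , ev f x′)
    ev-related []      x = 0-closed
    ev-related (y ∷ f) x = +-closed (constant y) (*-closed x (ev-related f x))

    inverse-related : ∀ {x x′} → S (x , x′) → ¬ (x ≈ 0#) →
                      ∃[ y ] ∃[ y′ ] (S (y , y′) × x * y ≈ 1#)
    inverse-related x x≉0 with inverse-polynomial x≉0
    ... | h , eq = _ , _ , ev-related h x , eq

    functional : ∀ {x x′ y y′} → S (x , x′) → S (y , y′) → x ≈ y → x′ ≈ y′
    functional x y x≈y = x-y≈0⇒x≈y _ _ (zero-zero (+-closed x (neg-closed y)) (trans (+-congʳ x≈y) (-‿inverseʳ _)))

    -- The inverse of `x` is a polynomial in `x` over M, so it lies in the domain and its image is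
    -- inverse to `x′`.
    nonzero : ∀ {x x′} → S (x , x′) → ¬ (x ≈ 0#) → ¬ (x′ ≈ 0#)
    nonzero x x≉0 x′≈0 with inverse-related x x≉0
    ... | y , y′ , yy′ , xy≈1 = invertible-nonzero (functional (*-closed x yy′) 1-closed xy≈1) x′≈0

    injective : ∀ {x x′ y y′} → S (x , x′) → S (y , y′) → x′ ≈ y′ → x ≈ y
    injective {x} {x′} {y} {y′} sx sy x′≈y′ with x ≟ y
    ... | yes x≈y = x≈y
    ... | no x≉y = contradiction (trans (+-congʳ x′≈y′) (-‿inverseʳ y′))
      (nonzero (+-closed sx (neg-closed sy)) (λ eq → x≉y (x-y≈0⇒x≈y x y eq)))

  private
    module A  = Adjunction K
    module A² = Adjunction K²
  open A using (Span; empty; _⊕_[_])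
  open A² using () renaming (Span to Span²; empty to empty²; _⊕_[_] to _⊕²_[_])

  least : (P : ℕ → Set (c ⊔ ℓ₁)) → ∀ n → P n → ∃[ d ] (P d × (∀ m → m ℕ.< d → ¬ P m))
  least P = <-rec _ λ n rec Pn → step n rec Pn
    where
    step : ∀ n → (∀ {m} → m ℕ.< n → P m → ∃[ d ] (P d × (∀ m → m ℕ.< d → ¬ P m))) →
           P n → ∃[ d ] (P d × (∀ m → m ℕ.< d → ¬ P m))
    step n rec Pn with decide (∃[ m ] (m ℕ.< n × P m))
    ... | yes (m , m<n , Pm) = rec m<n Pm
    ... | no none = n , Pn , λ m m<n Pm → none (m , m<n , Pm)

  module _ (E : Carrier → Set (c ⊔ ℓ₁)) (E-subring : IsSubring K E) (image⊆E : ∀ m → E (ι m)) where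
    open IsSubring E-subring

    -- The degree of the minimal polynomial: `E` is a field, because it contains M and all its
    -- elements are algebraic over M.
    IsMinimalDegree : Carrier → ℕ → Set (c ⊔ ℓ₁)
    IsMinimalDegree α d = Span E α d (α ^ d) × (∀ m → m ℕ.< d → ¬ Span E α m (α ^ m))

    minimal-degree : ∀ α → ∃ (IsMinimalDegree α)
    minimal-degree α with algebraic α
    ... | f , (n₀ , fn₀#0) , root with M.degree-of-nonzero f (λ f≋0 → M.#⇒≉ fn₀#0 (f≋0 n₀))
    ...   | n , deg with M.HasDegree⇒Leading f deg
    ...     | x , x≉0 , lead with M.inverseOf x≉0 | expand f n lead
      where
      expand : ∀ f n {x} → M.Leading f n x → ∃[ w ] (Span E α n w × ev f α ≈ w + ι x * α ^ n)
      expand []      zero    (0≈x , _) = 0# , empty refl , sym (begin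
        0# + ι _ * 1#  ≈⟨ +-congˡ (*-congʳ (trans (⟦⟧-cong (M.sym 0≈x)) 0#-homo)) ⟩
        0# + 0# * 1#   ≈⟨ Z.solve 0 (Z.con 0ℤ :+ Z.con 0ℤ :* Z.con 1ℤ := Z.con 0ℤ) refl ⟩
        0#             ∎)
      expand []      (suc n) (0≈x , _) = 0# , A.Span-0 E-subring (suc n) , sym (begin
        0# + ι _ * α ^ suc n  ≈⟨ +-congˡ (*-congʳ (trans (⟦⟧-cong (M.sym 0≈x)) 0#-homo)) ⟩
        0# + 0# * α ^ suc n   ≈⟨ trans (+-identityˡ _) (zeroˡ _) ⟩
        0#             ∎)
      expand (y ∷ f) zero    {x} (y≈x , above) = 0# , empty refl , (begin
        ι y + α * ev f α   ≈⟨ +-cong (⟦⟧-cong y≈x) (*-congˡ (eval-zero (map ι f) α (λ k → trans (coeff-map f k) (trans (⟦⟧-cong (above (suc k) (s≤s z≤n))) 0#-homo)))) ⟩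
        ι x + α * 0#       ≈⟨ Z.solve 2 (λ x α → x :+ α :* Z.con 0ℤ := Z.con 0ℤ :+ x :* Z.con 1ℤ) refl (ι x) α ⟩
        0# + ι x * 1#      ∎)
      expand (y ∷ f) (suc n) {x} (f≈x , above) with expand f n (f≈x , λ k n<k → above (suc k) (s≤s n<k))
      ... | w , span , eq = ι y + α * w ,
        A.Span-+ E-subring (A.Span-≤ E-subring (s≤s z≤n) (A.Span-resp E-subring (*-identityʳ _) (A.Span-scale E-subring (image⊆E y) (A.Span-power E-subring 0))))
                           (A.Span-shift E-subring span) ,
        (begin
          ι y + α * ev f α                    ≈⟨ +-congˡ (*-congˡ eq) ⟩
          ι y + α * (w + ι x * α ^ n)         ≈⟨ Z.solve 5 (λ y α w x g → y :+ α :* (w :+ x :* g) := y :+ α :* w :+ x :* (α :* g)) refl (ι y) α w (ι x) (α ^ n) ⟩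
          ι y + α * w + ι x * (α * α ^ n)     ∎)
    ...       | z , xz≈1 | w , span , eq = least (λ d → Span E α d (α ^ d)) n
      (A.Span-resp E-subring (begin
        ι (M.- z) * w                          ≈⟨ *-congʳ (-‿homo z) ⟩
        - ι z * w                              ≈⟨ Z.solve 4 (λ z w x g → :- z :* w := x :* z :* g :- z :* (w :+ x :* g)) refl (ι z) w (ι x) (α ^ n) ⟩
        ι x * ι z * α ^ n - ι z * (w + ι x * α ^ n)
          ≈⟨ +-cong (*-congʳ (trans (sym (*-homo x z)) (trans (⟦⟧-cong xz≈1) 1#-homo))) (-‿cong (*-congˡ (trans (sym eq) root))) ⟩
        1# * α ^ n - ι z * 0#                  ≈⟨ Z.solve 2 (λ g z → Z.con 1ℤ :* g :- z :* Z.con 0ℤ := g) refl (α ^ n) (ι z) ⟩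
        α ^ n                                  ∎)
        (A.Span-scale E-subring (image⊆E (M.- z)) span))

    module _ {α d} (minimal : IsMinimalDegree α d) where
      -- Dividing by a nonzero `s` would produce a monic relation of degree `n`, below the minimum.
      independent : ∀ {n w s} → n ℕ.< d → Span E α n w → E s → w + s * α ^ n ≈ 0# → s ≈ 0#
      independent {n} {w} {s} n<d span s∈E eq with s ≟ 0#
      ... | yes s≈0 = s≈0
      ... | no s≉0 with inverse-closed E-subring image⊆E s∈E s≉0
      ...   | z , z∈E , sz≈1 = contradiction (A.Span-resp E-subring (begin
        - z * w                                ≈⟨ Z.solve 4 (λ z w s g → :- z :* w := s :* z :* g :- z :* (w :+ s :* g)) refl z w s (α ^ n) ⟩
        s * z * α ^ n - z * (w + s * α ^ n)    ≈⟨ +-cong (*-congʳ sz≈1) (-‿cong (*-congˡ eq)) ⟩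
        1# * α ^ n - z * 0#                    ≈⟨ Z.solve 2 (λ g z → Z.con 1ℤ :* g :- z :* Z.con 0ℤ := g) refl (α ^ n) z ⟩
        α ^ n                                  ∎)
        (A.Span-scale E-subring (neg-closed z∈E) span)) (proj₂ minimal n n<d)

    minimal-positive : ∀ {α d} → IsMinimalDegree α d → 0 ℕ.< d
    minimal-positive {d = zero}  (empty 1≈0 , _) = contradiction 1≈0 1≉0
    minimal-positive {d = suc d} _               = s≤s z≤n

  eval-snoc : ∀ f s z → eval (f List.++ s ∷ []) z ≈ eval f z + s * z ^ length f
  eval-snoc []      s z = Z.solve 2 (λ s z → s :+ z :* Z.con 0ℤ := Z.con 0ℤ :+ s :* Z.con 1ℤ) refl s z
  eval-snoc (x ∷ f) s z = begin
    x + z * eval (f List.++ s ∷ []) z          ≈⟨ +-congˡ (*-congˡ (eval-snoc f s z)) ⟩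
    x + z * (eval f z + s * z ^ length f)      ≈⟨ Z.solve 5 (λ x z f s g → x :+ z :* (f :+ s :* g) := x :+ z :* f :+ s :* (z :* g)) refl x z (eval f z) s (z ^ length f) ⟩
    x + z * eval f z + s * (z * z ^ length f)  ∎

  coeff-snoc : ∀ f s → Leading (f List.++ s ∷ []) (length f) s
  coeff-snoc []      s = Leading-C s
  coeff-snoc (x ∷ f) s with coeff-snoc f s
  ... | top , above = top , λ { (suc m) (s≤s f<m) → above m f<m }

  length-snoc : ∀ f (s : Carrier) → length (f List.++ s ∷ []) ≡ suc (length f)
  length-snoc f s = ≡.trans (Listₚ.length-++ f) (ℕₚ.+-comm (length f) 1)

  module K²-power where
    open import Algebra.Properties.Semiring.Exp K².semiring public using () renaming (_^_ to _^²_)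

    ^²-components : ∀ α β n → (α , β) ^² n ≡ (α ^ n , β ^ n)
    ^²-components α β zero    = ≡.refl
    ^²-components α β (suc n) = ≡.cong (λ (x , y) → α * x , β * y) (^²-components α β n)

  open K²-power

  module Extension {S : K².Carrier → Set (c ⊔ ℓ₁)} (S-spec : IsSpecialization S) where
    open IsSpecialization S-spec

    Source : Carrier → Set (c ⊔ ℓ₁)
    Source x = ∃[ x′ ] S (x , x′)

    domain-isSubring : IsSubring K Source
    domain-isSubring = record
      { ≈-closed   = λ x≈y (x′ , s) → x′ , ≈-closed (x≈y , refl) s
      ; 0-closed   = 0# , 0-closed
      ; 1-closed   = 1# , 1-closed
      ; +-closed   = λ (x′ , s) (y′ , t) → x′ + y′ , +-closed s t
      ; *-closed   = λ (x′ , s) (y′ , t) → x′ * y′ , *-closed s t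
      ; neg-closed = λ (x′ , s) → - x′ , neg-closed s
      }

    image⊆domain : ∀ m → Source (ι m)
    image⊆domain m = ι m , constant m

    private
      add : ∀ {α β n w w′ s s′ x x′} → Span² S (α , β) n (w , w′) → S (s , s′) →
            x ≈ w + s * α ^ n → x′ ≈ w′ + s′ * β ^ n → Span² S (α , β) (suc n) (x , x′)
      add {α} {β} {n} {w} {w′} {s} {s′} {x} {x′} span s∈S eq eq′ =
        span ⊕² s∈S [ ≡.subst (λ (a , b) → (x ≈ w + s * a) × (x′ ≈ w′ + s′ * b))
                        (≡.sym (^²-components α β n)) (eq , eq′) ]

    first : ∀ {α β n x x′} → Span² S (α , β) n (x , x′) → Span Source α n x
    first (empty² (x≈0 , _)) = empty x≈0
    first {α} {β} {suc n} (_⊕²_[_] {w = w , _} {s = s , s′} span s∈S (eq , _)) =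
      first span ⊕ (s′ , s∈S) [ trans eq (+-congˡ (*-congˡ (reflexive (≡.cong proj₁ (^²-components α β n))))) ]

    -- The second component of a combination depends polynomially on the image of the generator.
    second : ∀ {α n x} → Span Source α n x →
             ∃[ f ] (length f ≡ n × All (λ s′ → ∃[ s ] S (s , s′)) f × (∀ β → Span² S (α , β) n (x , eval f β)))
    second (empty x≈0) = [] , ≡.refl , [] , λ β → empty² (x≈0 , refl)
    second {α} (_⊕_[_] {s = s} span (s′ , s∈S) eq) with second span
    ... | f , ≡.refl , values , combination =
      f List.++ s′ ∷ [] , length-snoc f s′ , Allₚ.++⁺ values ((s , s∈S) ∷ []) ,
      λ β → add (combination β) s∈S eq (eval-snoc f s′ β)

    module _ {α d} (minimal : IsMinimalDegree Source domain-isSubring image⊆domain α d) where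

      -- Sending `α` to a root `β` of the image of its minimal polynomial is well defined: a
      -- combination of length at most `d` that vanishes at `α` has only zero coefficients, hence so
      -- has its image.
      adjoin : ∀ {β} → Span² S (α , β) d (α ^ d , β ^ d) → IsSpecialization (Span² S (α , β) d)
      adjoin {β} relation = record
        { isSubring = A².Span-isSubring isSubring relation′
        ; constant  = λ m → A².Span-⊇ isSubring relation′ (constant m)
        ; zero-zero = λ span → vanish ℕₚ.≤-refl span
        }
        where
        relation′ : Span² S (α , β) d ((α , β) ^² d)
        relation′ = ≡.subst (Span² S (α , β) d) (≡.sym (^²-components α β d)) relation

        vanish : ∀ {n x x′} → n ℕ.≤ d → Span² S (α , β) n (x , x′) → x ≈ 0# → x′ ≈ 0#
        vanish _ (empty² (_ , x′≈0)) _ = x′≈0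
        vanish {suc n} {x} {x′} n<d (_⊕²_[_] {w = w , w′} {s = s , s′} span s∈S (eq , eq′)) x≈0 = begin
          x′                                      ≈⟨ eq′ ⟩
          w′ + s′ * proj₂ ((α , β) ^² n)          ≈⟨ +-cong (vanish (ℕₚ.<⇒≤ n<d) span w≈0) (*-congʳ (zero-zero s∈S s≈0)) ⟩
          0# + 0# * proj₂ ((α , β) ^² n)          ≈⟨ trans (+-identityˡ _) (zeroˡ _) ⟩
          0#                                      ∎
          where
          sum≈0 : w + s * α ^ n ≈ 0#
          sum≈0 = trans (sym (trans eq (+-congˡ (*-congˡ (reflexive (≡.cong proj₁ (^²-components α β n))))))) x≈0

          s≈0 : s ≈ 0#
          s≈0 = independent Source domain-isSubring image⊆domain minimal n<d (first span) (s′ , s∈S) sum≈0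

          w≈0 : w ≈ 0#
          w≈0 = trans (sym (trans (+-congˡ (trans (*-congʳ s≈0) (zeroˡ _))) (+-identityʳ w))) sum≈0

      adjoin-⊇ : ∀ {β} → Span² S (α , β) d (α ^ d , β ^ d) → ∀ {z} → S z → Span² S (α , β) d z
      adjoin-⊇ {β} relation = A².Span-⊇ isSubring (≡.subst (Span² S (α , β) d) (≡.sym (^²-components α β d)) relation)

      adjoin-generator : ∀ {β} → Span² S (α , β) d (α ^ d , β ^ d) → Span² S (α , β) d (α , β)
      adjoin-generator {β} relation =
        A².Span-generator isSubring (≡.subst (Span² S (α , β) d) (≡.sym (^²-components α β d)) relation)

    private
      monic-root : ∀ f {d} → length f ≡ d → 0 ℕ.< d → ∃[ β ] eval f β ≈ β ^ d
      monic-root f {suc n} f≡d _ with algebraicallyClosed (f List.++ - 1# ∷ []) n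
        (≡.subst (HasDegree closure (f List.++ - 1# ∷ [])) f≡d
          (≉⇒# (λ eq → 1≉0 (begin
             1#          ≈⟨ Z.solve 0 (Z.con 1ℤ := :- (:- Z.con 1ℤ)) refl ⟩
             - - 1#      ≈⟨ -‿cong (trans (sym (proj₁ (coeff-snoc f (- 1#)))) eq) ⟩
             - 0#        ≈⟨ Z.solve 0 (:- Z.con 0ℤ := Z.con 0ℤ) refl ⟩
             0#          ∎))
          , proj₂ (coeff-snoc f (- 1#))))
      ... | β , root = β , (begin
        eval f β                                            ≈⟨ Z.solve 2 (λ e g → e := e :+ :- Z.con 1ℤ :* g :+ g) refl (eval f β) (β ^ length f) ⟩
        eval f β + - 1# * β ^ length f + β ^ length f       ≈⟨ +-congʳ (trans (sym (eval-snoc f (- 1#) β)) root) ⟩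
        0# + β ^ length f                                   ≈⟨ +-identityˡ _ ⟩
        β ^ length f                                        ≈⟨ reflexive (≡.cong (β ^_) f≡d) ⟩
        β ^ suc n                                           ∎)

    abstract
      -- The image of the minimal polynomial of `α` has a root, Ω being algebraically closed, and
      -- any root will do.
      extend : ∀ α → ∃[ β ] ∃[ S′ ] (IsSpecialization S′ × (∀ {z} → S z → S′ z) × S′ (α , β))
      extend α with minimal-degree Source domain-isSubring image⊆domain α
      ... | d , minimal with second (proj₁ minimal)
      ...   | f , f≡d , _ , combination with monic-root f f≡d (minimal-positive Source domain-isSubring image⊆domain minimal)
      ...     | β , root = β , _ , adjoin minimal relation , adjoin-⊇ minimal relation , adjoin-generator minimal relation
        where
        relation : Span² S (α , β) d (α ^ d , β ^ d)
        relation = A².Span-resp isSubring (refl , root) (combination β)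

  Span⊆ : ∀ {E D : Carrier → Set (c ⊔ ℓ₁)} → IsSubring K D → (∀ {z} → E z → D z) → ∀ {α} → D α →
          ∀ {n z} → Span E α n z → D z
  Span⊆ D-subring E⊆D α∈D (empty z≈0) = ≈-closed (sym z≈0) 0-closed
    where open IsSubring D-subring
  Span⊆ {D = D} D-subring E⊆D {α} α∈D {suc n} (w ⊕ s [ eq ]) =
    ≈-closed (sym eq) (+-closed (Span⊆ D-subring E⊆D α∈D w) (*-closed (E⊆D s) (power n)))
    where
    open IsSubring D-subring
    power : ∀ n → D (α ^ n)
    power zero    = 1-closed
    power (suc n) = *-closed α∈D (power n)

  -- E is Galois over M in the sense that the specializations of E jointly fix only M.
  record IsGalois (E : Carrier → Set (c ⊔ ℓ₁)) : Set (Level.suc (c ⊔ ℓ₁)) where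
    field
      isSubring : IsSubring K E
      constants : ∀ m → E (ι m)
      moves     : ∀ {w} → E w → ¬ image w →
                  ∃[ S ] (IsSpecialization S × (∀ {z} → E z → ∃[ z′ ] S (z , z′)) × (∃[ w′ ] (S (w , w′) × ¬ (w′ ≈ w))))

  image-isGalois : IsGalois image
  image-isGalois = record
    { isSubring = image-isSubring
    ; constants = λ m → m , refl
    ; moves     = λ w∈M w∉M → contradiction w∈M w∉M
    }

  -- Adjoining a root of a separable cubic.

  IsCubicRoot : Carrier → Carrier → Carrier → Set ℓ₁
  IsCubicRoot p q z = z * (z * z) + p * z + q ≈ 0#

  -- E(α) need not be normal over E. As `IsGalois` speaks of homomorphisms into Ω, which may leave
  -- E(α), the property nevertheless survives the adjunction of a single root.
  module AdjoinCubicRoot {E} (E-galois : IsGalois E) {p q α β γ} (p∈E : E p) (q∈E : E q)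
    (α-root : IsCubicRoot p q α) (β-root : IsCubicRoot p q β) (γ-root : IsCubicRoot p q γ)
    (α≉β : ¬ (α ≈ β)) (β≉γ : ¬ (β ≈ γ)) (α≉γ : ¬ (α ≈ γ)) where
    open IsGalois E-galois
    open IsSubring isSubring

    -- The inclusion of `E` into Ω; its extensions are the homomorphisms over `E`.
    Diagonal : K².Carrier → Set (c ⊔ ℓ₁)
    Diagonal (x , x′) = x ≈ x′ × E x

    diagonal : IsSpecialization Diagonal
    diagonal = record
      { isSubring = record
        { ≈-closed   = λ (x≈y , x′≈y′) (x≈x′ , x) → trans (sym x≈y) (trans x≈x′ x′≈y′) , ≈-closed x≈y x
        ; 0-closed   = refl , 0-closed
        ; 1-closed   = refl , 1-closed
        ; +-closed   = λ (eq , x) (eq′ , y) → +-cong eq eq′ , +-closed x y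
        ; *-closed   = λ (eq , x) (eq′ , y) → *-cong eq eq′ , *-closed x y
        ; neg-closed = λ (eq , x) → -‿cong eq , neg-closed x
        }
      ; constant  = λ m → refl , constants m
      ; zero-zero = λ (x≈x′ , _) x≈0 → trans (sym x≈x′) x≈0
      }

    open Extension diagonal renaming (Source to D)

    E⊆D : ∀ {x} → E x → D x
    E⊆D {x} x∈E = x , refl , x∈E

    D⊆E : ∀ {x} → D x → E x
    D⊆E (_ , _ , x∈E) = x∈E

    private
      module D = IsSubring domain-isSubring

      equal-components : ∀ {n x x′} → Span² Diagonal (α , α) n (x , x′) → x ≈ x′
      equal-components (empty² (x≈0 , x′≈0)) = trans x≈0 (sym x′≈0)
      equal-components {suc n} (span ⊕² s≈s′ , _ [ eq , eq′ ]) = trans eq (trans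
        (+-cong (equal-components span) (*-cong s≈s′ (reflexive (power n)))) (sym eq′))
        where
        open K²-power
        power : ∀ n → proj₁ ((α , α) ^² n) ≡ proj₂ ((α , α) ^² n)
        power n = ≡.trans (≡.cong proj₁ (^²-components α α n)) (≡.sym (≡.cong proj₂ (^²-components α α n)))

      Moved : Carrier → Set (Level.suc (c ⊔ ℓ₁))
      Moved w = ∃[ S ] (IsSpecialization S × (∀ {z} → D z → S (z , z)) × (∃[ α′ ] S (α , α′)) × (∃[ w′ ] (S (w , w′) × ¬ (w′ ≈ w))))

      module _ {d} (minimal : IsMinimalDegree D domain-isSubring image⊆domain α d) {w} (w∉E : ¬ E w) where
        -- The minimal polynomial of `α` over `E` is X^d - g, and w = f(α). A root `β` of it gives
        -- the homomorphism α ↦ β over `E`, which sends `w` to f(β).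
        conjugate : ∀ f g → (∀ β → Span² Diagonal (α , β) d (α ^ d , eval g β)) → (∀ β → Span² Diagonal (α , β) d (w , eval f β)) →
                    ∀ β → eval g β ≈ β ^ d → Moved w ⊎ eval f β ≈ w
        conjugate f g relations combination β root with eval f β ≟ w
        ... | yes eq = inj₂ eq
        ... | no neq = inj₁ (_ , adjoin minimal relation , (λ z → adjoin-⊇ minimal relation (refl , D⊆E z)) ,
                             (β , adjoin-generator minimal relation) , eval f β , combination β , neq)
          where
          relation : Span² Diagonal (α , β) d (α ^ d , β ^ d)
          relation = A².Span-resp (IsSpecialization.isSubring diagonal) (refl , root) (relations β)

        -- A polynomial that takes the value `w` more often than its degree allows is constant, so
        -- `w` would be its constant coefficient, an element of `E`.
        constant-absurd : ∀ s f zs → E s → Distinct zs → DegreeBelow (s ∷ f) (length zs) → 1 ℕ.≤ length zs →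
                          All (λ z → eval (s ∷ f) z ≈ w) zs → Moved w
        constant-absurd s f zs s∈E dis below 1≤ values = contradiction
          (≈-closed (x-y≈0⇒x≈y s w (zero-of-roots (s - w ∷ f) zs dis
             (λ { zero n≤0 → contradiction (ℕₚ.≤-trans 1≤ n≤0) λ () ; (suc m) n≤m → below (suc m) n≤m })
             (All.map (λ {z} eq → trans (Z.solve 4 (λ s w z f → s :- w :+ z :* f := s :+ z :* f :- w) refl s w z (eval f z))
                                    (trans (+-congʳ eq) (-‿inverseʳ w))) values) 0)) s∈E) w∉E

        value-at-generator : ∀ f → (∀ β → Span² Diagonal (α , β) d (w , eval f β)) → eval f α ≈ w
        value-at-generator f combination = sym (equal-components (combination α))

    private
      member : ∀ {s′} → ∃[ s ] (s ≈ s′ × E s) → E s′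
      member (_ , s≈s′ , s∈E) = ≈-closed s≈s′ s∈E

      value₀ : ∀ p₀ z → eval (p₀ ∷ []) z ≈ p₀
      value₀ p₀ z = trans (+-congˡ (zeroʳ z)) (+-identityʳ p₀)

      value₁ : ∀ p₀ p₁ z → eval (p₀ ∷ p₁ ∷ []) z ≈ p₀ + p₁ * z
      value₁ = Z.solve 3 (λ p₀ p₁ z → p₀ :+ z :* (p₁ :+ z :* Z.con 0ℤ) := p₀ :+ p₁ :* z) refl

      value₂ : ∀ p₀ p₁ p₂ z → eval (p₀ ∷ p₁ ∷ p₂ ∷ []) z ≈ p₀ + p₁ * z + p₂ * (z * z)
      value₂ = Z.solve 4 (λ p₀ p₁ p₂ z → p₀ :+ z :* (p₁ :+ z :* (p₂ :+ z :* Z.con 0ℤ)) := p₀ :+ p₁ :* z :+ p₂ :* (z :* z)) refl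

      linear : ∀ {e₀ e₁} → E e₀ → E e₁ → Span D α 2 (e₀ + e₁ * α)
      linear e₀∈ e₁∈ = empty refl ⊕ E⊆D e₀∈ [ refl ] ⊕ E⊆D e₁∈
        [ Z.solve 3 (λ e₀ e₁ α → e₀ :+ e₁ :* α := Z.con 0ℤ :+ e₀ :* Z.con 1ℤ :+ e₁ :* (α :* Z.con 1ℤ)) refl _ _ α ]

      module _ {d} (minimal : IsMinimalDegree D domain-isSubring image⊆domain α d) where
        independent₁ : ∀ {e₀ e₁} → 1 ℕ.< d → E e₀ → E e₁ → e₀ + e₁ * α ≈ 0# → e₀ ≈ 0# × e₁ ≈ 0#
        independent₁ {e₀} {e₁} 1<d e₀∈ e₁∈ eq = trans (sym (trans (+-congˡ (trans (*-congʳ e₁≈0) (zeroˡ α))) (+-identityʳ e₀))) eq , e₁≈0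
          where
          e₁≈0 : e₁ ≈ 0#
          e₁≈0 = independent D domain-isSubring image⊆domain minimal 1<d
            (empty refl ⊕ E⊆D e₀∈ [ refl ]) (E⊆D e₁∈)
            (trans (Z.solve 3 (λ e₀ e₁ α → Z.con 0ℤ :+ e₀ :* Z.con 1ℤ :+ e₁ :* (α :* Z.con 1ℤ) := e₀ :+ e₁ :* α) refl e₀ e₁ α) eq)

        independent₂ : ∀ {e₀ e₁ e₂} → 2 ℕ.< d → E e₀ → E e₁ → E e₂ → e₀ + e₁ * α + e₂ * (α * α) ≈ 0# →
                       e₀ ≈ 0# × e₁ ≈ 0# × e₂ ≈ 0#
        independent₂ {e₀} {e₁} {e₂} 2<d e₀∈ e₁∈ e₂∈ eq = proj₁ rest , proj₂ rest , e₂≈0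
          where
          e₂≈0 : e₂ ≈ 0#
          e₂≈0 = independent D domain-isSubring image⊆domain minimal 2<d (linear e₀∈ e₁∈) (E⊆D e₂∈)
            (trans (Z.solve 4 (λ e₀ e₁ e₂ α → e₀ :+ e₁ :* α :+ e₂ :* (α :* (α :* Z.con 1ℤ)) := e₀ :+ e₁ :* α :+ e₂ :* (α :* α)) refl e₀ e₁ e₂ α) eq)

          rest : e₀ ≈ 0# × e₁ ≈ 0#
          rest = independent₁ (ℕₚ.<-trans (s≤s (s≤s z≤n)) 2<d) e₀∈ e₁∈
            (trans (sym (trans (+-congˡ (trans (*-congʳ e₂≈0) (zeroˡ _))) (+-identityʳ _))) eq)

      -- The hypotheses say that X³ + pX + q = (X + p₁)(X² - p₁X - p₀).
      quadratic-or-linear : ∀ {p₀ p₁ z} → q + p₀ * p₁ ≈ 0# → p + p₀ + p₁ * p₁ ≈ 0# → IsCubicRoot p q z →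
                            eval (p₀ ∷ p₁ ∷ []) z ≈ z ^ 2 ⊎ z ≈ - p₁
      quadratic-or-linear {p₀} {p₁} {z} eq₀ eq₁ root with z ≟ - p₁
      ... | yes z≈-p₁ = inj₂ z≈-p₁
      ... | no z≉-p₁ = inj₁ (x-y≈0⇒x≈y _ _ (*-cancel {z + p₁} (begin
        (z + p₁) * (eval (p₀ ∷ p₁ ∷ []) z - z ^ 2)
          ≈⟨ Z.solve 5 (λ p q p₀ p₁ z → (z :+ p₁) :* (p₀ :+ z :* (p₁ :+ z :* Z.con 0ℤ) :- z :* (z :* Z.con 1ℤ))
                := (q :+ p₀ :* p₁) :+ (p :+ p₀ :+ p₁ :* p₁) :* z :- (z :* (z :* z) :+ p :* z :+ q)) refl p q p₀ p₁ z ⟩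
        (q + p₀ * p₁) + (p + p₀ + p₁ * p₁) * z - (z * (z * z) + p * z + q)
          ≈⟨ +-cong (+-cong eq₀ (*-congʳ eq₁)) (-‿cong root) ⟩
        0# + 0# * z - 0#
          ≈⟨ Z.solve 1 (λ z → Z.con 0ℤ :+ Z.con 0ℤ :* z :- Z.con 0ℤ := Z.con 0ℤ) refl z ⟩
        0# ∎)
        (λ z+p₁≈0 → z≉-p₁ (x-y≈0⇒x≈y z (- p₁) (trans (Z.solve 2 (λ z p₁ → z :- :- p₁ := z :+ p₁) refl z p₁) z+p₁≈0)))))

    private
      module _ {d} (minimal : IsMinimalDegree D domain-isSubring image⊆domain α d) {w} (w∉E : ¬ E w) where
        Relations : List Carrier → Set (c ⊔ ℓ₁)
        Relations g = ∀ β → Span² Diagonal (α , β) d (α ^ d , eval g β)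

        Conjugates : List Carrier → Set (c ⊔ ℓ₁)
        Conjugates f = ∀ β → Span² Diagonal (α , β) d (w , eval f β)

        -- The cubic splits into the minimal polynomial of `α` and a linear factor. At most one of
        -- the different roots `β` and `γ` belongs to the linear factor; another one is a conjugate
        -- of `α`.
        quadratic-moved : ∀ p₀ p₁ s₀ s₁ → d ≡ 2 → E p₀ → E p₁ → E s₀ →
                          Relations (p₀ ∷ p₁ ∷ []) → Conjugates (s₀ ∷ s₁ ∷ []) → Moved w
        quadratic-moved p₀ p₁ s₀ s₁ ≡.refl p₀∈ p₁∈ s₀∈ relations combination = choose (shape β-root) (shape γ-root)
          where
          relation : p₀ + p₁ * α ≈ α * α
          relation = trans (sym (value₁ p₀ p₁ α)) (trans (sym (equal-components (relations α))) (Z.solve 1 (λ a → a :* (a :* Z.con 1ℤ) := a :* a) refl α))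

          shapes : q + p₀ * p₁ ≈ 0# × p + p₀ + p₁ * p₁ ≈ 0#
          shapes = independent₁ minimal (s≤s (s≤s z≤n))
            (+-closed q∈E (*-closed p₀∈ p₁∈))
            (+-closed (+-closed p∈E p₀∈) (*-closed p₁∈ p₁∈)) (begin
              q + p₀ * p₁ + (p + p₀ + p₁ * p₁) * α
                ≈⟨ Z.solve 5 (λ p q p₀ p₁ a → q :+ p₀ :* p₁ :+ (p :+ p₀ :+ p₁ :* p₁) :* a
                     := (a :* (a :* a) :+ p :* a :+ q) :+ (a :+ p₁) :* ((p₀ :+ p₁ :* a) :- a :* a)) refl p q p₀ p₁ α ⟩
              (α * (α * α) + p * α + q) + (α + p₁) * ((p₀ + p₁ * α) - α * α)
                ≈⟨ +-cong α-root (*-congˡ (trans (+-congʳ relation) (-‿inverseʳ _))) ⟩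
              0# + (α + p₁) * 0#  ≈⟨ trans (+-identityˡ _) (zeroʳ _) ⟩
              0#                  ∎)

          shape : ∀ {z} → IsCubicRoot p q z → eval (p₀ ∷ p₁ ∷ []) z ≈ z ^ 2 ⊎ z ≈ - p₁
          shape = quadratic-or-linear (proj₁ shapes) (proj₂ shapes)

          moved-by : ∀ {z} → ¬ (α ≈ z) → eval (p₀ ∷ p₁ ∷ []) z ≈ z ^ 2 → Moved w
          moved-by {z} α≉z root with conjugate minimal w∉E (s₀ ∷ s₁ ∷ []) (p₀ ∷ p₁ ∷ []) relations combination z root
          ... | inj₁ moved = moved
          ... | inj₂ eq = constant-absurd minimal w∉E s₀ (s₁ ∷ []) (α ∷ z ∷ []) s₀∈ ((α≉z ∷ []) ∷ [] ∷ [])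
            (λ { (suc (suc m)) _ → refl ; (suc zero) (s≤s ()) }) (s≤s z≤n)
            (value-at-generator minimal w∉E (s₀ ∷ s₁ ∷ []) combination ∷ eq ∷ [])

          choose : eval (p₀ ∷ p₁ ∷ []) β ≈ β ^ 2 ⊎ β ≈ - p₁ → eval (p₀ ∷ p₁ ∷ []) γ ≈ γ ^ 2 ⊎ γ ≈ - p₁ → Moved w
          choose (inj₁ root) _           = moved-by α≉β root
          choose (inj₂ _)    (inj₁ root) = moved-by α≉γ root
          choose (inj₂ β≈)   (inj₂ γ≈)   = contradiction (trans β≈ (sym γ≈)) β≉γ

        -- The cubic is the minimal polynomial, so `β` and `γ` are both conjugates of `α`. If
        -- neither moved `w`, a polynomial of degree at most 2 would take the value `w` three times.
        cubic-moved : ∀ p₀ p₁ p₂ s₀ s₁ s₂ → d ≡ 3 → E p₀ → E p₁ → E p₂ → E s₀ →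
                      Relations (p₀ ∷ p₁ ∷ p₂ ∷ []) → Conjugates (s₀ ∷ s₁ ∷ s₂ ∷ []) → Moved w
        cubic-moved p₀ p₁ p₂ s₀ s₁ s₂ ≡.refl p₀∈ p₁∈ p₂∈ s₀∈ relations combination = choose (valid β-root) (valid γ-root)
          where
          shapes : p₀ + q ≈ 0# × p₁ + p ≈ 0# × p₂ ≈ 0#
          shapes = independent₂ minimal (s≤s (s≤s (s≤s z≤n))) (+-closed p₀∈ q∈E) (+-closed p₁∈ p∈E) p₂∈ (begin
            p₀ + q + (p₁ + p) * α + p₂ * (α * α)
              ≈⟨ Z.solve 6 (λ p q p₀ p₁ p₂ a → p₀ :+ q :+ (p₁ :+ p) :* a :+ p₂ :* (a :* a)
                    := (p₀ :+ p₁ :* a :+ p₂ :* (a :* a)) :- a :* (a :* (a :* Z.con 1ℤ)) :+ (a :* (a :* a) :+ p :* a :+ q)) refl p q p₀ p₁ p₂ α ⟩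
            (p₀ + p₁ * α + p₂ * (α * α)) - α ^ 3 + (α * (α * α) + p * α + q)
              ≈⟨ +-cong (+-congʳ (trans (sym (value₂ p₀ p₁ p₂ α)) (sym (equal-components (relations α))))) α-root ⟩
            α ^ 3 - α ^ 3 + 0#  ≈⟨ trans (+-identityʳ _) (-‿inverseʳ _) ⟩
            0#                  ∎)

          valid : ∀ {z} → IsCubicRoot p q z → Moved w ⊎ eval (s₀ ∷ s₁ ∷ s₂ ∷ []) z ≈ w
          valid {z} root = conjugate minimal w∉E (s₀ ∷ s₁ ∷ s₂ ∷ []) (p₀ ∷ p₁ ∷ p₂ ∷ []) relations combination z (begin
            eval (p₀ ∷ p₁ ∷ p₂ ∷ []) z
              ≈⟨ Z.solve 6 (λ p q p₀ p₁ p₂ z → p₀ :+ z :* (p₁ :+ z :* (p₂ :+ z :* Z.con 0ℤ))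
                    := (p₀ :+ q) :+ (p₁ :+ p) :* z :+ p₂ :* (z :* z) :- (z :* (z :* z) :+ p :* z :+ q) :+ z :* (z :* (z :* Z.con 1ℤ))) refl p q p₀ p₁ p₂ z ⟩
            (p₀ + q) + (p₁ + p) * z + p₂ * (z * z) - (z * (z * z) + p * z + q) + z ^ 3
              ≈⟨ +-congʳ (+-cong (+-cong (+-cong (proj₁ shapes) (*-congʳ (proj₁ (proj₂ shapes)))) (*-congʳ (proj₂ (proj₂ shapes)))) (-‿cong root)) ⟩
            0# + 0# * z + 0# * (z * z) - 0# + z ^ 3
              ≈⟨ Z.solve 1 (λ z → Z.con 0ℤ :+ Z.con 0ℤ :* z :+ Z.con 0ℤ :* (z :* z) :- Z.con 0ℤ :+ z :* (z :* (z :* Z.con 1ℤ)) := z :* (z :* (z :* Z.con 1ℤ))) refl z ⟩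
            z ^ 3 ∎)

          choose : Moved w ⊎ eval (s₀ ∷ s₁ ∷ s₂ ∷ []) β ≈ w → Moved w ⊎ eval (s₀ ∷ s₁ ∷ s₂ ∷ []) γ ≈ w → Moved w
          choose (inj₁ moved) _            = moved
          choose (inj₂ _)     (inj₁ moved) = moved
          choose (inj₂ eq)    (inj₂ eq′)   =
            constant-absurd minimal w∉E s₀ (s₁ ∷ s₂ ∷ []) (α ∷ β ∷ γ ∷ []) s₀∈
              ((α≉β ∷ α≉γ ∷ []) ∷ (β≉γ ∷ []) ∷ [] ∷ [])
              (λ { (suc (suc (suc m))) _ → refl ; (suc (suc zero)) (s≤s (s≤s ())) ; (suc zero) (s≤s ()) }) (s≤s z≤n)
              (value-at-generator minimal w∉E (s₀ ∷ s₁ ∷ s₂ ∷ []) combination ∷ eq ∷ eq′ ∷ [])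

        degree-at-most-3 : ¬ (3 ℕ.< d)
        degree-at-most-3 3<d = proj₂ minimal 3 3<d (empty refl ⊕ D.neg-closed (E⊆D q∈E) [ refl ] ⊕ D.neg-closed (E⊆D p∈E) [ refl ] ⊕ D.0-closed
          [ (begin
              α ^ 3  ≈⟨ Z.solve 3 (λ p q a → a :* (a :* (a :* Z.con 1ℤ)) := (a :* (a :* a) :+ p :* a :+ q) :+ (Z.con 0ℤ :+ :- q :* Z.con 1ℤ :+ :- p :* (a :* Z.con 1ℤ) :+ Z.con 0ℤ :* (a :* (a :* Z.con 1ℤ)))) refl p q α ⟩
              (α * (α * α) + p * α + q) + (0# + - q * 1# + - p * (α * 1#) + 0# * α ^ 2) ≈⟨ trans (+-congʳ α-root) (+-identityˡ _) ⟩
              0# + - q * 1# + - p * (α * 1#) + 0# * α ^ 2 ∎) ])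

        find-moved : ∀ g f → length g ≡ d → length f ≡ d → All (λ s′ → ∃[ s ] Diagonal (s , s′)) g →
                     All (λ s′ → ∃[ s ] Diagonal (s , s′)) f → Relations g → Conjugates f → Moved w
        find-moved _ [] _ 0≡d _ _ _ _ = contradiction (≡.subst (0 ℕ.<_) (≡.sym 0≡d) (minimal-positive D domain-isSubring image⊆domain minimal)) λ ()
        find-moved _ (s ∷ []) _ _ _ (s∈ ∷ []) _ combination =
          contradiction (≈-closed (trans (sym (value₀ s α)) (value-at-generator minimal w∉E (s ∷ []) combination)) (member s∈)) w∉E
        find-moved (p₀ ∷ p₁ ∷ []) (s₀ ∷ s₁ ∷ []) _ 2≡d (p₀∈ ∷ p₁∈ ∷ []) (s₀∈ ∷ _) =
          quadratic-moved p₀ p₁ s₀ s₁ (≡.sym 2≡d) (member p₀∈) (member p₁∈) (member s₀∈)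
        find-moved (p₀ ∷ p₁ ∷ p₂ ∷ []) (s₀ ∷ s₁ ∷ s₂ ∷ []) _ 3≡d (p₀∈ ∷ p₁∈ ∷ p₂∈ ∷ []) (s₀∈ ∷ _) =
          cubic-moved p₀ p₁ p₂ s₀ s₁ s₂ (≡.sym 3≡d) (member p₀∈) (member p₁∈) (member p₂∈) (member s₀∈)
        find-moved _ (_ ∷ _ ∷ _ ∷ _ ∷ f) _ 4+≡d _ _ _ _ =
          contradiction (≡.subst (3 ℕ.<_) 4+≡d (s≤s (s≤s (s≤s (s≤s z≤n))))) degree-at-most-3
        find-moved [] (_ ∷ _ ∷ []) ≡.refl ()
        find-moved (_ ∷ []) (_ ∷ _ ∷ []) ≡.refl ()
        find-moved (_ ∷ _ ∷ _ ∷ _) (_ ∷ _ ∷ []) ≡.refl ()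
        find-moved [] (_ ∷ _ ∷ _ ∷ []) ≡.refl ()
        find-moved (_ ∷ []) (_ ∷ _ ∷ _ ∷ []) ≡.refl ()
        find-moved (_ ∷ _ ∷ []) (_ ∷ _ ∷ _ ∷ []) ≡.refl ()
        find-moved (_ ∷ _ ∷ _ ∷ _ ∷ _) (_ ∷ _ ∷ _ ∷ []) ≡.refl ()

    private
      Moves : (Carrier → Set (c ⊔ ℓ₁)) → Carrier → Set (Level.suc (c ⊔ ℓ₁))
      Moves E′ w = ∃[ S ] (IsSpecialization S × (∀ {z} → E′ z → ∃[ z′ ] S (z , z′)) × (∃[ w′ ] (S (w , w′) × ¬ (w′ ≈ w))))

      from-moved : ∀ {d w} → Moved w → Moves (Span D α d) w
      from-moved (S , S-spec , S⊇ , (α′ , sα) , moved) =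
        S , S-spec , Span⊆ (Extension.domain-isSubring S-spec) (λ z → _ , S⊇ z) (α′ , sα) , moved

      from-extension : ∀ {d w} → Moves E w → Moves (Span D α d) w
      from-extension (S , S-spec , S⊇ , w′ , sw , neq) =
        let α′ , S′ , S′-spec , S⊆S′ , sα = Extension.extend S-spec α in
        S′ , S′-spec , Span⊆ (Extension.domain-isSubring S′-spec) (λ z → _ , S⊆S′ (proj₂ (S⊇ (D⊆E z)))) (α′ , sα) ,
        w′ , S⊆S′ sw , neq

      -- An element of `E` is moved by a homomorphism of `E`, extended to `α`; an element outside
      -- `E` is moved by a homomorphism over `E`.
      span-moves : ∀ {d} → IsMinimalDegree D domain-isSubring image⊆domain α d → ∀ {w} → Span D α d w → ¬ image w →
                   Dec (E w) → Moves (Span D α d) w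
      span-moves minimal span w∉M (yes w∈E) = from-extension (moves w∈E w∉M)
      span-moves minimal span w∉M (no w∉E)  =
        let g , g≡d , g∈ , relations   = second (proj₁ minimal)
            f , f≡d , f∈ , combination = second span
        in from-moved (find-moved minimal w∉E g f g≡d f≡d g∈ f∈ relations combination)

      span-isGalois : ∀ {d} → IsMinimalDegree D domain-isSubring image⊆domain α d → IsGalois (Span D α d)
      span-isGalois minimal = record
        { isSubring = A.Span-isSubring domain-isSubring (proj₁ minimal)
        ; constants = λ m → A.Span-⊇ domain-isSubring (proj₁ minimal) (E⊆D (constants m))
        ; moves     = λ {w} span w∉M → span-moves minimal span w∉M (decide (E w))
        }

    abstract
      E[α] : ∃[ E′ ] (IsGalois E′ × (∀ {z} → E z → E′ z) × E′ α)
      E[α] = let d , minimal = minimal-degree D domain-isSubring image⊆domain α in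
        Span D α d , span-isGalois minimal ,
        (λ z → A.Span-⊇ domain-isSubring (proj₁ minimal) (E⊆D z)) ,
        A.Span-generator domain-isSubring (proj₁ minimal)

  -- Polynomial relations among the roots.

  infixl 6 _⊞_
  infixl 7 _⊠_
  -- Polynomials over M kept as syntax, so that permuting the roots is a renaming of variables even
  -- before it is known to respect equality of values.
  data Term (I : Set) : Set c where
    var     : I → Term I
    const   : M.Carrier → Term I
    _⊞_ _⊠_ : Term I → Term I → Term I
    ⊟_      : Term I → Term I

  ⟦_⟧ : ∀ {I} → Term I → (I → Carrier) → Carrier
  ⟦ var i   ⟧ v = v i
  ⟦ const m ⟧ v = ι m
  ⟦ s ⊞ t   ⟧ v = ⟦ s ⟧ v + ⟦ t ⟧ v
  ⟦ s ⊠ t   ⟧ v = ⟦ s ⟧ v * ⟦ t ⟧ v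
  ⟦ ⊟ t     ⟧ v = - ⟦ t ⟧ v

  rename : ∀ {I J} → (I → J) → Term I → Term J
  rename ρ (var i)   = var (ρ i)
  rename ρ (const m) = const m
  rename ρ (s ⊞ t)   = rename ρ s ⊞ rename ρ t
  rename ρ (s ⊠ t)   = rename ρ s ⊠ rename ρ t
  rename ρ (⊟ t)     = ⊟ rename ρ t

  ⟦rename⟧ : ∀ {I J} (ρ : I → J) t v → ⟦ rename ρ t ⟧ v ≡ ⟦ t ⟧ (v ∘ ρ)
  ⟦rename⟧ ρ (var i)   v = ≡.refl
  ⟦rename⟧ ρ (const m) v = ≡.refl
  ⟦rename⟧ ρ (s ⊞ t)   v = ≡.cong₂ _+_ (⟦rename⟧ ρ s v) (⟦rename⟧ ρ t v)
  ⟦rename⟧ ρ (s ⊠ t)   v = ≡.cong₂ _*_ (⟦rename⟧ ρ s v) (⟦rename⟧ ρ t v)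
  ⟦rename⟧ ρ (⊟ t)     v = ≡.cong (-_) (⟦rename⟧ ρ t v)

  ⟦⟧-cong-env : ∀ {I} (t : Term I) {v w} → (∀ i → v i ≈ w i) → ⟦ t ⟧ v ≈ ⟦ t ⟧ w
  ⟦⟧-cong-env (var i)   eq = eq i
  ⟦⟧-cong-env (const m) eq = refl
  ⟦⟧-cong-env (s ⊞ t)   eq = +-cong (⟦⟧-cong-env s eq) (⟦⟧-cong-env t eq)
  ⟦⟧-cong-env (s ⊠ t)   eq = *-cong (⟦⟧-cong-env s eq) (⟦⟧-cong-env t eq)
  ⟦⟧-cong-env (⊟ t)     eq = -‿cong (⟦⟧-cong-env t eq)

  -- The condition under which `v i ↦ v (ρ i)` extends to a homomorphism from `M[ v ]` to Ω over M;
  -- its graph is `Graph v ρ`.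
  PreservesRelations : ∀ {I} → (I → Carrier) → (I → I) → Set (c ⊔ ℓ₁)
  PreservesRelations v ρ = ∀ t → ⟦ t ⟧ v ≈ 0# → ⟦ t ⟧ (v ∘ ρ) ≈ 0#

  M[_] : ∀ {I : Set} → (I → Carrier) → Carrier → Set (c ⊔ ℓ₁)
  M[ v ] x = ∃[ t ] ⟦ t ⟧ v ≈ x

  M[]-isSubring : ∀ {I : Set} (v : I → Carrier) → IsSubring K M[ v ]
  M[]-isSubring v = record
    { ≈-closed   = λ x≈y (t , eq) → t , trans eq x≈y
    ; 0-closed   = const M.0# , 0#-homo
    ; 1-closed   = const M.1# , 1#-homo
    ; +-closed   = λ (s , eq) (t , eq′) → s ⊞ t , +-cong eq eq′
    ; *-closed   = λ (s , eq) (t , eq′) → s ⊠ t , *-cong eq eq′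
    ; neg-closed = λ (t , eq) → ⊟ t , -‿cong eq
    }

  Graph : ∀ {I} → (I → Carrier) → (I → I) → K².Carrier → Set (c ⊔ ℓ₁)
  Graph v ρ (x , x′) = ∃[ t ] (⟦ t ⟧ v ≈ x × ⟦ t ⟧ (v ∘ ρ) ≈ x′)

  graph-isSpecialization : ∀ {I} (v : I → Carrier) ρ → PreservesRelations v ρ → IsSpecialization (Graph v ρ)
  graph-isSpecialization v ρ preserves = record
    { isSubring = record
      { ≈-closed   = λ (x≈y , x′≈y′) (t , eq , eq′) → t , trans eq x≈y , trans eq′ x′≈y′
      ; 0-closed   = const M.0# , 0#-homo , 0#-homo
      ; 1-closed   = const M.1# , 1#-homo , 1#-homo
      ; +-closed   = λ (s , eq₁ , eq₁′) (t , eq₂ , eq₂′) → s ⊞ t , +-cong eq₁ eq₂ , +-cong eq₁′ eq₂′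
      ; *-closed   = λ (s , eq₁ , eq₁′) (t , eq₂ , eq₂′) → s ⊠ t , *-cong eq₁ eq₂ , *-cong eq₁′ eq₂′
      ; neg-closed = λ (t , eq , eq′) → ⊟ t , -‿cong eq , -‿cong eq′
      }
    ; constant  = λ m → const m , refl , refl
    ; zero-zero = λ (t , eq , eq′) x≈0 → trans (sym eq′) (preserves t (trans eq x≈0))
    }

  module _ {S} (S-spec : IsSpecialization S) where
    open IsSpecialization S-spec

    terms-related : ∀ {I} {v v′ : I → Carrier} → (∀ i → S (v i , v′ i)) → ∀ t → S (⟦ t ⟧ v , ⟦ t ⟧ v′)
    terms-related related (var i)   = related i
    terms-related related (const m) = constant m
    terms-related related (s ⊞ t)   = +-closed (terms-related related s) (terms-related related t)
    terms-related related (s ⊠ t)   = *-closed (terms-related related s) (terms-related related t)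
    terms-related related (⊟ t)     = neg-closed (terms-related related t)

    specialization-preserves : ∀ {I} {v : I → Carrier} {ρ} → (∀ i → S (v i , v (ρ i))) → PreservesRelations v ρ
    specialization-preserves related t = zero-zero (terms-related related t)

  preserves-id : ∀ {I} (v : I → Carrier) → PreservesRelations v id
  preserves-id v t eq = eq

  preserves-∘ : ∀ {I} (v : I → Carrier) ρ ρ′ → PreservesRelations v ρ → PreservesRelations v ρ′ →
                PreservesRelations v (ρ ∘ ρ′)
  preserves-∘ v ρ ρ′ p p′ t eq =
    trans (sym (reflexive (⟦rename⟧ ρ′ t (v ∘ ρ)))) (p (rename ρ′ t) (trans (reflexive (⟦rename⟧ ρ′ t v)) (p′ t eq)))

  preserves-cong : ∀ {I} (v : I → Carrier) (ρ ρ′ : I → I) → (∀ i → ρ i ≡ ρ′ i) → PreservesRelations v ρ → PreservesRelations v ρ′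
  preserves-cong v ρ ρ′ eq p t t≈0 = trans (⟦⟧-cong-env t (λ i → reflexive (≡.cong v (≡.sym (eq i))))) (p t t≈0)

  -- The roots of X³ + pX + p.
  record CubicRoots (p : M.Carrier) : Set (c ⊔ ℓ₁) where
    field
      root     : Fin 3 → Carrier
      e₁       : root 0F + root 1F + root 2F ≈ 0#
      e₂       : root 0F * root 1F + root 1F * root 2F + root 2F * root 0F ≈ ι p
      e₃       : root 0F * root 1F * root 2F ≈ - ι p
      distinct : ∀ i j → root i ≈ root j → i ≡ j

    factored : ∀ z → z * (z * z) + ι p * z + ι p ≈ (z - root 0F) * ((z - root 1F) * (z - root 2F))
    factored z = begin
      z * (z * z) + ι p * z + ι p
        ≈⟨ +-cong (+-congˡ (*-congʳ (sym e₂))) (trans (Z.solve 1 (λ p → p := :- (:- p)) refl (ι p)) (-‿cong (sym e₃))) ⟩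
      z * (z * z) + (root 0F * root 1F + root 1F * root 2F + root 2F * root 0F) * z + - (root 0F * root 1F * root 2F)
        ≈⟨ Z.solve 4 (λ z x y w → z :* (z :* z) :+ (x :* y :+ y :* w :+ w :* x) :* z :+ :- (x :* y :* w)
              := (z :- x) :* ((z :- y) :* (z :- w)) :+ (x :+ y :+ w) :* (z :* z)) refl z (root 0F) (root 1F) (root 2F) ⟩
      (z - root 0F) * ((z - root 1F) * (z - root 2F)) + (root 0F + root 1F + root 2F) * (z * z)
        ≈⟨ trans (+-congˡ (trans (*-congʳ e₁) (zeroˡ _))) (+-identityʳ _) ⟩
      (z - root 0F) * ((z - root 1F) * (z - root 2F)) ∎

    isRoot : ∀ i → IsCubicRoot (ι p) (ι p) (root i)
    isRoot 0F = trans (factored _) (trans (*-congʳ (-‿inverseʳ _)) (zeroˡ _))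
    isRoot 1F = trans (factored _) (trans (*-congˡ (trans (*-congʳ (-‿inverseʳ _)) (zeroˡ _))) (zeroʳ _))
    isRoot 2F = trans (factored _) (trans (*-congˡ (trans (*-congˡ (-‿inverseʳ _)) (zeroʳ _))) (zeroʳ _))

    complete : ∀ z → IsCubicRoot (ι p) (ι p) z → ∃[ i ] z ≈ root i
    complete z eq with z ≟ root 0F | z ≟ root 1F
    ... | yes z≈x | _       = 0F , z≈x
    ... | no _    | yes z≈y = 1F , z≈y
    ... | no z≉x  | no z≉y  = 2F , x-y≈0⇒x≈y _ _ (*-cancel (*-cancel (trans (sym (factored z)) eq)
      (λ eq → z≉x (x-y≈0⇒x≈y _ _ eq))) (λ eq → z≉y (x-y≈0⇒x≈y _ _ eq)))

    apart : ∀ {i j} → ¬ (i ≡ j) → ¬ (root i ≈ root j)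
    apart i≢j eq = i≢j (distinct _ _ eq)

    module _ {S} (S-spec : IsSpecialization S) where
      open IsSpecialization S-spec

      root-image : ∀ i → ∃[ z ] S (root i , z) → ∃[ j ] S (root i , root j)
      root-image i (z , s) =
        let j , z≈j = complete z (zero-zero (+-closed (+-closed (*-closed s (*-closed s s)) (*-closed (constant p) s)) (constant p)) (isRoot i))
        in j , ≈-closed (refl , z≈j) s

      permutes-roots : (∀ i → ∃[ z ] S (root i , z)) → ∃[ σ ] (∀ i → S (root i , root (act σ i)))
      permutes-roots images =
        let i₀ , s₀ = root-image 0F (images 0F)
            i₁ , s₁ = root-image 1F (images 1F)
            i₂ , s₂ = root-image 2F (images 2F)
            σ , eq₀ , eq₁ , eq₂ = S₃.act-surjective i₀ i₁ i₂ (different s₀ s₁ λ ()) (different s₁ s₂ λ ()) (different s₂ s₀ λ ())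
        in σ , λ { 0F → ≡.subst (λ j → S (root 0F , root j)) (≡.sym eq₀) s₀
                 ; 1F → ≡.subst (λ j → S (root 1F , root j)) (≡.sym eq₁) s₁
                 ; 2F → ≡.subst (λ j → S (root 2F , root j)) (≡.sym eq₂) s₂ }
        where
        different : ∀ {i i′ j j′} → S (root i , root i′) → S (root j , root j′) → ¬ (i ≡ j) → ¬ (i′ ≡ j′)
        different s t i≢j ≡.refl = apart i≢j (injective s t refl)

    adjoin-roots : ∀ {E} → IsGalois E → ∃[ E′ ] (IsGalois E′ × (∀ {z} → E z → E′ z) × (∀ i → E′ (root i)))
    adjoin-roots {E} E-galois =
      let E₀ , galois₀ , ⊆₀ , ∈₀ = adjoin E-galois 0F 1F 2F (λ ()) (λ ()) (λ ())
          E₁ , galois₁ , ⊆₁ , ∈₁ = adjoin galois₀ 1F 2F 0F (λ ()) (λ ()) (λ ())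
          E₂ , galois₂ , ⊆₂ , ∈₂ = adjoin galois₁ 2F 0F 1F (λ ()) (λ ()) (λ ())
      in E₂ , galois₂ , (λ z → ⊆₂ (⊆₁ (⊆₀ z))) , λ { 0F → ⊆₂ (⊆₁ ∈₀) ; 1F → ⊆₂ ∈₁ ; 2F → ∈₂ }
      where
      adjoin : ∀ {E} → IsGalois E → ∀ i j k → ¬ (i ≡ j) → ¬ (j ≡ k) → ¬ (i ≡ k) →
               ∃[ E′ ] (IsGalois E′ × (∀ {z} → E z → E′ z) × E′ (root i))
      adjoin E-galois i j k i≢j j≢k i≢k = AdjoinCubicRoot.E[α] E-galois
        (IsGalois.constants E-galois p) (IsGalois.constants E-galois p) (isRoot i) (isRoot j) (isRoot k)
        (apart i≢j) (apart j≢k) (apart i≢k)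

    extend-roots : ∀ {S} → IsSpecialization S →
                   ∃[ S′ ] (IsSpecialization S′ × (∀ {z} → S z → S′ z) × (∀ i → ∃[ z ] S′ (root i , z)))
    extend-roots S-spec =
      let z₀ , S₀ , spec₀ , ⊆₀ , ∈₀ = Extension.extend S-spec (root 0F)
          z₁ , S₁ , spec₁ , ⊆₁ , ∈₁ = Extension.extend spec₀ (root 1F)
          z₂ , S₂ , spec₂ , ⊆₂ , ∈₂ = Extension.extend spec₁ (root 2F)
      in S₂ , spec₂ , (λ z → ⊆₂ (⊆₁ (⊆₀ z))) , λ { 0F → z₀ , ⊆₂ (⊆₁ ∈₀) ; 1F → z₁ , ⊆₂ ∈₁ ; 2F → z₂ , ∈₂ }

  -- The Galois group of the compositum.

  module JointRoots {p q} (X : CubicRoots p) (Y : CubicRoots q) where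
    module X = CubicRoots X
    module Y = CubicRoots Y
    open X public using () renaming (root to x)
    open Y public using () renaming (root to y)

    roots : Fin 3 ⊎ Fin 3 → Carrier
    roots = [ x , y ]′

    act² : S₃ → S₃ → Fin 3 ⊎ Fin 3 → Fin 3 ⊎ Fin 3
    act² σ τ = Sum.map (act σ) (act τ)

    record G (σ τ : S₃) : Set (c ⊔ ℓ₁) where
      constructor conjugation
      field preserves : PreservesRelations roots (act² σ τ)
    open G public

    G-id : G 0F 0F
    G-id = conjugation (preserves-cong roots id (act² 0F 0F)
      (λ { (inj₁ i) → ≡.cong inj₁ (≡.sym (S₃.act-id i)) ; (inj₂ j) → ≡.cong inj₂ (≡.sym (S₃.act-id j)) }) (preserves-id roots))

    G-∙ : ∀ {σ τ σ′ τ′} → G σ τ → G σ′ τ′ → G (σ S₃.∙ σ′) (τ S₃.∙ τ′)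
    G-∙ {σ} {τ} {σ′} {τ′} g g′ = conjugation (preserves-cong roots (act² σ τ ∘ act² σ′ τ′) (act² (σ S₃.∙ σ′) (τ S₃.∙ τ′))
      (λ { (inj₁ i) → ≡.cong inj₁ (≡.sym (S₃.act-∙ σ σ′ i)) ; (inj₂ j) → ≡.cong inj₂ (≡.sym (S₃.act-∙ τ τ′ j)) })
      (preserves-∘ roots (act² σ τ) (act² σ′ τ′) (preserves g) (preserves g′)))

    open S₃.Subgroup G (λ σ τ → decide (G σ τ)) G-id G-∙ public

    module _ {S} (S-spec : IsSpecialization S) where
      joint-permutation : (∀ i → ∃[ z ] S (x i , z)) → (∀ j → ∃[ z ] S (y j , z)) →
                          ∃[ σ ] ∃[ τ ] (G σ τ × (∀ i → S (roots i , roots (act² σ τ i))))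
      joint-permutation images images′ =
        let σ , on-x = X.permutes-roots S-spec images
            τ , on-y = Y.permutes-roots S-spec images′
            related : ∀ i → S (roots i , roots (act² σ τ i))
            related = λ { (inj₁ i) → on-x i ; (inj₂ j) → on-y j }
        in σ , τ , conjugation (specialization-preserves S-spec {ρ = act² σ τ} related) , related

    abstract
      -- A value outside M is moved by a homomorphism on a Galois ring that contains all six roots.
      -- This homomorphism permutes both sets of roots and so comes from an element of `G`.
      fixed⇒∈M : ∀ t → (∀ {σ τ} → G σ τ → ⟦ t ⟧ (roots ∘ act² σ τ) ≈ ⟦ t ⟧ roots) → image (⟦ t ⟧ roots)
      fixed⇒∈M t fixed with decide (image (⟦ t ⟧ roots))
      ... | yes ∈M = ∈M
      ... | no ∉M = contradiction
        (let E , galois , ⊆E , x∈E = X.adjoin-roots image-isGalois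
             F , galois′ , ⊆F , y∈F = Y.adjoin-roots galois
             v∈F : ∀ i → F (roots i)
             v∈F = λ { (inj₁ i) → ⊆F (x∈E i) ; (inj₂ j) → y∈F j }
             S , spec , domain , w′ , sw , neq = IsGalois.moves galois′ (terms∈ galois′ v∈F t) ∉M
             σ , τ , g , related = joint-permutation spec (λ i → domain (v∈F (inj₁ i))) (λ j → domain (v∈F (inj₂ j)))
         in neq (trans (IsSpecialization.functional spec sw (terms-related spec related t) refl) (fixed g)))
        id
        where
        terms∈ : ∀ {F} → IsGalois F → (∀ i → F (roots i)) → ∀ t → F (⟦ t ⟧ roots)
        terms∈ {F} galois ∈F = go
          where
          open IsSubring (IsGalois.isSubring galois)
          go : ∀ t → F (⟦ t ⟧ roots)
          go (var i)   = ∈F i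
          go (const m) = IsGalois.constants galois m
          go (s ⊞ t)   = +-closed (go s) (go t)
          go (s ⊠ t)   = *-closed (go s) (go t)
          go (⊟ t)     = neg-closed (go t)

    G⇒first : ∀ {σ τ} → G σ τ → PreservesRelations x (act σ)
    G⇒first {σ} {τ} g t t≈0 = trans (sym (reflexive (⟦rename⟧ inj₁ t (roots ∘ act² σ τ)))) (preserves g (rename inj₁ t) (trans (reflexive (⟦rename⟧ inj₁ t roots)) t≈0))

    G⇒second : ∀ {σ τ} → G σ τ → PreservesRelations y (act τ)
    G⇒second {σ} {τ} g t t≈0 = trans (sym (reflexive (⟦rename⟧ inj₂ t (roots ∘ act² σ τ)))) (preserves g (rename inj₂ t) (trans (reflexive (⟦rename⟧ inj₂ t roots)) t≈0))

    private
      same-permutation : ∀ {p} (R : CubicRoots p) {S} → IsSpecialization S → let open CubicRoots R in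
        ∀ σ σ′ → (∀ i → S (root i , root (act σ i))) → (∀ i → S (root i , root (act σ′ i))) → σ ≡ σ′
      same-permutation R spec σ σ′ s s′ =
        S₃.act-faithful σ σ′ (λ i → CubicRoots.distinct R _ _ (IsSpecialization.functional spec (s i) (s′ i) refl))

    abstract
      -- The homomorphism of M[x] given by `σ` extends to the y's and then permutes both sets of
      -- roots; on the x's it is still `σ`, as these are distinct.
      first⇒G : ∀ {σ} → PreservesRelations x (act σ) → ∃[ τ ] G σ τ
      first⇒G {σ} preserves =
        let spec = graph-isSpecialization x (act σ) preserves
            S , S-spec , ⊆S , images = Y.extend-roots spec
            on-x : ∀ i → S (x i , x (act σ i))
            on-x = λ i → ⊆S (var i , refl , refl)
            σ′ , τ , g , related = joint-permutation S-spec (λ i → _ , on-x i) images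
        in τ , ≡.subst (λ σ → G σ τ) (same-permutation X S-spec σ′ σ (λ i → related (inj₁ i)) on-x) g

      second⇒G : ∀ {τ} → PreservesRelations y (act τ) → ∃[ σ ] G σ τ
      second⇒G {τ} preserves =
        let spec = graph-isSpecialization y (act τ) preserves
            S , S-spec , ⊆S , images = X.extend-roots spec
            on-y : ∀ i → S (y i , y (act τ i))
            on-y = λ i → ⊆S (var i , refl , refl)
            σ , τ′ , g , related = joint-permutation S-spec images (λ i → _ , on-y i)
        in σ , ≡.subst (λ τ → G σ τ) (same-permutation Y S-spec τ′ τ (λ i → related (inj₂ i)) on-y) g

  -- Splitting fields and their automorphisms as permutations.

  ev-cubic : ∀ p z → ev (cubic M p) z ≈ z * (z * z) + ι p * z + ι p
  ev-cubic p z = begin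
    ev (cubic M p) z
      ≈⟨ ev-+ (X³ M.+ₚ M.C p M.*ₚ M.X) (M.C p) z ⟩
    ev (X³ M.+ₚ M.C p M.*ₚ M.X) z + ev (M.C p) z
      ≈⟨ +-cong (trans (ev-+ X³ (M.C p M.*ₚ M.X) z) (+-cong (ev-^ M.X 3 z (ev-X z))
           (trans (ev-* (M.C p) M.X z) (*-cong (ev-C p z) (ev-X z))))) (ev-C p z) ⟩
    z ^ 3 + ι p * z + ι p
      ≈⟨ Z.solve 2 (λ z p → z :* (z :* (z :* Z.con 1ℤ)) :+ p :* z :+ p := z :* (z :* z) :+ p :* z :+ p) refl z (ι p) ⟩
    z * (z * z) + ι p * z + ι p ∎
    where
    open SemiringDefinitions (RawRing.rawSemiring M.polyRing) using () renaming (_^_ to _^ₚ_)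
    X³ : M.Poly
    X³ = M.X ^ₚ 3

  module SplittingField {p} (R : CubicRoots p) where
    open CubicRoots R

    L : Subfield closure (c ⊔ ℓ₁)
    L = Spl Ω (cubic M p)

    L∈ : Carrier → Set (c ⊔ ℓ₁)
    L∈ = Subfield.Member L

    private module L = RawRing (Subfield.ring L)

    root∈L : ∀ i → L∈ (root i)
    root∈L i = gen (inj₂ (trans (ev-cubic p (root i)) (isRoot i)))

    -- The polynomial expressions in the roots already form a field, since the inverse of an
    -- algebraic element is a polynomial in it.
    L⊆M[root] : ∀ {z} → L∈ z → M[ root ] z
    L⊆M[root] (gen (inj₁ (m , eq))) = const m , eq
    L⊆M[root] (gen (inj₂ eq))       = let i , z≈ = complete _ (trans (sym (ev-cubic p _)) eq) in var i , sym z≈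
    L⊆M[root] (resp x≈y x)          = IsSubring.≈-closed (M[]-isSubring root) x≈y (L⊆M[root] x)
    L⊆M[root] 0∈                    = IsSubring.0-closed (M[]-isSubring root)
    L⊆M[root] 1∈                    = IsSubring.1-closed (M[]-isSubring root)
    L⊆M[root] (+∈ x y)              = IsSubring.+-closed (M[]-isSubring root) (L⊆M[root] x) (L⊆M[root] y)
    L⊆M[root] (*∈ x y)              = IsSubring.*-closed (M[]-isSubring root) (L⊆M[root] x) (L⊆M[root] y)
    L⊆M[root] (-∈ x)                = IsSubring.neg-closed (M[]-isSubring root) (L⊆M[root] x)
    L⊆M[root] (⁻¹∈ xy≈1 x)          =
      let z , z∈ , xz≈1 = inverse-closed (M[]-isSubring root) (λ m → const m , refl) (L⊆M[root] x) (invertible-nonzero xy≈1)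
      in IsSubring.≈-closed (M[]-isSubring root) (*-cancelˡ (invertible-nonzero xy≈1) (trans xz≈1 (sym xy≈1))) z∈

    M[root]⊆L : ∀ t → L∈ (⟦ t ⟧ root)
    M[root]⊆L (var i)   = root∈L i
    M[root]⊆L (const m) = gen (inj₁ (m , refl))
    M[root]⊆L (s ⊞ t)   = +∈ (M[root]⊆L s) (M[root]⊆L t)
    M[root]⊆L (s ⊠ t)   = *∈ (M[root]⊆L s) (M[root]⊆L t)
    M[root]⊆L (⊟ t)     = -∈ (M[root]⊆L t)

    Gal-L : Group _ _
    Gal-L = Gal L image

    private
      module Gal-L = Group Gal-L
      Aut = Automorphism L image
      open Automorphism using (to)

    module _ (φ : Aut) where
      private module φ = Automorphism φ

      automorphism-graph : K².Carrier → Set (c ⊔ ℓ₁)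
      automorphism-graph (x , x′) = ∃[ e ] (proj₁ e ≈ x × proj₁ (to φ e) ≈ x′)

      automorphism-isSpecialization : IsSpecialization automorphism-graph
      automorphism-isSpecialization = record
        { isSubring = record
          { ≈-closed   = λ (x≈y , x′≈y′) (e , eq , eq′) → e , trans eq x≈y , trans eq′ x′≈y′
          ; 0-closed   = L.0# , refl , φ.0#-homo
          ; 1-closed   = L.1# , refl , φ.1#-homo
          ; +-closed   = λ (d , eq₁ , eq₁′) (e , eq₂ , eq₂′) → d L.+ e , +-cong eq₁ eq₂ , trans (φ.+-homo d e) (+-cong eq₁′ eq₂′)
          ; *-closed   = λ (d , eq₁ , eq₁′) (e , eq₂ , eq₂′) → d L.* e , *-cong eq₁ eq₂ , trans (φ.*-homo d e) (*-cong eq₁′ eq₂′)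
          ; neg-closed = λ (e , eq , eq′) → L.- e , -‿cong eq , trans (φ.-‿homo e) (-‿cong eq′)
          }
        ; constant  = λ m → (ι m , gen (inj₁ (m , refl))) , refl , φ.fixes _ (m , refl)
        ; zero-zero = λ { (e , eq , eq′) x≈0 → trans (sym eq′) (trans (φ.⟦⟧-cong {e} {L.0#} (trans eq x≈0)) φ.0#-homo) }
        }

      private
        permutation-data : ∃[ σ ] (∀ i → automorphism-graph (root i , root (act σ i)))
        permutation-data = permutes-roots automorphism-isSpecialization (λ i → _ , (root i , root∈L i) , refl , refl)

      permutation : S₃
      permutation = proj₁ permutation-data

      permutation-preserves : PreservesRelations root (act permutation)
      permutation-preserves = specialization-preserves automorphism-isSpecialization (proj₂ permutation-data)

      automorphism-on-terms : ∀ e t → ⟦ t ⟧ root ≈ proj₁ e → proj₁ (to φ e) ≈ ⟦ t ⟧ (root ∘ act permutation)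
      automorphism-on-terms e t eq = IsSpecialization.functional automorphism-isSpecialization
        (e , refl , refl) (terms-related automorphism-isSpecialization (proj₂ permutation-data) t) (sym eq)

    -- Stated for products of two, so that commuting permutations give commuting automorphisms
    -- without a computation of `permutation` on a product.
    permutations-determine : ∀ φ ψ φ′ ψ′ → permutation φ S₃.∙ permutation ψ ≡ permutation φ′ S₃.∙ permutation ψ′ →
                             (φ Gal-L.∙ ψ) Gal-L.≈ (φ′ Gal-L.∙ ψ′)
    permutations-determine φ ψ φ′ ψ′ eq e =
      let t , t≈e = L⊆M[root] (proj₂ e) in
      trans (composite φ ψ t t≈e) (trans (⟦⟧-cong-env t (λ i → reflexive (≡.cong root (same i)))) (sym (composite φ′ ψ′ t t≈e)))
      where
      composite : ∀ φ ψ t → ⟦ t ⟧ root ≈ proj₁ e →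
                  proj₁ (to φ (to ψ e)) ≈ ⟦ t ⟧ (root ∘ act (permutation φ) ∘ act (permutation ψ))
      composite φ ψ t t≈e = trans
        (automorphism-on-terms φ (to ψ e) (rename (act (permutation ψ)) t)
          (trans (reflexive (⟦rename⟧ (act (permutation ψ)) t root)) (sym (automorphism-on-terms ψ e t t≈e))))
        (reflexive (⟦rename⟧ (act (permutation ψ)) t (root ∘ act (permutation φ))))

      same : ∀ i → act (permutation φ) (act (permutation ψ) i) ≡ act (permutation φ′) (act (permutation ψ′) i)
      same i = ≡.trans (≡.sym (S₃.act-∙ (permutation φ) (permutation ψ) i))
                 (≡.trans (≡.cong (λ σ → act σ i) eq) (S₃.act-∙ (permutation φ′) (permutation ψ′) i))

    trivial-permutation : ∀ φ → permutation φ ≡ 0F → φ Gal-L.≈ Gal-L.ε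
    trivial-permutation φ eq e =
      let t , t≈e = L⊆M[root] (proj₂ e) in
      trans (automorphism-on-terms φ e t t≈e)
        (trans (⟦⟧-cong-env t (λ i → reflexive (≡.cong root (≡.trans (≡.cong (λ σ → act σ i) eq) (S₃.act-id i))))) t≈e)

    module _ {σ} (σ-preserves : PreservesRelations root (act σ)) where
      private
        module Γ = IsSpecialization (graph-isSpecialization root (act σ) σ-preserves)

        term : L.Carrier → Term (Fin 3)
        term e = proj₁ (L⊆M[root] (proj₂ e))

        move-term : Term (Fin 3) → L.Carrier
        move-term t = ⟦ rename (act σ) t ⟧ root , M[root]⊆L (rename (act σ) t)

        f : L.Carrier → L.Carrier
        f e = move-term (term e)

        graph : ∀ e → Graph root (act σ) (proj₁ e , proj₁ (f e))
        graph e = term e , proj₂ (L⊆M[root] (proj₂ e)) , sym (reflexive (⟦rename⟧ (act σ) (term e) root))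

      permutation-automorphism : Aut
      permutation-automorphism = record
        { to = f
        ; isRingIsomorphism = record
          { isRingMonomorphism = record
            { isRingHomomorphism = record
              { isSemiringHomomorphism = record
                { isNearSemiringHomomorphism = record
                  { +-isMonoidHomomorphism = record
                    { isMagmaHomomorphism = record
                      { isRelHomomorphism = record { cong = λ {d} {e} d≈e → Γ.functional (graph d) (graph e) d≈e }
                      ; homo = λ d e → Γ.functional (graph (d L.+ e)) (Γ.+-closed (graph d) (graph e)) refl
                      }
                    ; ε-homo = Γ.functional (graph L.0#) Γ.0-closed refl
                    }
                  ; *-homo = λ d e → Γ.functional (graph (d L.* e)) (Γ.*-closed (graph d) (graph e)) refl
                  }
                ; 1#-homo = Γ.functional (graph L.1#) Γ.1-closed refl
                }
              ; -‿homo = λ e → Γ.functional (graph (L.- e)) (Γ.neg-closed (graph e)) refl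
              }
            ; injective = λ {d} {e} eq → Γ.injective (graph d) (graph e) eq
            }
          -- Applying `σ⁻¹` to the variables of a term for `e` gives a preimage of `e`.
          ; surjective = λ e → let t , t≈e = L⊆M[root] (proj₂ e) in
              (⟦ rename (act (S₃.inv σ)) t ⟧ root , M[root]⊆L (rename (act (S₃.inv σ)) t)) ,
              λ {d} d≈ → trans (Γ.functional (graph d) (rename (act (S₃.inv σ)) t , sym d≈ , refl) refl)
                (trans (reflexive (⟦rename⟧ (act (S₃.inv σ)) t (root ∘ act σ)))
                  (trans (⟦⟧-cong-env t (λ i → reflexive (≡.cong root (S₃.act-inv σ i)))) t≈e))
          }
        ; fixes = λ { e (m , ιm≈e) → trans (Γ.functional (graph e) (Γ.constant m) (sym ιm≈e)) ιm≈e }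
        }

      permutation-automorphism-on-roots : ∀ e i → proj₁ e ≈ root i → proj₁ (to permutation-automorphism e) ≈ root (act σ i)
      permutation-automorphism-on-roots e i eq = Γ.functional (graph e) (var i , sym eq , refl) refl

    private
      module _ {σ} (σ-preserves : PreservesRelations root (act σ)) where
        φ = permutation-automorphism {σ} σ-preserves

        on-roots : ∀ e i → proj₁ e ≈ root i → proj₁ (to φ e) ≈ root (act σ i)
        on-roots = permutation-automorphism-on-roots {σ} σ-preserves

        rootᴸ : Fin 3 → L.Carrier
        rootᴸ i = root i , root∈L i

        trivial⇒id : φ Gal-L.≈ Gal-L.ε → σ ≡ 0F
        trivial⇒id φ≈ε = S₃.act-faithful σ 0F λ i → distinct _ _
          (trans (sym (on-roots (rootᴸ i) i refl)) (trans (φ≈ε (rootᴸ i)) (reflexive (≡.cong root (≡.sym (S₃.act-id i))))))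

        order-2 : (φ Gal-L.∙ φ) Gal-L.≈ Gal-L.ε → σ S₃.∙ σ ≡ 0F
        order-2 φ²≈ε = S₃.act-faithful (σ S₃.∙ σ) 0F λ i → distinct _ _
          (trans (reflexive (≡.cong root (S₃.act-∙ σ σ i)))
            (trans (sym (on-roots (to φ (rootᴸ i)) (act σ i) (on-roots (rootᴸ i) i refl)))
              (trans (φ²≈ε (rootᴸ i)) (reflexive (≡.cong root (≡.sym (S₃.act-id i)))))))

        order-3 : (φ Gal-L.∙ (φ Gal-L.∙ φ)) Gal-L.≈ Gal-L.ε → σ S₃.∙ (σ S₃.∙ σ) ≡ 0F
        order-3 φ³≈ε = S₃.act-faithful (σ S₃.∙ (σ S₃.∙ σ)) 0F λ i → distinct (act (σ S₃.∙ (σ S₃.∙ σ)) i) (act 0F i)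
          (trans (reflexive (≡.cong root (≡.trans (S₃.act-∙ σ (σ S₃.∙ σ) i) (≡.cong (act σ) (S₃.act-∙ σ σ i)))))
            (trans (sym (on-roots (to φ (to φ (rootᴸ i))) (act σ (act σ i)) (on-roots (to φ (rootᴸ i)) (act σ i) (on-roots (rootᴸ i) i (refl {root i})))))
              (trans (φ³≈ε (rootᴸ i)) (reflexive (≡.cong root (≡.sym (S₃.act-id i)))))))

    trivial⇒ : IsTrivial Gal-L → ∀ {σ} → PreservesRelations root (act σ) → σ ≡ 0F
    trivial⇒ trivial {σ} σ-preserves = trivial⇒id {σ} σ-preserves (trivial (permutation-automorphism {σ} σ-preserves))

    cyclic-nontrivial : ∀ n → ¬ (ℤ.+ n ℤ∣.∣ 1ℤ) → Gal-L ≅ Cyclic n →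
                        ∃[ σ ] (PreservesRelations root (act σ) × ¬ (σ ≡ 0F))
    cyclic-nontrivial n n∤1 (f , isIso) =
      let φ , φ↦1 = F.surjective 1ℤ in
      permutation φ , permutation-preserves φ ,
      λ eq → n∤1 (Group.trans (Cyclic n) {1ℤ} {f φ} {0ℤ}
        (Group.sym (Cyclic n) {f φ} {1ℤ} (φ↦1 {φ} (λ _ → refl)))
        (Group.trans (Cyclic n) {f φ} {f Gal-L.ε} {0ℤ} (F.⟦⟧-cong (trivial-permutation φ eq)) F.ε-homo))
      where module F = IsGroupIsomorphism isIso

    cyclic-2⇒ : Gal-L ≅ Cyclic 2 → ∀ {σ} → PreservesRelations root (act σ) → σ S₃.∙ σ ≡ 0F
    cyclic-2⇒ (f , isIso) {σ} σ-preserves = order-2 {σ} σ-preserves (F.injective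
      (transᶜ {f (φ′ Gal-L.∙ φ′)} {k ℤ.+ k} {f Gal-L.ε} (F.∙-homo φ′ φ′)
        (transᶜ {k ℤ.+ k} {0ℤ} {f Gal-L.ε} (ℤ∣.divides k (double k))
          (Group.sym (Cyclic 2) {f Gal-L.ε} {0ℤ} F.ε-homo))))
      where
      module F = IsGroupIsomorphism isIso
      φ′ = permutation-automorphism {σ} σ-preserves
      k = f φ′
      transᶜ : ∀ {i j l} → Group._≈_ (Cyclic 2) i j → Group._≈_ (Cyclic 2) j l → Group._≈_ (Cyclic 2) i l
      transᶜ {i} {j} {l} = Group.trans (Cyclic 2) {i} {j} {l}
      double : ∀ k → (k ℤ.+ k) ℤ.- 0ℤ ≡ k ℤ.* ℤ.+ 2
      double = solve-∀

    cyclic-3⇒ : Gal-L ≅ Cyclic 3 → ∀ {σ} → PreservesRelations root (act σ) → σ S₃.∙ (σ S₃.∙ σ) ≡ 0F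
    cyclic-3⇒ (f , isIso) {σ} σ-preserves = order-3 {σ} σ-preserves (F.injective
      (transᶜ {f (φ′ Gal-L.∙ (φ′ Gal-L.∙ φ′))} {k ℤ.+ f (φ′ Gal-L.∙ φ′)} {f Gal-L.ε} (F.∙-homo φ′ (φ′ Gal-L.∙ φ′))
        (transᶜ {k ℤ.+ f (φ′ Gal-L.∙ φ′)} {k ℤ.+ (k ℤ.+ k)} {f Gal-L.ε}
          (Group.∙-cong (Cyclic 3) {k} {k} {f (φ′ Gal-L.∙ φ′)} {k ℤ.+ k} (Group.refl (Cyclic 3) {k}) (F.∙-homo φ′ φ′))
          (transᶜ {k ℤ.+ (k ℤ.+ k)} {0ℤ} {f Gal-L.ε} (ℤ∣.divides k (triple k))
            (Group.sym (Cyclic 3) {f Gal-L.ε} {0ℤ} F.ε-homo)))))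
      where
      module F = IsGroupIsomorphism isIso
      φ′ = permutation-automorphism {σ} σ-preserves
      k = f φ′
      transᶜ : ∀ {i j l} → Group._≈_ (Cyclic 3) i j → Group._≈_ (Cyclic 3) j l → Group._≈_ (Cyclic 3) i l
      transᶜ {i} {j} {l} = Group.trans (Cyclic 3) {i} {j} {l}
      triple : ∀ k → (k ℤ.+ (k ℤ.+ k)) ℤ.- 0ℤ ≡ k ℤ.* ℤ.+ 3
      triple = solve-∀

    symmetric⇒ : Gal-L ≅ 𝔖 3 → ∃[ σ ] ∃[ τ ] (PreservesRelations root (act σ) × PreservesRelations root (act τ) ×
                                               ¬ (σ S₃.∙ τ ≡ τ S₃.∙ σ))
    symmetric⇒ (f , isIso) =
      let φ , φ↦ = F.surjective (transpose 0F 1F)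
          ψ , ψ↦ = F.surjective (transpose 1F 2F)
      in permutation φ , permutation ψ , permutation-preserves φ , permutation-preserves ψ ,
         λ commute → noncommuting λ i → ≡.trans
           (≡.sym (Group.∙-cong (𝔖 3) {f φ} {transpose 0F 1F} {f ψ} {transpose 1F 2F} (φ↦ {φ} λ _ → refl) (ψ↦ {ψ} λ _ → refl) i))
           (≡.trans (≡.sym (F.∙-homo φ ψ i))
             (≡.trans (F.⟦⟧-cong (permutations-determine φ ψ ψ φ commute) i)
               (≡.trans (F.∙-homo ψ φ i)
                 (Group.∙-cong (𝔖 3) {f ψ} {transpose 1F 2F} {f φ} {transpose 0F 1F} (ψ↦ {ψ} λ _ → refl) (φ↦ {φ} λ _ → refl) i))))
      where
      module F = IsGroupIsomorphism isIso
      noncommuting : ¬ (∀ i → transpose {3} 0F 1F ⟨$⟩ʳ (transpose 1F 2F ⟨$⟩ʳ i) ≡ transpose 1F 2F ⟨$⟩ʳ (transpose 0F 1F ⟨$⟩ʳ i))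
      noncommuting eq with eq 0F
      ... | ()

  -- Matchings between the roots of the two cubics.

  open Tschirnhausen K
  open Formulas (rawRing closure) using (num; den; δ; _·_)
  module FM = Formulas (rawRing M)
  module ι-hom = FormulaHomomorphism (rawRing M) K ι isHomomorphism

  ev-H : ∀ a b z → ev (H M a b) z ≈ ι a * num (ι a) z ^ 3 - ι b * den (ι a) z ^ 2
  ev-H a b z = E.resolvent-hom (M.C a) (M.C b) M.X (ev-C a z) (ev-C b z) (ev-X z)
    where module E = FormulaHomomorphism M.polyRing K (λ f → ev f z) (ev-isRingHomomorphism z)

  make-roots : ∀ {p} (r₀ r₁ r₂ : Carrier) → ¬ (FM.δ p M.≈ M.0#) → e₁ r₀ r₁ r₂ ≈ 0# → e₂ r₀ r₁ r₂ ≈ ι p → e₃ r₀ r₁ r₂ ≈ - ι p →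
               ∃[ R ] ((CubicRoots.root {p} R 0F ≡ r₀) × (CubicRoots.root R 1F ≡ r₁) × (CubicRoots.root R 2F ≡ r₂))
  make-roots {p} r₀ r₁ r₂ δ≉0 s₁ s₂ s₃ = record
    { root = root ; e₁ = s₁ ; e₂ = s₂ ; e₃ = s₃ ; distinct = distinct } , ≡.refl , ≡.refl , ≡.refl
    where
    root : Fin 3 → Carrier
    root 0F = r₀
    root 1F = r₁
    root 2F = r₂

    ιδ≉0 : ¬ (δ (ι p) ≈ 0#)
    ιδ≉0 eq = ι-nonzero δ≉0 (trans (ι-hom.δ-hom refl) eq)

    01≉ : ¬ (r₀ ≈ r₁)
    01≉ eq = ιδ≉0 (double-root s₁ s₂ s₃ eq)

    12≉ : ¬ (r₁ ≈ r₂)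
    12≉ eq = ιδ≉0 (double-root
      (trans (Z.solve 3 (λ x y z → y :+ z :+ x := x :+ y :+ z) refl r₀ r₁ r₂) s₁)
      (trans (Z.solve 3 (λ x y z → y :* z :+ z :* x :+ x :* y := x :* y :+ y :* z :+ z :* x) refl r₀ r₁ r₂) s₂)
      (trans (Z.solve 3 (λ x y z → y :* z :* x := x :* y :* z) refl r₀ r₁ r₂) s₃) eq)

    20≉ : ¬ (r₂ ≈ r₀)
    20≉ eq = ιδ≉0 (double-root
      (trans (Z.solve 3 (λ x y z → z :+ x :+ y := x :+ y :+ z) refl r₀ r₁ r₂) s₁)
      (trans (Z.solve 3 (λ x y z → z :* x :+ x :* y :+ y :* z := x :* y :+ y :* z :+ z :* x) refl r₀ r₁ r₂) s₂)
      (trans (Z.solve 3 (λ x y z → z :* x :* y := x :* y :* z) refl r₀ r₁ r₂) s₃) eq)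

    distinct : ∀ i j → root i ≈ root j → i ≡ j
    distinct 0F 0F _  = ≡.refl
    distinct 0F 1F eq = contradiction eq 01≉
    distinct 0F 2F eq = contradiction (sym eq) 20≉
    distinct 1F 0F eq = contradiction (sym eq) 01≉
    distinct 1F 1F _  = ≡.refl
    distinct 1F 2F eq = contradiction eq 12≉
    distinct 2F 0F eq = contradiction eq 20≉
    distinct 2F 1F eq = contradiction (sym eq) 12≉
    distinct 2F 2F _  = ≡.refl

  cubic-roots : ∀ p → ¬ (FM.δ p M.≈ M.0#) → CubicRoots p
  cubic-roots p δ≉0 =
    let x , x-root = algebraicallyClosed (ι p ∷ ι p ∷ 0# ∷ 1# ∷ []) 2 (≉⇒# 1≉0 , λ { (suc (suc (suc (suc m)))) _ → refl
                       ; (suc zero) (s≤s ()) ; (suc (suc zero)) (s≤s (s≤s ())) ; (suc (suc (suc zero))) (s≤s (s≤s (s≤s ()))) })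
        -- The quadratic is the quotient of X³ + pX + p by X - x. The third root is -(x + y) because
        -- the roots have sum 0.
        y , y-root = algebraicallyClosed (x * x + ι p ∷ x ∷ 1# ∷ []) 1 (≉⇒# 1≉0 , λ { (suc (suc (suc m))) _ → refl
                       ; (suc zero) (s≤s ()) ; (suc (suc zero)) (s≤s (s≤s ())) })
    in proj₁ (make-roots x y (- (x + y)) δ≉0
         (Z.solve 2 (λ x y → x :+ y :+ :- (x :+ y) := Z.con 0ℤ) refl x y)
         (begin
           e₂ x y (- (x + y))
             ≈⟨ Z.solve 3 (λ x y p → x :* y :+ y :* :- (x :+ y) :+ :- (x :+ y) :* x
                  := p :- (x :* x :+ p :+ y :* (x :+ y :* (Z.con 1ℤ :+ y :* Z.con 0ℤ)))) refl x y (ι p) ⟩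
           ι p - eval (x * x + ι p ∷ x ∷ 1# ∷ []) y
             ≈⟨ +-congˡ (-‿cong y-root) ⟩
           ι p - 0#
             ≈⟨ Z.solve 1 (λ p → p :- Z.con 0ℤ := p) refl (ι p) ⟩
           ι p ∎)
         (begin
           e₃ x y (- (x + y))
             ≈⟨ Z.solve 3 (λ x y p → x :* y :* :- (x :+ y)
                  := :- p :+ (p :+ x :* (p :+ x :* (Z.con 0ℤ :+ x :* (Z.con 1ℤ :+ x :* Z.con 0ℤ))))
                     :- x :* (x :* x :+ p :+ y :* (x :+ y :* (Z.con 1ℤ :+ y :* Z.con 0ℤ)))) refl x y (ι p) ⟩
           - ι p + eval (ι p ∷ ι p ∷ 0# ∷ 1# ∷ []) x - x * eval (x * x + ι p ∷ x ∷ 1# ∷ []) y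
             ≈⟨ +-cong (+-congˡ x-root) (-‿cong (*-congˡ y-root)) ⟩
           - ι p + 0# - x * 0#
             ≈⟨ Z.solve 2 (λ p x → :- p :+ Z.con 0ℤ :- x :* Z.con 0ℤ := :- p) refl (ι p) x ⟩
           - ι p ∎))

  permute : ∀ {p} → CubicRoots p → S₃ → CubicRoots p
  permute {p} R π = record
    { root     = root ∘ act π
    ; e₁       = trans (sums π) R.e₁
    ; e₂       = trans (pairs π) R.e₂
    ; e₃       = trans (products π) R.e₃
    ; distinct = λ i j eq → ≡.trans (≡.sym (S₃.inv-act π i)) (≡.trans (≡.cong (act (S₃.inv π)) (R.distinct _ _ eq)) (S₃.inv-act π j))
    }
    where
    module R = CubicRoots R
    root = R.root

    sums : ∀ π → e₁ (root (act π 0F)) (root (act π 1F)) (root (act π 2F)) ≈ e₁ (root 0F) (root 1F) (root 2F)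
    sums 0F = refl
    sums 1F = Z.solve 3 (λ x y z → y :+ z :+ x := x :+ y :+ z) refl _ _ _
    sums 2F = Z.solve 3 (λ x y z → z :+ x :+ y := x :+ y :+ z) refl _ _ _
    sums 3F = Z.solve 3 (λ x y z → x :+ z :+ y := x :+ y :+ z) refl _ _ _
    sums 4F = Z.solve 3 (λ x y z → y :+ x :+ z := x :+ y :+ z) refl _ _ _
    sums 5F = Z.solve 3 (λ x y z → z :+ y :+ x := x :+ y :+ z) refl _ _ _

    pairs : ∀ π → e₂ (root (act π 0F)) (root (act π 1F)) (root (act π 2F)) ≈ e₂ (root 0F) (root 1F) (root 2F)
    pairs 0F = refl
    pairs 1F = Z.solve 3 (λ x y z → y :* z :+ z :* x :+ x :* y := x :* y :+ y :* z :+ z :* x) refl _ _ _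
    pairs 2F = Z.solve 3 (λ x y z → z :* x :+ x :* y :+ y :* z := x :* y :+ y :* z :+ z :* x) refl _ _ _
    pairs 3F = Z.solve 3 (λ x y z → x :* z :+ z :* y :+ y :* x := x :* y :+ y :* z :+ z :* x) refl _ _ _
    pairs 4F = Z.solve 3 (λ x y z → y :* x :+ x :* z :+ z :* y := x :* y :+ y :* z :+ z :* x) refl _ _ _
    pairs 5F = Z.solve 3 (λ x y z → z :* y :+ y :* x :+ x :* z := x :* y :+ y :* z :+ z :* x) refl _ _ _

    products : ∀ π → e₃ (root (act π 0F)) (root (act π 1F)) (root (act π 2F)) ≈ e₃ (root 0F) (root 1F) (root 2F)
    products 0F = refl
    products 1F = Z.solve 3 (λ x y z → y :* z :* x := x :* y :* z) refl _ _ _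
    products 2F = Z.solve 3 (λ x y z → z :* x :* y := x :* y :* z) refl _ _ _
    products 3F = Z.solve 3 (λ x y z → x :* z :* y := x :* y :* z) refl _ _ _
    products 4F = Z.solve 3 (λ x y z → y :* x :* z := x :* y :* z) refl _ _ _
    products 5F = Z.solve 3 (λ x y z → z :* y :* x := x :* y :* z) refl _ _ _

  module _ (3≉0 : ¬ (3 · 1# ≈ 0#)) where
    3-cancel : ∀ {x} → 3 · x ≈ 0# → x ≈ 0#
    3-cancel {x} eq = *-cancel (trans (Z.solve 1 (λ x → 3 :× Z.con 1ℤ :* x := 3 :× x) refl x) eq) 3≉0

    9-nonzero : ∀ {x} → ¬ (x ≈ 0#) → ¬ (9 · x ≈ 0#)
    9-nonzero {x} x≉0 eq = x≉0 (3-cancel (3-cancel (trans (Z.solve 1 (λ x → 3 :× (3 :× x) := 9 :× x) refl x) eq)))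

    27-nonzero : ∀ {x} → ¬ (x ≈ 0#) → ¬ (27 · x ≈ 0#)
    27-nonzero {x} x≉0 eq = 9-nonzero x≉0 (3-cancel (trans (Z.solve 1 (λ x → 3 :× (9 :× x) := 27 :× x) refl x) eq))

    -- y is matched with x when y = (C / 3) θ(x) for every corresponding pair of roots.
    Match : ∀ {a b} → CubicRoots a → CubicRoots b → Carrier → Carrier → Set ℓ₁
    Match {a} X Y u C = ∀ i → 3 · CubicRoots.root Y i ≈ C * θ (ι a) u (CubicRoots.root X i)

    module _ {a b} (a≉0 : ¬ (ι a ≈ 0#)) (b≉0 : ¬ (ι b ≈ 0#)) (X : CubicRoots a) where
      private module X = CubicRoots X

      module _ (Y : CubicRoots b) {u C} (match : Match X Y u C) where
        private
          module Y = CubicRoots Y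
          A = ι a
          B = ι b
          P = num A u
          Q = den A u

        match-e₂ : 9 · B ≈ C * C * (A * P)
        match-e₂ = begin
          9 · B
            ≈⟨ ·-cong 9 (sym Y.e₂) ⟩
          9 · e₂ (Y.root 0F) (Y.root 1F) (Y.root 2F)
            ≈⟨ Z.solve 3 (λ x y z → 9 :× (x :* y :+ y :* z :+ z :* x) := 3 :× x :* (3 :× y) :+ 3 :× y :* (3 :× z) :+ 3 :× z :* (3 :× x)) refl _ _ _ ⟩
          e₂ (3 · Y.root 0F) (3 · Y.root 1F) (3 · Y.root 2F)
            ≈⟨ e₂-cong (match 0F) (match 1F) (match 2F) ⟩
          e₂ (C * θ A u (X.root 0F)) (C * θ A u (X.root 1F)) (C * θ A u (X.root 2F))
            ≈⟨ Z.solve 4 (λ c x y z → c :* x :* (c :* y) :+ c :* y :* (c :* z) :+ c :* z :* (c :* x) := c :* c :* (x :* y :+ y :* z :+ z :* x)) refl C _ _ _ ⟩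
          C * C * e₂ (θ A u (X.root 0F)) (θ A u (X.root 1F)) (θ A u (X.root 2F))
            ≈⟨ *-congˡ (θ-e₂ X.e₁ X.e₂ X.e₃ u) ⟩
          C * C * (A * P) ∎

        match-e₃ : 27 · B ≈ C * (C * C) * (A * Q)
        match-e₃ = begin
          27 · B
            ≈⟨ Z.solve 1 (λ b → 27 :× b := :- (27 :× (:- b))) refl B ⟩
          - (27 · - B)
            ≈⟨ -‿cong (·-cong 27 (sym Y.e₃)) ⟩
          - (27 · e₃ (Y.root 0F) (Y.root 1F) (Y.root 2F))
            ≈⟨ -‿cong (Z.solve 3 (λ x y z → 27 :× (x :* y :* z) := 3 :× x :* (3 :× y) :* (3 :× z)) refl _ _ _) ⟩
          - e₃ (3 · Y.root 0F) (3 · Y.root 1F) (3 · Y.root 2F)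
            ≈⟨ -‿cong (e₃-cong (match 0F) (match 1F) (match 2F)) ⟩
          - e₃ (C * θ A u (X.root 0F)) (C * θ A u (X.root 1F)) (C * θ A u (X.root 2F))
            ≈⟨ Z.solve 4 (λ c x y z → :- (c :* x :* (c :* y) :* (c :* z)) := c :* (c :* c) :* :- (x :* y :* z)) refl C _ _ _ ⟩
          C * (C * C) * - e₃ (θ A u (X.root 0F)) (θ A u (X.root 1F)) (θ A u (X.root 2F))
            ≈⟨ *-congˡ (trans (-‿cong (θ-e₃ X.e₁ X.e₂ X.e₃ u)) (Z.solve 1 (λ q → :- (:- q) := q) refl _)) ⟩
          C * (C * C) * (A * Q) ∎

        match-den : ¬ (Q ≈ 0#)
        match-den Q≈0 = 27-nonzero b≉0 (trans match-e₃ (trans (*-congˡ (trans (*-congˡ Q≈0) (zeroʳ A))) (zeroʳ _)))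

        match-scale : ¬ (C ≈ 0#)
        match-scale C≈0 = 9-nonzero b≉0 (trans match-e₂ (trans (*-congʳ (trans (*-congʳ C≈0) (zeroˡ C))) (zeroˡ _)))

        -- Eliminates the scale: as 27² = 9³, the square of `match-e₃` times b is the cube of
        -- `match-e₂`, and C⁶a² cancels.
        match-equation : B * Q ^ 2 ≈ A * P ^ 3
        match-equation = *-cancelˡ (*-nonzero (*-nonzero C²≉0 (*-nonzero C²≉0 C²≉0)) (*-nonzero a≉0 a≉0)) (begin
          C * C * (C * C * (C * C)) * (A * A) * (B * Q ^ 2)
            ≈⟨ Z.solve 4 (λ c a b q → c :* c :* (c :* c :* (c :* c)) :* (a :* a) :* (b :* q :^ 2)
                  := b :* ((c :* (c :* c) :* (a :* q)) :* (c :* (c :* c) :* (a :* q)))) refl C A B Q ⟩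
          B * ((C * (C * C) * (A * Q)) * (C * (C * C) * (A * Q)))
            ≈⟨ *-congˡ (sym (*-cong match-e₃ match-e₃)) ⟩
          B * (27 · B * 27 · B)
            ≈⟨ Z.solve 1 (λ b → b :* (27 :× b :* 27 :× b) := 9 :× b :* (9 :× b :* 9 :× b)) refl B ⟩
          9 · B * (9 · B * 9 · B)
            ≈⟨ *-cong match-e₂ (*-cong match-e₂ match-e₂) ⟩
          C * C * (A * P) * (C * C * (A * P) * (C * C * (A * P)))
            ≈⟨ Z.solve 3 (λ c a p → c :* c :* (a :* p) :* (c :* c :* (a :* p) :* (c :* c :* (a :* p)))
                  := c :* c :* (c :* c :* (c :* c)) :* (a :* a) :* (a :* p :^ 3)) refl C A P ⟩
          C * C * (C * C * (C * C)) * (A * A) * (A * P ^ 3) ∎)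
          where
          C²≉0 : ¬ (C * C ≈ 0#)
          C²≉0 = *-nonzero match-scale match-scale

        -- Dividing `match-e₃` by `match-e₂`, with 27b = 3 · 9b. So `u` determines the scale and
        -- with it the whole matching.
        match-determines-scale : C * Q ≈ 3 · P
        match-determines-scale = *-cancelˡ (*-nonzero (*-nonzero match-scale match-scale) a≉0) (begin
          C * C * A * (C * Q)      ≈⟨ Z.solve 3 (λ c a q → c :* c :* a :* (c :* q) := c :* (c :* c) :* (a :* q)) refl C A Q ⟩
          C * (C * C) * (A * Q)    ≈⟨ sym match-e₃ ⟩
          27 · B                   ≈⟨ Z.solve 1 (λ b → 27 :× b := 3 :× (9 :× b)) refl B ⟩
          3 · (9 · B)              ≈⟨ ·-cong 3 match-e₂ ⟩
          3 · (C * C * (A * P))    ≈⟨ Z.solve 3 (λ c a p → 3 :× (c :* c :* (a :* p)) := c :* c :* a :* (3 :× p)) refl C A P ⟩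
          C * C * A * (3 · P)      ∎)

      match-roots-unique : ∀ (Y Y′ : CubicRoots b) {u C C′} → Match X Y u C → Match X Y′ u C′ →
                           ∀ i → CubicRoots.root Y i ≈ CubicRoots.root Y′ i
      match-roots-unique Y Y′ {u} {C} {C′} match match′ i = x-y≈0⇒x≈y _ _ (3-cancel (begin
        3 · (CubicRoots.root Y i - CubicRoots.root Y′ i)
          ≈⟨ Z.solve 2 (λ y y′ → 3 :× (y :- y′) := 3 :× y :- 3 :× y′) refl _ _ ⟩
        3 · CubicRoots.root Y i - 3 · CubicRoots.root Y′ i
          ≈⟨ +-cong (match i) (-‿cong (match′ i)) ⟩
        C * θ (ι a) u (X.root i) - C′ * θ (ι a) u (X.root i)
          ≈⟨ +-congʳ (*-congʳ C≈C′) ⟩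
        C′ * θ (ι a) u (X.root i) - C′ * θ (ι a) u (X.root i)
          ≈⟨ -‿inverseʳ _ ⟩
        0# ∎))
        where
        C≈C′ : C ≈ C′
        C≈C′ = *-cancelˡ (match-den Y match) (trans (*-comm _ C)
          (trans (match-determines-scale Y match) (trans (sym (match-determines-scale Y′ match′)) (*-comm C′ _))))

      -- The difference of the two expressions for 3y has degree at most 2 in x and vanishes at
      -- three distinct points, so its coefficients, listed in `difference`, are zero.
      match-unique : ∀ (Y : CubicRoots b) {u u′ C C′} → Match X Y u C → Match X Y u′ C′ → u ≈ u′ × C ≈ C′
      match-unique Y {u} {u′} {C} {C′} match match′ = u≈u′ , C≈C′
        where
        difference : List Carrier
        difference = 2 · (C * ι a) - 2 · (C′ * ι a) ∷ C * u - C′ * u′ ∷ 3 · (C - C′) ∷ []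

        vanishes : ∀ i → eval difference (X.root i) ≈ 0#
        vanishes i = begin
          eval difference (X.root i)
            ≈⟨ Z.solve 6 (λ c c′ u u′ a x →
                 2 :× (c :* a) :- 2 :× (c′ :* a) :+ x :* (c :* u :- c′ :* u′ :+ x :* (3 :× (c :- c′) :+ x :* Z.con 0ℤ))
                 := c :* (3 :× (x :* x) :+ u :* x :+ 2 :× a) :- c′ :* (3 :× (x :* x) :+ u′ :* x :+ 2 :× a)) refl C C′ u u′ (ι a) (X.root i) ⟩
          C * θ (ι a) u (X.root i) - C′ * θ (ι a) u′ (X.root i)
            ≈⟨ +-cong (sym (match i)) (-‿cong (sym (match′ i))) ⟩
          3 · CubicRoots.root Y i - 3 · CubicRoots.root Y i
            ≈⟨ -‿inverseʳ _ ⟩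
          0# ∎

        zeroes : difference ≋ []
        zeroes = zero-of-roots difference (X.root 0F ∷ X.root 1F ∷ X.root 2F ∷ [])
          ((X.apart (λ ()) ∷ X.apart (λ ()) ∷ []) ∷ (X.apart (λ ()) ∷ []) ∷ [] ∷ [])
          (λ { (suc (suc (suc m))) _ → refl ; (suc zero) (s≤s ()) ; (suc (suc zero)) (s≤s (s≤s ())) })
          (vanishes 0F ∷ vanishes 1F ∷ vanishes 2F ∷ [])

        C≈C′ : C ≈ C′
        C≈C′ = x-y≈0⇒x≈y _ _ (3-cancel (zeroes 2))

        u≈u′ : u ≈ u′
        u≈u′ = *-cancelˡ (match-scale Y match) (trans (x-y≈0⇒x≈y _ _ (zeroes 1)) (*-congʳ (sym C≈C′)))

      -- Interpolation gives u = 3μ/κ and C = κ/V. That both stay in `D` is what later makes them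
      -- expressions in the roots, on which the Galois group acts.
      match-exists : ∀ (Y : CubicRoots b) → ¬ (ι a ≈ ι b) →
        ∀ {D : Carrier → Set (c ⊔ ℓ₁)} → IsSubring K D → (∀ m → D (ι m)) → (∀ i → D (X.root i)) → (∀ i → D (CubicRoots.root Y i)) →
        ∃[ u ] ∃[ C ] (D u × D C × Match X Y u C)
      match-exists Y a≉b {D} D-subring constants x∈D y∈D =
        3 · (μ′ * k) , κ′ * v , *3∈D (*-closed μ∈D k∈D) , *-closed κ∈D v∈D , matched
        where
        open IsSubring D-subring
        module Y = CubicRoots Y
        x₀ = X.root 0F ; x₁ = X.root 1F ; x₂ = X.root 2F
        y₀ = Y.root 0F ; y₁ = Y.root 1F ; y₂ = Y.root 2F
        V′ = V x₀ x₁ x₂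
        κ′ = κ x₀ x₁ x₂ y₀ y₁ y₂
        μ′ = μ x₀ x₁ x₂ y₀ y₁ y₂

        -∈D : ∀ {s t} → D s → D t → D (s - t)
        -∈D s t = +-closed s (neg-closed t)

        *3∈D : ∀ {s} → D s → D (3 · s)
        *3∈D s = +-closed s (+-closed s (+-closed s 0-closed))

        x₀∈ = x∈D 0F ; x₁∈ = x∈D 1F ; x₂∈ = x∈D 2F
        y₀∈ = y∈D 0F ; y₁∈ = y∈D 1F ; y₂∈ = y∈D 2F

        V∈D : D V′
        V∈D = *-closed (-∈D x₀∈ x₁∈) (*-closed (-∈D x₁∈ x₂∈) (-∈D x₀∈ x₂∈))

        κ∈D : D κ′
        κ∈D = +-closed (+-closed (*-closed y₀∈ (-∈D x₁∈ x₂∈)) (*-closed y₁∈ (-∈D x₂∈ x₀∈))) (*-closed y₂∈ (-∈D x₀∈ x₁∈))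

        μ∈D : D μ′
        μ∈D = +-closed (+-closed (*-closed (*-closed x₀∈ y₀∈) (-∈D x₁∈ x₂∈)) (*-closed (*-closed x₁∈ y₁∈) (-∈D x₂∈ x₀∈)))
                       (*-closed (*-closed x₂∈ y₂∈) (-∈D x₀∈ x₁∈))

        difference≉0 : ∀ {i j} → ¬ (i ≡ j) → ¬ (X.root i - X.root j ≈ 0#)
        difference≉0 i≢j eq = X.apart i≢j (x-y≈0⇒x≈y _ _ eq)

        V≉0 : ¬ (V′ ≈ 0#)
        V≉0 = *-nonzero (difference≉0 λ ()) (*-nonzero (difference≉0 λ ()) (difference≉0 λ ()))

        interpolated : ∀ i → V′ * (3 · Y.root i) ≈ κ′ * (3 · (X.root i * X.root i) + 2 · ι a) + 3 · (μ′ * X.root i)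
        interpolated 0F = interpolate x₀ x₁ x₂ y₀ y₁ y₂ X.e₁ X.e₂ Y.e₁
        -- The other two points follow by cyclic rotation, under which V, κ and μ are invariant.
        interpolated 1F = trans (*-congʳ (Z.solve 3 (λ x y z → (x :- y) :* ((y :- z) :* (x :- z)) := (y :- z) :* ((z :- x) :* (y :- x))) refl x₀ x₁ x₂))
          (trans (interpolate x₁ x₂ x₀ y₁ y₂ y₀
            (CubicRoots.e₁ (permute X 1F)) (CubicRoots.e₂ (permute X 1F)) (CubicRoots.e₁ (permute Y 1F)))
            (+-cong (*-congʳ (rotate _ _ _)) (·-cong 3 (*-congʳ (rotate _ _ _)))))
          where
          rotate : ∀ x y z → y + z + x ≈ x + y + z
          rotate = Z.solve 3 (λ x y z → y :+ z :+ x := x :+ y :+ z) refl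
        interpolated 2F = trans (*-congʳ (Z.solve 3 (λ x y z → (x :- y) :* ((y :- z) :* (x :- z)) := (z :- x) :* ((x :- y) :* (z :- y))) refl x₀ x₁ x₂))
          (trans (interpolate x₂ x₀ x₁ y₂ y₀ y₁
            (CubicRoots.e₁ (permute X 2F)) (CubicRoots.e₂ (permute X 2F)) (CubicRoots.e₁ (permute Y 2F)))
            (+-cong (*-congʳ (rotate _ _ _)) (·-cong 3 (*-congʳ (rotate _ _ _)))))
          where
          rotate : ∀ x y z → z + x + y ≈ x + y + z
          rotate = Z.solve 3 (λ x y z → z :+ x :+ y := x :+ y :+ z) refl

        -- If κ = 0 then y = (μ / V) x, which forces a = b.
        κ≉0 : ¬ (κ′ ≈ 0#)
        κ≉0 κ≈0 = a≉b (*-cancelˡ (*-nonzero V≉0 V≉0) (begin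
          V′ * V′ * ι a   ≈⟨ *-congʳ (*-cong V≈μ V≈μ) ⟩
          μ′ * μ′ * ι a   ≈⟨ sym pairs ⟩
          V′ * V′ * ι b   ∎))
          where
          proportional : ∀ i → V′ * Y.root i ≈ μ′ * X.root i
          proportional i = x-y≈0⇒x≈y _ _ (3-cancel (begin
            3 · (V′ * Y.root i - μ′ * X.root i)
              ≈⟨ Z.solve 4 (λ v y m x → 3 :× (v :* y :- m :* x) := v :* (3 :× y) :- 3 :× (m :* x)) refl V′ (Y.root i) μ′ (X.root i) ⟩
            V′ * (3 · Y.root i) - 3 · (μ′ * X.root i)
              ≈⟨ +-congʳ (trans (interpolated i) (+-congʳ (trans (*-congʳ κ≈0) (zeroˡ _)))) ⟩
            0# + 3 · (μ′ * X.root i) - 3 · (μ′ * X.root i)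
              ≈⟨ trans (+-congʳ (+-identityˡ _)) (-‿inverseʳ _) ⟩
            0# ∎))

          pairs : V′ * V′ * ι b ≈ μ′ * μ′ * ι a
          pairs = begin
            V′ * V′ * ι b
              ≈⟨ *-congˡ (sym Y.e₂) ⟩
            V′ * V′ * e₂ y₀ y₁ y₂
              ≈⟨ Z.solve 4 (λ c x y z → c :* c :* (x :* y :+ y :* z :+ z :* x) := c :* x :* (c :* y) :+ c :* y :* (c :* z) :+ c :* z :* (c :* x)) refl V′ y₀ y₁ y₂ ⟩
            e₂ (V′ * y₀) (V′ * y₁) (V′ * y₂)
              ≈⟨ e₂-cong (proportional 0F) (proportional 1F) (proportional 2F) ⟩
            e₂ (μ′ * x₀) (μ′ * x₁) (μ′ * x₂)
              ≈⟨ Z.solve 4 (λ c x y z → c :* x :* (c :* y) :+ c :* y :* (c :* z) :+ c :* z :* (c :* x) := c :* c :* (x :* y :+ y :* z :+ z :* x)) refl μ′ x₀ x₁ x₂ ⟩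
            μ′ * μ′ * e₂ x₀ x₁ x₂
              ≈⟨ *-congˡ X.e₂ ⟩
            μ′ * μ′ * ι a ∎

          triple : V′ * (V′ * V′) * ι b ≈ μ′ * (μ′ * μ′) * ι a
          triple = begin
            V′ * (V′ * V′) * ι b
              ≈⟨ Z.solve 2 (λ c b → c :* (c :* c) :* b := :- (c :* (c :* c) :* :- b)) refl V′ (ι b) ⟩
            - (V′ * (V′ * V′) * - ι b)
              ≈⟨ -‿cong (*-congˡ (sym Y.e₃)) ⟩
            - (V′ * (V′ * V′) * e₃ y₀ y₁ y₂)
              ≈⟨ -‿cong (Z.solve 4 (λ c x y z → c :* (c :* c) :* (x :* y :* z) := c :* x :* (c :* y) :* (c :* z)) refl V′ y₀ y₁ y₂) ⟩
            - e₃ (V′ * y₀) (V′ * y₁) (V′ * y₂)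
              ≈⟨ -‿cong (e₃-cong (proportional 0F) (proportional 1F) (proportional 2F)) ⟩
            - e₃ (μ′ * x₀) (μ′ * x₁) (μ′ * x₂)
              ≈⟨ -‿cong (Z.solve 4 (λ c x y z → c :* x :* (c :* y) :* (c :* z) := c :* (c :* c) :* (x :* y :* z)) refl μ′ x₀ x₁ x₂) ⟩
            - (μ′ * (μ′ * μ′) * e₃ x₀ x₁ x₂)
              ≈⟨ -‿cong (*-congˡ X.e₃) ⟩
            - (μ′ * (μ′ * μ′) * - ι a)
              ≈⟨ Z.solve 2 (λ c b → :- (c :* (c :* c) :* :- b) := c :* (c :* c) :* b) refl μ′ (ι a) ⟩
            μ′ * (μ′ * μ′) * ι a ∎

          V≈μ : V′ ≈ μ′
          V≈μ = *-cancelˡ (*-nonzero (*-nonzero V≉0 V≉0) b≉0) (begin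
            V′ * V′ * ι b * V′    ≈⟨ Z.solve 2 (λ v b → v :* v :* b :* v := v :* (v :* v) :* b) refl V′ (ι b) ⟩
            V′ * (V′ * V′) * ι b  ≈⟨ triple ⟩
            μ′ * (μ′ * μ′) * ι a  ≈⟨ Z.solve 2 (λ m a → m :* (m :* m) :* a := m :* m :* a :* m) refl μ′ (ι a) ⟩
            μ′ * μ′ * ι a * μ′    ≈⟨ *-congʳ (sym pairs) ⟩
            V′ * V′ * ι b * μ′    ∎)

        κ-inverse = inverse-closed D-subring constants κ∈D κ≉0
        V-inverse = inverse-closed D-subring constants V∈D V≉0
        k = proj₁ κ-inverse ; k∈D = proj₁ (proj₂ κ-inverse) ; κk≈1 = proj₂ (proj₂ κ-inverse)
        v = proj₁ V-inverse ; v∈D = proj₁ (proj₂ V-inverse) ; Vv≈1 = proj₂ (proj₂ V-inverse)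

        matched : Match X Y (3 · (μ′ * k)) (κ′ * v)
        matched i = begin
          3 · Y.root i
            ≈⟨ sym (*-identityˡ _) ⟩
          1# * (3 · Y.root i)
            ≈⟨ *-congʳ (sym Vv≈1) ⟩
          V′ * v * (3 · Y.root i)
            ≈⟨ Z.solve 3 (λ V v y → V :* v :* (3 :× y) := v :* (V :* (3 :× y))) refl V′ v (Y.root i) ⟩
          v * (V′ * (3 · Y.root i))
            ≈⟨ *-congˡ (interpolated i) ⟩
          v * (κ′ * (3 · (X.root i * X.root i) + 2 · ι a) + 3 · (μ′ * X.root i))
            ≈⟨ *-congˡ (+-congˡ (·-cong 3 (trans (sym (*-identityˡ _)) (*-congʳ (sym κk≈1))))) ⟩
          v * (κ′ * (3 · (X.root i * X.root i) + 2 · ι a) + 3 · (κ′ * k * (μ′ * X.root i)))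
            ≈⟨ Z.solve 6 (λ v κ k μ x a → v :* (κ :* (3 :× (x :* x) :+ 2 :× a) :+ 3 :× (κ :* k :* (μ :* x)))
                  := κ :* v :* (3 :× (x :* x) :+ 3 :× (μ :* k) :* x :+ 2 :× a)) refl v κ′ k μ′ (X.root i) (ι a) ⟩
          κ′ * v * θ (ι a) (3 · (μ′ * k)) (X.root i) ∎

      -- Scaling by P/Q makes the linear and the constant coefficient of T³ + aPT + aQ equal, and
      -- the equation says that their common value is b.
      match-from-equation : ¬ (FM.δ b M.≈ M.0#) → ∀ u → ¬ (den (ι a) u ≈ 0#) → ι b * den (ι a) u ^ 2 ≈ ι a * num (ι a) u ^ 3 →
                            ∃[ Y ] ∃[ C ] Match X Y u C
      match-from-equation δb≉0 u Q≉0 equation =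
        let d , Qd≈1 = inverseOf Q≉0 in from-inverse d Qd≈1
        where
        A = ι a ; B = ι b ; P = num A u ; Q = den A u
        t₀ = θ A u (X.root 0F) ; t₁ = θ A u (X.root 1F) ; t₂ = θ A u (X.root 2F)

        from-inverse : ∀ d → Q * d ≈ 1# → ∃[ Y ] ∃[ C ] Match X Y u C
        from-inverse d Qd≈1 =
          let Y , eq₀ , eq₁ , eq₂ = make-roots {b} (l * t₀) (l * t₁) (l * t₂) δb≉0 s₁ s₂ s₃
          in Y , 3 · l , λ { 0F → scale eq₀ ; 1F → scale eq₁ ; 2F → scale eq₂ }
          where
          l = P * d

          scale : ∀ {y t} → y ≡ l * t → 3 · y ≈ 3 · l * t
          scale {t = t} ≡.refl = Z.solve 2 (λ l t → 3 :× (l :* t) := 3 :× l :* t) refl l t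

          lP≈ : l * l * (A * P) ≈ B
          lP≈ = begin
            P * d * (P * d) * (A * P)  ≈⟨ Z.solve 3 (λ p d a → p :* d :* (p :* d) :* (a :* p) := a :* p :^ 3 :* (d :* d)) refl P d A ⟩
            A * P ^ 3 * (d * d)        ≈⟨ *-congʳ (sym equation) ⟩
            B * Q ^ 2 * (d * d)        ≈⟨ Z.solve 3 (λ b q d → b :* q :^ 2 :* (d :* d) := b :* (q :* d :* (q :* d))) refl B Q d ⟩
            B * (Q * d * (Q * d))      ≈⟨ *-congˡ (*-cong Qd≈1 Qd≈1) ⟩
            B * (1# * 1#)              ≈⟨ Z.solve 1 (λ b → b :* (Z.con 1ℤ :* Z.con 1ℤ) := b) refl B ⟩
            B                          ∎

          lQ≈ : l * (l * l) * (A * Q) ≈ B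
          lQ≈ = begin
            P * d * (l * l) * (A * Q)    ≈⟨ Z.solve 5 (λ p d l a q → p :* d :* (l :* l) :* (a :* q) := l :* l :* (a :* p) :* (q :* d)) refl P d l A Q ⟩
            l * l * (A * P) * (Q * d)    ≈⟨ *-cong lP≈ Qd≈1 ⟩
            B * 1#                       ≈⟨ *-identityʳ B ⟩
            B                            ∎

          s₁ : e₁ (l * t₀) (l * t₁) (l * t₂) ≈ 0#
          s₁ = trans (Z.solve 4 (λ l x y z → l :* x :+ l :* y :+ l :* z := l :* (x :+ y :+ z)) refl l t₀ t₁ t₂)
                 (trans (*-congˡ (θ-e₁ X.e₁ X.e₂ X.e₃ u)) (zeroʳ l))

          s₂ : e₂ (l * t₀) (l * t₁) (l * t₂) ≈ B
          s₂ = trans (Z.solve 4 (λ c x y z → c :* x :* (c :* y) :+ c :* y :* (c :* z) :+ c :* z :* (c :* x) := c :* c :* (x :* y :+ y :* z :+ z :* x)) refl l t₀ t₁ t₂)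
                 (trans (*-congˡ (θ-e₂ X.e₁ X.e₂ X.e₃ u)) lP≈)

          s₃ : e₃ (l * t₀) (l * t₁) (l * t₂) ≈ - B
          s₃ = trans (Z.solve 4 (λ c x y z → c :* x :* (c :* y) :* (c :* z) := c :* (c :* c) :* (x :* y :* z)) refl l t₀ t₁ t₂)
                 (trans (*-congˡ (θ-e₃ X.e₁ X.e₂ X.e₃ u))
                   (trans (Z.solve 2 (λ c q → c :* :- q := :- (c :* q)) refl (l * (l * l)) (A * Q)) (-‿cong lQ≈)))

  -- Irreducibility over M in terms of roots in Ω.

  module PolynomialsOverM where
    open SemiringDefinitions (RawRing.rawSemiring M.polyRing) using () renaming (_^_ to _^ₚ_; _×_ to _·ₚ_)
    open M using (Poly; C; X; _+ₚ_; _*ₚ_)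

    private
      negₚ : Poly → Poly
      negₚ = map (M.-_)

      below-C : ∀ x n → M.DegreeBelow (C x) (suc n)
      below-C x n (suc m) _ = M.refl

      below : ∀ f {m n x} → m ℕ.< n → M.Leading f m x → M.DegreeBelow f n
      below f m<n (_ , above) k n≤k = above k (ℕₚ.<-≤-trans m<n n≤k)

    Leading-num : ∀ a → M.Leading (Formulas.num M.polyRing (C a) X) 2 M.1#
    Leading-num a = M.Leading-+-lower (X ^ₚ 2 +ₚ 9 ·ₚ X) (negₚ (3 ·ₚ C a))
      (M.Leading-+-lower (X ^ₚ 2) (9 ·ₚ X) (M.Leading-monic-^ X 2 M.Leading-X)
        (M.DegreeBelow-· 9 X (below X (s≤s (s≤s z≤n)) M.Leading-X)))
      (M.DegreeBelow-neg (3 ·ₚ C a) (M.DegreeBelow-· 3 (C a) (below-C a 1)))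

    Leading-den : ∀ a → M.Leading (Formulas.den M.polyRing (C a) X) 3 M.1#
    Leading-den a =
      assemble (2 ·ₚ (C a *ₚ X ^ₚ 2)) (M.DegreeBelow-· 2 (C a *ₚ X ^ₚ 2) (aX^ 2 (s≤s (s≤s (s≤s z≤n))))) (27 ·ₚ C a)
        (M.DegreeBelow-· 27 (C a) (below-C a 2))
      where
      aX^ : ∀ k → k ℕ.* 1 ℕ.< 3 → M.DegreeBelow (C a *ₚ X ^ₚ k) 3
      aX^ k k<3 = below (C a *ₚ X ^ₚ k) k<3 (M.Leading-* (C a) (X ^ₚ k) (M.Leading-C a) (M.Leading-monic-^ X k M.Leading-X))

      assemble : ∀ f → M.DegreeBelow f 3 → ∀ g → M.DegreeBelow g 3 →
              M.Leading (X ^ₚ 3 +ₚ negₚ f +ₚ negₚ (9 ·ₚ (C a *ₚ X)) +ₚ negₚ (2 ·ₚ (C a ^ₚ 2)) +ₚ negₚ g) 3 M.1#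
      assemble f f< g g< =
        M.Leading-+-lower (X ^ₚ 3 +ₚ negₚ f +ₚ negₚ (9 ·ₚ (C a *ₚ X)) +ₚ negₚ (2 ·ₚ (C a ^ₚ 2))) (negₚ g)
          (M.Leading-+-lower (X ^ₚ 3 +ₚ negₚ f +ₚ negₚ (9 ·ₚ (C a *ₚ X))) (negₚ (2 ·ₚ (C a ^ₚ 2)))
            (M.Leading-+-lower (X ^ₚ 3 +ₚ negₚ f) (negₚ (9 ·ₚ (C a *ₚ X)))
              (M.Leading-+-lower (X ^ₚ 3) (negₚ f) (M.Leading-monic-^ X 3 M.Leading-X) (M.DegreeBelow-neg f f<))
              (M.DegreeBelow-neg (9 ·ₚ (C a *ₚ X)) (M.DegreeBelow-· 9 (C a *ₚ X)
                (below (C a *ₚ X) (s≤s (s≤s z≤n)) (M.Leading-* (C a) X (M.Leading-C a) M.Leading-X)))))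
            (M.DegreeBelow-neg (2 ·ₚ (C a ^ₚ 2)) (M.DegreeBelow-· 2 (C a ^ₚ 2) (below (C a ^ₚ 2) (s≤s z≤n) Leading-C²))))
          (M.DegreeBelow-neg g g<)
        where
        Leading-C² : M.Leading (C a ^ₚ 2) 0 (a M.* (a M.* M.1#))
        Leading-C² = M.Leading-* (C a) (C a ^ₚ 1) (M.Leading-C a) (M.Leading-* (C a) (C M.1#) (M.Leading-C a) (M.Leading-C M.1#))

    Leading-H : ∀ a b → M.Leading (H M a b) 6 (a M.- b)
    Leading-H a b = M.Leading-resp (H M a b) (H M a b) (λ _ → M.refl)
      (M.+-cong (M.*-identityʳ a) (M.-‿cong (M.*-identityʳ b)))
      (M.Leading-+ (C a *ₚ num′ ^ₚ 3) (negₚ (C b *ₚ den′ ^ₚ 2))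
        (M.Leading-* (C a) (num′ ^ₚ 3) (M.Leading-C a) (M.Leading-monic-^ num′ 3 (Leading-num a)))
        (M.Leading-neg (C b *ₚ den′ ^ₚ 2) (M.Leading-* (C b) (den′ ^ₚ 2) (M.Leading-C b) (M.Leading-monic-^ den′ 2 (Leading-den a)))))
      where
      num′ = Formulas.num M.polyRing (C a) X
      den′ = Formulas.den M.polyRing (C a) X

    Leading-cubic : ∀ p → M.Leading (cubic M p) 3 M.1#
    Leading-cubic p = M.Leading-+-lower (X ^ₚ 3 +ₚ C p *ₚ X) (C p)
      (M.Leading-+-lower (X ^ₚ 3) (C p *ₚ X) (M.Leading-monic-^ X 3 M.Leading-X)
        (below (C p *ₚ X) (s≤s (s≤s z≤n)) (M.Leading-* (C p) X (M.Leading-C p) M.Leading-X)))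
      (below-C p 2)

    infix 4 _∣ₚ_
    _∣ₚ_ : Poly → Poly → Set (c ⊔ ℓ₁)
    f ∣ₚ g = SemiringDefinitions._∣_ (RawRing.rawSemiring M.polyRing) f g

    degree-zero-unit : ∀ f {x} → ¬ (x M.≈ M.0#) → M.Leading f 0 x → f ∣ₚ C M.1#
    degree-zero-unit f {x} x≉0 (f≈x , above) =
      let y , xy≈1 = M.inverseOf x≉0 in C y RawMagmaDefinitions., λ n → M.trans (M.coeff-+ (map (y M.*_) f) (M.0# ∷ []) n)
        (M.trans (M.+-cong (M.coeff-scale y f n) M.refl) (inverse-coeff y xy≈1 n))
      where
      inverse-coeff : ∀ y → x M.* y M.≈ M.1# → ∀ n → y M.* M.coeff f n M.+ M.coeff (M.0# ∷ []) n M.≈ M.coeff (C M.1#) n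
      inverse-coeff y xy≈1 zero    = M.trans (M.+-identityʳ _) (M.trans (M.*-congˡ f≈x) (M.trans (M.*-comm y x) xy≈1))
      inverse-coeff y xy≈1 (suc n) = M.trans (M.+-identityʳ _) (M.trans (M.*-congˡ (above (suc n) (s≤s z≤n))) (M.zeroʳ y))

    unit⇒degree-zero : ∀ f {n x} → ¬ (x M.≈ M.0#) → M.Leading f n x → f ∣ₚ C M.1# → n ≡ 0
    unit⇒degree-zero f {n} x≉0 lead (q RawMagmaDefinitions., qf≈1) =
      let m , degree = M.degree-of-nonzero q (λ q≋0 → M.1≉0 (M.trans (M.sym (qf≈1 0)) (M.zero-*ₚ q f q≋0 0)))
          y , y≉0 , lead-q = M.HasDegree⇒Leading q degree
      in ℕₚ.m+n≡0⇒n≡0 m (M.Leading-unique (C M.1#) (M.*-nonzero y≉0 x≉0) M.1≉0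
           (M.Leading-resp (q *ₚ f) (C M.1#) qf≈1 M.refl (M.Leading-* q f lead-q lead)) (M.Leading-C M.1#))

    irreducible⇒rootless : ∀ f {n} m → 1 ℕ.< n → M.Leading f n M.1# → IrreducibleOver M f → ¬ (M.eval f m M.≈ M.0#)
    irreducible⇒rootless f {n} m 1<n lead irreducible fm≈0 =
      let q = M.quotient m f
          fq = M.factor-root m f fm≈0
          k , degree = M.degree-of-nonzero q (λ q≋0 → M.1≉0 (M.trans (M.sym (proj₁ lead)) (M.quotient-reflects-zero m f fm≈0 q≋0 n)))
          y , y≉0 , lead-q = M.HasDegree⇒Leading q degree
          1+k≡n = M.Leading-unique f (M.*-nonzero M.1≉0 y≉0) M.1≉0
            (M.Leading-resp ((M.- m ∷ M.1# ∷ []) *ₚ q) f fq M.refl (M.Leading-* (M.- m ∷ M.1# ∷ []) q (M.Leading-linear m) lead-q)) lead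
      in [ (λ unit → contradiction (unit⇒degree-zero (M.- m ∷ M.1# ∷ []) M.1≉0 (M.Leading-linear m) unit) λ ())
         , (λ unit → ℕₚ.<-irrefl (≡.trans (≡.cong suc (≡.sym (unit⇒degree-zero q y≉0 lead-q unit))) 1+k≡n) 1<n) ]′
           (SemiringDefinitions.Irreducible.split-∣1 irreducible {M.- m ∷ M.1# ∷ []} {q} (λ n → M.sym (fq n)))

    Leading-map : ∀ f {n x} → M.Leading f n x → Leading (map ι f) n (ι x)
    Leading-map f (eq , above) =
      trans (coeff-map f _) (⟦⟧-cong eq) , λ m n<m → trans (coeff-map f m) (trans (⟦⟧-cong (above m n<m)) 0#-homo)

    degree≥roots : ∀ f {n x} zs → ¬ (x M.≈ M.0#) → M.Leading f n x → Distinct zs → All (λ z → ev f z ≈ 0#) zs → length zs ℕ.≤ n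
    degree≥roots f {n} zs x≉0 lead distinct roots with length zs ℕₚ.≤? n
    ... | yes ≤n = ≤n
    ... | no ≰n = contradiction
      (M.trans (M.sym (proj₁ lead)) (ι-injective (trans (sym (coeff-map f n)) (trans
        (zero-of-roots (map ι f) zs distinct (λ m ≤m → proj₂ (Leading-map f lead) m (ℕₚ.<-≤-trans (ℕₚ.≰⇒> ≰n) ≤m)) roots n) (sym 0#-homo)))))
      x≉0

    -- In a factorization one factor vanishes at the first root, hence by the transitivity
    -- hypothesis at all roots. It then has the full degree, and the other factor is a constant.
    irreducible-from-roots : ∀ g zs → M.Leading g (length zs) M.1# → 0 ℕ.< length zs → Distinct zs →
      (∀ f → (∃[ z ] (z ∈ zs × ev f z ≈ 0#)) → All (λ z → ev f z ≈ 0#) zs) → All (λ z → ev g z ≈ 0#) zs → IrreducibleOver M g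
    irreducible-from-roots g (z₀ ∷ zs) lead _ distinct transitive roots = SemiringDefinitions.mkIrred not-unit split
      where
      nonzero-factors : ∀ f h → f *ₚ h M.≋ g → ¬ (f M.≋ []) × ¬ (h M.≋ [])
      nonzero-factors f h eq =
        (λ f≋0 → M.1≉0 (M.trans (M.sym (proj₁ lead)) (M.trans (M.sym (eq _)) (M.zero-*ₚ f h f≋0 _)))) ,
        (λ h≋0 → M.1≉0 (M.trans (M.sym (proj₁ lead)) (M.trans (M.sym (eq _)) (*-zero f h h≋0 _))))
        where
        *-zero : ∀ f h → h M.≋ [] → f *ₚ h M.≋ []
        *-zero []      h h≋0 n       = M.refl
        *-zero (x ∷ f) h h≋0 n = M.trans (M.coeff-+ (map (x M.*_) h) _ n)
          (M.trans (M.+-cong (M.trans (M.coeff-scale x h n) (M.trans (M.*-congˡ (h≋0 n)) (M.zeroʳ x))) (tail n)) (M.+-identityʳ _))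
          where
          tail : ∀ n → M.coeff (M.0# ∷ f *ₚ h) n M.≈ M.0#
          tail zero    = M.refl
          tail (suc n) = *-zero f h h≋0 n

      not-unit : ¬ (g ∣ₚ C M.1#)
      not-unit unit = contradiction (unit⇒degree-zero g M.1≉0 lead unit) λ ()

      split : ∀ {f h} → g M.≋ f *ₚ h → f ∣ₚ C M.1# ⊎ h ∣ₚ C M.1#
      split {f} {h} g≋fh =
        let f≉0 , h≉0 = nonzero-factors f h (λ n → M.sym (g≋fh n))
            m , deg-f = M.degree-of-nonzero f f≉0
            n , deg-h = M.degree-of-nonzero h h≉0
            x , x≉0 , lead-f = M.HasDegree⇒Leading f deg-f
            y , y≉0 , lead-h = M.HasDegree⇒Leading h deg-h
            m+n≡ = M.Leading-unique (f *ₚ h) (M.*-nonzero x≉0 y≉0) M.1≉0 (M.Leading-* f h lead-f lead-h)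
                     (M.Leading-resp g (f *ₚ h) g≋fh M.refl lead)
        in cases x≉0 lead-f y≉0 lead-h m+n≡
        where
        product-root : ev f z₀ * ev h z₀ ≈ 0#
        product-root = trans (sym (ev-* f h z₀)) (trans (eval-cong (map ι (f *ₚ h)) (map ι g)
          (λ n → trans (coeff-map (f *ₚ h) n) (trans (⟦⟧-cong (M.sym (g≋fh n))) (sym (coeff-map g n)))) refl) (All.head roots))

        zero-left : ∀ m n → m ℕ.+ n ≡ suc (length zs) → suc (length zs) ℕ.≤ m → n ≡ 0
        zero-left m n eq ≤m = ℕₚ.n≤0⇒n≡0 (ℕₚ.+-cancelˡ-≤ m n 0
          (ℕₚ.≤-trans (ℕₚ.≤-reflexive eq) (ℕₚ.≤-trans ≤m (ℕₚ.≤-reflexive (≡.sym (ℕₚ.+-identityʳ m))))))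

        cases : ∀ {m n x y} → ¬ (x M.≈ M.0#) → M.Leading f m x → ¬ (y M.≈ M.0#) → M.Leading h n y → m ℕ.+ n ≡ suc (length zs) →
                f ∣ₚ C M.1# ⊎ h ∣ₚ C M.1#
        cases {m} {n} {x} {y} x≉0 lead-f y≉0 lead-h m+n≡ with ev f z₀ ≟ 0#
        ... | yes fz₀≈0 = inj₂ (degree-zero-unit h y≉0 (≡.subst (λ k → M.Leading h k y)
          (zero-left m n m+n≡ (degree≥roots f (z₀ ∷ zs) x≉0 lead-f distinct (transitive f (z₀ , here ≡.refl , fz₀≈0)))) lead-h))
        ... | no fz₀≉0 = inj₁ (degree-zero-unit f x≉0 (≡.subst (λ k → M.Leading f k x)
          (zero-left n m (≡.trans (ℕₚ.+-comm n m) m+n≡) (degree≥roots h (z₀ ∷ zs) y≉0 lead-h distinct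
            (transitive h (z₀ , here ≡.refl , *-cancel product-root fz₀≉0)))) lead-f))

    same-roots : ∀ f g {n x} zs → length zs ≡ n → Distinct zs → M.Leading f n x → M.Leading g n x →
                 All (λ z → ev f z ≈ 0#) zs → All (λ z → ev g z ≈ 0#) zs → f M.≋ g
    same-roots f g zs ≡.refl distinct lead-f lead-g roots-f roots-g n = ι-injective (trans (sym (coeff-map f n)) (trans
      (determined-by-roots (map ι f) (map ι g) _ zs distinct (Leading-map f lead-f) (Leading-map g lead-g) roots-f roots-g n)
      (coeff-map g n)))

    descend : ∀ (P : List Carrier) → (∀ n → image (Polynomial.coeff (rawRing closure) P n)) → ∃[ f ] (map ι f ≋ P)
    descend []      coeffs∈M = [] , λ n → refl
    descend (x ∷ P) coeffs∈M =
      let m , ιm≈x = coeffs∈M 0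
          f , f≋P  = descend P (λ n → coeffs∈M (suc n))
      in m ∷ f , λ { zero → ιm≈x ; (suc n) → f≋P n }

  open PolynomialsOverM

  module _ {S} (S-spec : IsSpecialization S) where
    open IsSpecialization S-spec
    open Polynomial (rawRing closure) using (coeff)

    rootsPoly-related : ∀ {I : Set} (u u′ : I → Carrier) → (∀ i → S (u i , u′ i)) →
                        ∀ O n → S (coeff (rootsPoly (map u O)) n , coeff (rootsPoly (map u′ O)) n)
    rootsPoly-related u u′ related []      zero    = 1-closed
    rootsPoly-related u u′ related []      (suc n) = 0-closed
    rootsPoly-related u u′ related (i ∷ O) zero    =
      ≈-closed (sym (coeff-linear-zero (u i) (rootsPoly (map u O))) , sym (coeff-linear-zero (u′ i) (rootsPoly (map u′ O))))
        (*-closed (neg-closed (related i)) (rootsPoly-related u u′ related O 0))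
    rootsPoly-related u u′ related (i ∷ O) (suc n) =
      ≈-closed (sym (coeff-linear-suc (u i) (rootsPoly (map u O)) n) , sym (coeff-linear-suc (u′ i) (rootsPoly (map u′ O)) n))
        (+-closed (*-closed (neg-closed (related i)) (rootsPoly-related u u′ related O (suc n))) (rootsPoly-related u u′ related O n))

  -- Parity of permutations and irrationality of the roots.

  true-or-false : ∀ b → b ≡ false ⊎ b ≡ true
  true-or-false false = inj₁ ≡.refl
  true-or-false true  = inj₂ ≡.refl

  -- Fixed by the even and exchanged by the odd permutations; unlike for the square root of the
  -- discriminant, this separates the two parities in characteristic 2 as well.
  cyclic cyclic′ : (Fin 3 → Carrier) → Carrier
  cyclic  r = r 0F * r 0F * r 1F + r 1F * r 1F * r 2F + r 2F * r 2F * r 0F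
  cyclic′ r = r 1F * r 1F * r 0F + r 2F * r 2F * r 1F + r 0F * r 0F * r 2F

  cyclic-even : ∀ r σ → odd σ ≡ false → cyclic (r ∘ act σ) ≈ cyclic r × cyclic′ (r ∘ act σ) ≈ cyclic′ r
  cyclic-even r 0F _ = refl , refl
  cyclic-even r 1F _ = Z.solve 3 (λ x y z → y :* y :* z :+ z :* z :* x :+ x :* x :* y := x :* x :* y :+ y :* y :* z :+ z :* z :* x) refl _ _ _
                     , Z.solve 3 (λ x y z → z :* z :* y :+ x :* x :* z :+ y :* y :* x := y :* y :* x :+ z :* z :* y :+ x :* x :* z) refl _ _ _
  cyclic-even r 2F _ = Z.solve 3 (λ x y z → z :* z :* x :+ x :* x :* y :+ y :* y :* z := x :* x :* y :+ y :* y :* z :+ z :* z :* x) refl _ _ _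
                     , Z.solve 3 (λ x y z → x :* x :* z :+ y :* y :* x :+ z :* z :* y := y :* y :* x :+ z :* z :* y :+ x :* x :* z) refl _ _ _
  cyclic-even r 3F ()
  cyclic-even r 4F ()
  cyclic-even r 5F ()

  cyclic-odd : ∀ r σ → odd σ ≡ true → cyclic (r ∘ act σ) ≈ cyclic′ r × cyclic′ (r ∘ act σ) ≈ cyclic r
  cyclic-odd r 0F ()
  cyclic-odd r 1F ()
  cyclic-odd r 2F ()
  cyclic-odd r 3F _ = Z.solve 3 (λ x y z → x :* x :* z :+ z :* z :* y :+ y :* y :* x := y :* y :* x :+ z :* z :* y :+ x :* x :* z) refl _ _ _
                    , Z.solve 3 (λ x y z → z :* z :* x :+ y :* y :* z :+ x :* x :* y := x :* x :* y :+ y :* y :* z :+ z :* z :* x) refl _ _ _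
  cyclic-odd r 4F _ = Z.solve 3 (λ x y z → y :* y :* x :+ x :* x :* z :+ z :* z :* y := y :* y :* x :+ z :* z :* y :+ x :* x :* z) refl _ _ _
                    , Z.solve 3 (λ x y z → x :* x :* y :+ z :* z :* x :+ y :* y :* z := x :* x :* y :+ y :* y :* z :+ z :* z :* x) refl _ _ _
  cyclic-odd r 5F _ = Z.solve 3 (λ x y z → z :* z :* y :+ y :* y :* x :+ x :* x :* z := y :* y :* x :+ z :* z :* y :+ x :* x :* z) refl _ _ _
                    , Z.solve 3 (λ x y z → y :* y :* z :+ x :* x :* y :+ z :* z :* x := x :* x :* y :+ y :* y :* z :+ z :* z :* x) refl _ _ _

  cyclic-difference : ∀ {p} (R : CubicRoots p) → let open CubicRoots R in ¬ (cyclic root - cyclic′ root ≈ 0#)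
  cyclic-difference R eq = *-nonzero (apart≉0 λ ()) (*-nonzero (apart≉0 λ ()) (apart≉0 λ ()))
    (trans (Z.solve 3 (λ x y z → (x :- y) :* ((y :- z) :* (x :- z)) :=
      x :* x :* y :+ y :* y :* z :+ z :* z :* x :- (y :* y :* x :+ z :* z :* y :+ x :* x :* z)) refl (root 0F) (root 1F) (root 2F)) eq)
    where
    open CubicRoots R
    apart≉0 : ∀ {i j} → ¬ (i ≡ j) → ¬ (root i - root j ≈ 0#)
    apart≉0 i≢j eq = apart i≢j (x-y≈0⇒x≈y _ _ eq)

  eval-ι : ∀ f m → ev f (ι m) ≈ ι (M.eval f m)
  eval-ι []      m = sym 0#-homo
  eval-ι (y ∷ f) m = trans (+-congˡ (trans (*-congˡ (eval-ι f m)) (sym (*-homo m (M.eval f m))))) (sym (+-homo y _))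

  root-not-in-M : ∀ {a} (X : CubicRoots a) → IrreducibleOver M (cubic M a) → ∀ i → ¬ image (CubicRoots.root X i)
  root-not-in-M {a} X irreducible i (m , ιm≈x) =
    irreducible⇒rootless (cubic M a) m (s≤s (s≤s z≤n)) (Leading-cubic a) irreducible
      (ι-injective (trans (sym (eval-ι (cubic M a) m)) (trans (ev-cubic a (ι m)) (trans
        (+-congʳ (+-cong (*-cong ιm≈x (*-cong ιm≈x ιm≈x)) (*-congˡ ιm≈x))) (trans (CubicRoots.isRoot X i) (sym 0#-homo))))))

  swap-conjugation : ∀ {p q} (X : CubicRoots p) (Y : CubicRoots q) {σ τ} → JointRoots.G Y X τ σ → JointRoots.G X Y σ τ
  swap-conjugation X Y {σ} {τ} g = JointRoots.conjugation λ t t≈0 →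
    trans (⟦⟧-cong-env t λ { (inj₁ i) → refl ; (inj₂ j) → refl })
      (trans (sym (reflexive (⟦rename⟧ Sum.swap t (JointRoots.roots Y X ∘ JointRoots.act² Y X τ σ))))
        (JointRoots.G.preserves g (rename Sum.swap t)
          (trans (reflexive (⟦rename⟧ Sum.swap t (JointRoots.roots Y X)))
            (trans (⟦⟧-cong-env t λ { (inj₁ i) → refl ; (inj₂ j) → refl }) t≈0))))

  -- The action on the six roots of H and its factorization.

  module Comparison {a b} (3≉0 : ¬ (3 · 1# ≈ 0#)) (a≉b : ¬ (ι a ≈ ι b)) (a≉0 : ¬ (ι a ≈ 0#)) (b≉0 : ¬ (ι b ≈ 0#))
    (X : CubicRoots a) (Y : CubicRoots b) where
    open JointRoots X Y public

    private
      abstract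
        matching : ∀ π → ∃[ u ] ∃[ C ] (M[ roots ] u × M[ roots ] C × Match 3≉0 X (permute Y π) u C)
        matching π = match-exists 3≉0 a≉0 b≉0 X (permute Y π) a≉b (M[]-isSubring roots) (λ m → const m , refl)
          (λ i → var (inj₁ i) , refl) (λ i → var (inj₂ (act π i)) , refl)

    u C : S₃ → Carrier
    u π = proj₁ (matching π)
    C π = proj₁ (proj₂ (matching π))

    u∈ : ∀ π → M[ roots ] (u π)
    u∈ π = proj₁ (proj₂ (proj₂ (matching π)))

    C∈ : ∀ π → M[ roots ] (C π)
    C∈ π = proj₁ (proj₂ (proj₂ (proj₂ (matching π))))

    u-match : ∀ π → Match 3≉0 X (permute Y π) (u π) (C π)
    u-match π = proj₂ (proj₂ (proj₂ (proj₂ (matching π))))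

    Γ : S₃ → S₃ → K².Carrier → Set (c ⊔ ℓ₁)
    Γ σ τ = Graph roots (act² σ τ)

    Γ-isSpecialization : ∀ {σ τ} → G σ τ → IsSpecialization (Γ σ τ)
    Γ-isSpecialization {σ} {τ} g = graph-isSpecialization roots (act² σ τ) (preserves g)

    -- The homomorphism of (σ , τ) is applied to the equation for `x j` and `y (act π j)`; it
    -- becomes the equation for `x (act σ j)` and `y (act τ (act π j))`, which belongs to `τ π σ⁻¹`.
    Γ-match : ∀ {σ τ} → G σ τ → ∀ π {u u′ C C′} → Match 3≉0 X (permute Y π) u C → Γ σ τ (u , u′) → Γ σ τ (C , C′) →
              Match 3≉0 X (permute Y (move σ τ π)) u′ C′
    Γ-match {σ} {τ} g π {u} {u′} {C} {C′} match u-related C-related i =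
      ≡.subst (λ i → 3 · y (act (move σ τ π) i) ≈ C′ * θ (ι a) u′ (x i)) (S₃.act-inv σ i) at-image
      where
      open IsSpecialization (Γ-isSpecialization g)
      j = act (S₃.inv σ) i

      3-related : ∀ {z z′} → Γ σ τ (z , z′) → Γ σ τ (3 · z , 3 · z′)
      3-related s = +-closed s (+-closed s (+-closed s 0-closed))

      2-related : ∀ {z z′} → Γ σ τ (z , z′) → Γ σ τ (2 · z , 2 · z′)
      2-related s = +-closed s (+-closed s 0-closed)

      x-related : Γ σ τ (x j , x (act σ j))
      x-related = var (inj₁ j) , refl , refl

      y-related : Γ σ τ (y (act π j) , y (act τ (act π j)))
      y-related = var (inj₂ (act π j)) , refl , refl

      at-image : 3 · y (act (move σ τ π) (act σ j)) ≈ C′ * θ (ι a) u′ (x (act σ j))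
      at-image = trans (reflexive (≡.cong (λ k → 3 · y k) (S₃.act-move σ τ π j)))
        (functional (3-related y-related)
          (*-closed C-related (+-closed (+-closed (3-related (*-closed x-related x-related)) (*-closed u-related x-related)) (2-related (constant a))))
          (match j))

    uC-related : ∀ {σ τ} → G σ τ → ∀ π → Γ σ τ (u π , u (move σ τ π)) × Γ σ τ (C π , C (move σ τ π))
    uC-related {σ} {τ} g π =
      let t , t≈u = u∈ π
          s , s≈C = C∈ π
          match   = Γ-match g π (u-match π) (t , t≈u , refl) (s , s≈C , refl)
          u≈ , C≈ = match-unique 3≉0 a≉0 b≉0 X (permute Y (move σ τ π)) match (u-match (move σ τ π))
      in (t , t≈u , u≈) , (s , s≈C , C≈)

    u-related : ∀ {σ τ} → G σ τ → ∀ π → Γ σ τ (u π , u (move σ τ π))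
    u-related g π = proj₁ (uC-related g π)

    -- Equal parameters have equal scales and so produce the same ordered triple of y's.
    u-injective : ∀ π ρ → u π ≈ u ρ → π ≡ ρ
    u-injective π ρ eq = S₃.act-faithful π ρ λ i → Y.distinct (act π i) (act ρ i)
      (match-roots-unique 3≉0 a≉0 b≉0 X (permute Y π) (permute Y ρ) (u-match π)
        (λ j → trans (u-match ρ j) (*-congˡ (θ-cong refl (sym eq) refl))) i)

    H-root : ∀ π → ev (H M a b) (u π) ≈ 0#
    H-root π = trans (ev-H a b (u π))
      (trans (+-congˡ (-‿cong (match-equation 3≉0 a≉0 b≉0 X (permute Y π) (u-match π)))) (-‿inverseʳ _))

    distinct-values : ∀ {O} → AllPairs (λ π ρ → ¬ (π ≡ ρ)) O → Distinct (map u O)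
    distinct-values []        = []
    distinct-values (≢ ∷ ≢s) = Allₚ.map⁺ (All.map (λ π≢ρ eq → π≢ρ (u-injective _ _ eq)) ≢) ∷ distinct-values ≢s

    fixed-in-M : ∀ {z} → M[ roots ] z → (∀ {σ τ} → G σ τ → Γ σ τ (z , z)) → image z
    fixed-in-M (t , t≈z) fixed = IsSubring.≈-closed image-isSubring t≈z (fixed⇒∈M t λ {σ} {τ} g →
      trans (IsSpecialization.functional (Γ-isSpecialization g) (t , refl , refl) (fixed g) t≈z) (sym t≈z))

    -- Stability of `O` under `G` puts the coefficients of the product of the X - u_π into M, and
    -- transitivity on `O` makes the product irreducible.
    orbit-factor : ∀ O → AllPairs (λ π ρ → ¬ (π ≡ ρ)) O → IsOrbit O →
      ∃[ g ] (IrreducibleOver M g × M.Leading g (length O) M.1# × All (λ π → ev g (u π) ≈ 0#) O)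
    orbit-factor O O-distinct (stable , π₀ , π₀∈O , transitive) = g , irreducible , g-leading , g-roots
      where
      open Polynomial (rawRing closure) using (coeff)
      P : List Carrier
      P = rootsPoly (map u O)

      P-leading : Leading P (length O) 1#
      P-leading = ≡.subst (λ n → Leading P n 1#) (Listₚ.length-map u O) (Leading-rootsPoly (map u O))

      module _ {σ τ} (gστ : G σ τ) where
        u′ : S₃ → Carrier
        u′ = u ∘ move σ τ

        u′-distinct : Distinct (map u′ O)
        u′-distinct = go O-distinct
          where
          move-injective : ∀ π ρ → u′ π ≈ u′ ρ → π ≡ ρ
          move-injective π ρ eq = u-injective π ρ (IsSpecialization.injective (Γ-isSpecialization gστ)
            (u-related gστ π) (u-related gστ ρ) eq)

          go : ∀ {O} → AllPairs (λ π ρ → ¬ (π ≡ ρ)) O → Distinct (map u′ O)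
          go []        = []
          go (≢ ∷ ≢s) = Allₚ.map⁺ (All.map (λ π≢ρ eq → π≢ρ (move-injective _ _ eq)) ≢) ∷ go ≢s

        -- Both are monic of the same degree and vanish at the moved points. Comparing roots
        -- replaces an argument that the coefficients are symmetric functions.
        same-polynomial : P ≋ rootsPoly (map u′ O)
        same-polynomial = determined-by-roots P (rootsPoly (map u′ O)) 1# (map u′ O) u′-distinct
          (≡.subst (λ n → Leading P n 1#) (≡.sym (Listₚ.length-map u′ O)) P-leading)
          (Leading-rootsPoly (map u′ O))
          (Allₚ.map⁺ (All.tabulate λ {π} π∈O → All.lookup (rootsPoly-vanishes (map u O)) (∈-map⁺ u (stable gστ π∈O))))
          (rootsPoly-vanishes (map u′ O))

      coefficient∈M : ∀ n → image (coeff P n)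
      coefficient∈M n =
        let t , t≈c , _ = rootsPoly-related (graph-isSpecialization roots id (preserves-id roots)) u u
                            (λ π → let t , t≈u = u∈ π in t , t≈u , t≈u) O n
        in fixed-in-M (t , t≈c) λ {σ} {τ} gστ → IsSpecialization.≈-closed (Γ-isSpecialization gστ)
             (refl , sym (same-polynomial gστ n))
             (rootsPoly-related (Γ-isSpecialization gστ) u (u ∘ move σ τ) (u-related gστ) O n)

      g : M.Poly
      g = proj₁ (descend P coefficient∈M)

      g≋P : map ι g ≋ P
      g≋P = proj₂ (descend P coefficient∈M)

      g-leading : M.Leading g (length O) M.1#
      g-leading = ι-injective (trans (sym (coeff-map g _)) (trans (g≋P _) (trans (proj₁ P-leading) (sym 1#-homo)))) ,
        λ m n<m → ι-injective (trans (sym (coeff-map g m)) (trans (g≋P m) (trans (proj₂ P-leading m n<m) (sym 0#-homo))))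

      g-values : All (λ z → ev g z ≈ 0#) (map u O)
      g-values = All.map (λ {z} eq → trans (eval-cong (map ι g) P g≋P refl) eq) (rootsPoly-vanishes (map u O))

      g-roots : All (λ π → ev g (u π) ≈ 0#) O
      g-roots = Allₚ.map⁻ g-values

      all-from-one : ∀ f → (∃[ z ] (z ∈ map u O × ev f z ≈ 0#)) → All (λ z → ev f z ≈ 0#) (map u O)
      all-from-one f (z , z∈ , fz≈0) =
        let π , π∈O , z≡ = ∈-map⁻ u z∈
            σ , τ , gστ , move≡ = transitive π∈O
            fπ₀≈0 : ev f (u π₀) ≈ 0#
            fπ₀≈0 = IsSpecialization.injective (Γ-isSpecialization gστ)
              (IsSpecialization.ev-related (Γ-isSpecialization gστ) f (u-related gστ π₀))
              (IsSpecialization.0-closed (Γ-isSpecialization gστ))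
              (trans (reflexive (≡.cong (λ π → ev f (u π)) move≡)) (trans (reflexive (≡.cong (ev f) (≡.sym z≡))) fz≈0))
        in Allₚ.map⁺ (All.tabulate λ {ρ} ρ∈O →
             let σ′ , τ′ , g′ , move≡′ = transitive ρ∈O in
             trans (reflexive (≡.cong (λ π → ev f (u π)) (≡.sym move≡′)))
               (IsSpecialization.zero-zero (Γ-isSpecialization g′)
                 (IsSpecialization.ev-related (Γ-isSpecialization g′) f (u-related g′ π₀)) fπ₀≈0))

      irreducible : IrreducibleOver M g
      irreducible = irreducible-from-roots g (map u O)
        (≡.subst (λ n → M.Leading g n M.1#) (≡.sym (Listₚ.length-map u O)) g-leading)
        (≡.subst (0 ℕ.<_) (≡.sym (Listₚ.length-map u O)) (positive π₀∈O))
        (distinct-values O-distinct) all-from-one g-values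
        where
        positive : ∀ {π} {O : List S₃} → π ∈ O → 0 ℕ.< length O
        positive (here _)  = s≤s z≤n
        positive (there _) = s≤s z≤n

    private
      Factor : M.Poly → List S₃ → Set (c ⊔ ℓ₁)
      Factor g O = IrreducibleOver M g × M.Leading g (length O) M.1# × All (λ π → ev g (u π) ≈ 0#) O

      product : List M.Poly → M.Poly
      product = List.foldr M._*ₚ_ (M.C M.1#)

      factors : ∀ Os → All (AllPairs (λ π ρ → ¬ (π ≡ ρ))) Os → All IsOrbit Os → ∃[ gs ] Pointwise Factor gs Os
      factors []       []       []       = [] , []
      factors (O ∷ Os) (d ∷ ds) (o ∷ os) =
        let g , factor = orbit-factor O d o
            gs , pw = factors Os ds os
        in g ∷ gs , factor ∷ pw

      product-leading : ∀ {gs Os} → Pointwise Factor gs Os → M.Leading (product gs) (length (List.concat Os)) M.1#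
      product-leading [] = M.Leading-C M.1#
      product-leading {g ∷ gs} {O ∷ Os} ((_ , lead , _) ∷ pw) =
        ≡.subst (λ n → M.Leading (g M.*ₚ product gs) n M.1#) (≡.sym (Listₚ.length-++ O))
          (M.Leading-resp (g M.*ₚ product gs) (g M.*ₚ product gs) (λ _ → M.refl) (M.*-identityˡ M.1#)
            (M.Leading-* g (product gs) lead (product-leading pw)))

      product-roots : ∀ {gs Os} → Pointwise Factor gs Os → All (λ π → ev (product gs) (u π) ≈ 0#) (List.concat Os)
      product-roots [] = []
      product-roots {g ∷ gs} ((_ , _ , roots-g) ∷ pw) = Allₚ.++⁺
        (All.map (λ {π} eq → trans (ev-* g (product gs) (u π)) (trans (*-congʳ eq) (zeroˡ _))) roots-g)
        (All.map (λ {π} eq → trans (ev-* g (product gs) (u π)) (trans (*-congˡ eq) (zeroʳ _))) (product-roots pw))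

      irreducible-degrees : ∀ {gs Os} → Pointwise Factor gs Os →
                            Pointwise (λ g d → IrreducibleOver M g × HasDegree M g d) gs (map length Os)
      irreducible-degrees [] = []
      irreducible-degrees {g ∷ _} ((irreducible , (top , above) , _) ∷ pw) =
        (irreducible , M.≉⇒# (λ eq → M.1≉0 (M.trans (M.sym top) eq)) , above) ∷ irreducible-degrees pw

    -- H and the product of the orbit factors, scaled by a - b, have degree 6, the same leading
    -- coefficient and the same six distinct roots.
    degrees-from-orbits : ∀ Os → All (AllPairs (λ π ρ → ¬ (π ≡ ρ))) Os → AllPairs (λ π ρ → ¬ (π ≡ ρ)) (List.concat Os) →
      length (List.concat Os) ≡ 6 → All IsOrbit Os → HasFactorDegrees M (H M a b) (map length Os)
    degrees-from-orbits Os ds distinct six orbits =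
      let gs , pw = factors Os ds orbits in
      e , gs , M.≉⇒# e≉0 , equal gs pw , irreducible-degrees pw
      where
      e : M.Carrier
      e = a M.- b

      e≉0 : ¬ (e M.≈ M.0#)
      e≉0 eq = a≉b (⟦⟧-cong (M.x-y≈0⇒x≈y a b eq))

      values : ∀ f → All (λ π → ev f (u π) ≈ 0#) (List.concat Os) → All (λ z → ev f z ≈ 0#) (map u (List.concat Os))
      values f = Allₚ.map⁺

      equal : ∀ gs → Pointwise Factor gs Os → H M a b M.≋ M.C e M.*ₚ product gs
      equal gs pw = same-roots (H M a b) (M.C e M.*ₚ product gs) (map u (List.concat Os))
        (≡.trans (Listₚ.length-map u (List.concat Os)) six) (distinct-values distinct) (Leading-H a b)
        (≡.subst (λ k → M.Leading (M.C e M.*ₚ product gs) k e) six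
          (M.Leading-resp (M.C e M.*ₚ product gs) (M.C e M.*ₚ product gs) (λ _ → M.refl) (M.*-identityʳ e)
            (M.Leading-* (M.C e) (product gs) (M.Leading-C e) (product-leading pw))))
        (values (H M a b) (All.tabulate λ {π} _ → H-root π))
        (values (M.C e M.*ₚ product gs) (All.map
          (λ {π} eq → trans (ev-* (M.C e) (product gs) (u π)) (trans (*-congˡ eq) (zeroʳ _))) (product-roots pw)))

    -- The two splitting fields under the joint Galois group.

    module LX = SplittingField X
    module LY = SplittingField Y

    La Lb : Carrier → Set (c ⊔ ℓ₁)
    La = LX.L∈
    Lb = LY.L∈

    image⊆La : ∀ {z} → image z → La z
    image⊆La z∈M = gen (inj₁ z∈M)

    image⊆Lb : ∀ {z} → image z → Lb z
    image⊆Lb z∈M = gen (inj₁ z∈M)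

    La-image : ∀ {z} → La z → ∀ σ → ∃[ z′ ] (∀ τ → Γ σ τ (z , z′))
    La-image z∈La σ =
      let t , t≈z = LX.L⊆M[root] z∈La in ⟦ t ⟧ (x ∘ act σ) , λ τ →
      rename inj₁ t , trans (reflexive (⟦rename⟧ inj₁ t roots)) t≈z , reflexive (⟦rename⟧ inj₁ t (roots ∘ act² σ τ))

    Lb-image : ∀ {z} → Lb z → ∀ τ → ∃[ z′ ] (∀ σ → Γ σ τ (z , z′))
    Lb-image z∈Lb τ =
      let t , t≈z = LY.L⊆M[root] z∈Lb in ⟦ t ⟧ (y ∘ act τ) , λ σ →
      rename inj₂ t , trans (reflexive (⟦rename⟧ inj₂ t roots)) t≈z , reflexive (⟦rename⟧ inj₂ t (roots ∘ act² σ τ))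

    La⊆M[roots] : ∀ {z} → La z → M[ roots ] z
    La⊆M[roots] z∈La = let _ , related = La-image z∈La 0F ; t , t≈z , _ = related 0F in t , t≈z

    Lb⊆M[roots] : ∀ {z} → Lb z → M[ roots ] z
    Lb⊆M[roots] z∈Lb = let _ , related = Lb-image z∈Lb 0F ; t , t≈z , _ = related 0F in t , t≈z

    record Stable (σ τ : S₃) (z : Carrier) : Set (c ⊔ ℓ₁) where
      constructor stable
      field stability : Γ σ τ (z , z)
    open Stable

    -- An element of `La` is an expression in the x's alone, so its image does not depend on the
    -- second component.
    La-first : ∀ {z σ τ τ′} → La z → G σ τ → Stable σ τ z → Stable σ τ′ z
    La-first {σ = σ} {τ} {τ′} z∈La g fixed =
      let z′ , related = La-image z∈La σ
          z′≈z = IsSpecialization.functional (Γ-isSpecialization g) (related τ) (stability fixed) refl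
          t , t≈z , t≈z′ = related τ′
      in stable (t , t≈z , trans t≈z′ z′≈z)

    Lb-second : ∀ {z σ σ′ τ} → Lb z → G σ τ → Stable σ τ z → Stable σ′ τ z
    Lb-second {σ = σ} {σ′} {τ} z∈Lb g fixed =
      let z′ , related = Lb-image z∈Lb τ
          z′≈z = IsSpecialization.functional (Γ-isSpecialization g) (related σ) (stability fixed) refl
          t , t≈z , t≈z′ = related σ′
      in stable (t , t≈z , trans t≈z′ z′≈z)

    Stable-id : ∀ {z} → M[ roots ] z → Stable 0F 0F z
    Stable-id (t , t≈z) = stable (t , t≈z , trans (⟦⟧-cong-env t λ { (inj₁ i) → reflexive (≡.cong x (S₃.act-id i))
                                                                  ; (inj₂ j) → reflexive (≡.cong y (S₃.act-id j)) }) t≈z)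

    Stable-∙ : ∀ {σ τ σ′ τ′ z} → G σ τ → Stable σ τ z → Stable σ′ τ′ z → Stable (σ ∙ σ′) (τ ∙ τ′) z
    Stable-∙ {σ} {τ} {σ′} {τ′} {z} g (stable fixed) (stable (t , t≈z , t≈z′)) = stable (t , t≈z , trans
      (⟦⟧-cong-env t λ { (inj₁ i) → reflexive (≡.cong x (S₃.act-∙ σ σ′ i)) ; (inj₂ j) → reflexive (≡.cong y (S₃.act-∙ τ τ′ j)) })
      (trans (sym (reflexive (⟦rename⟧ (act² σ′ τ′) t (roots ∘ act² σ τ))))
        (IsSpecialization.functional (Γ-isSpecialization g)
          (rename (act² σ′ τ′) t , trans (reflexive (⟦rename⟧ (act² σ′ τ′) t roots)) t≈z′ , refl) fixed refl)))

    -- The y's lie in `La` and are therefore fixed by every pair with trivial first component.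
    first-determines : (∀ {z} → Lb z → La z) → ∀ {τ} → G 0F τ → τ ≡ 0F
    first-determines Lb⊆La {τ} g = S₃.act-faithful τ 0F λ j → Y.distinct (act τ j) (act 0F j)
      (trans (IsSpecialization.functional (Γ-isSpecialization g) (var (inj₂ j) , refl , refl)
               (stability (La-first {τ = 0F} {τ} (Lb⊆La (LY.root∈L j)) G-id (Stable-id (var (inj₂ j) , refl)))) refl)
             (reflexive (≡.cong y (≡.sym (S₃.act-id j)))))

    second-determines : (∀ {z} → La z → Lb z) → ∀ {σ} → G σ 0F → σ ≡ 0F
    second-determines La⊆Lb {σ} g = S₃.act-faithful σ 0F λ i → X.distinct (act σ i) (act 0F i)
      (trans (IsSpecialization.functional (Γ-isSpecialization g) (var (inj₁ i) , refl , refl)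
               (stability (Lb-second {σ = 0F} {σ} (La⊆Lb (LX.root∈L i)) G-id (Stable-id (var (inj₁ i) , refl)))) refl)
             (reflexive (≡.cong x (≡.sym (S₃.act-id i)))))

    FixedMatching : Set (c ⊔ ℓ₁)
    FixedMatching = ∃[ π ] (∀ {σ τ} → G σ τ → Fixes π σ τ)

    -- A defect would act trivially on one of the two fields and not on the other.
    equal⇒fixed : La ≐ Lb → FixedMatching
    equal⇒fixed (La⊆Lb , Lb⊆La) with fixed-or-defect
    ... | inj₁ fixed = fixed
    ... | inj₂ (σ , τ , g , inj₁ (≡.refl , τ≢)) = contradiction (first-determines Lb⊆La g) τ≢
    ... | inj₂ (σ , τ , g , inj₂ (σ≢ , ≡.refl)) = contradiction (second-determines La⊆Lb g) σ≢

    module _ (π : S₃) (fixed : ∀ {σ τ} → G σ τ → Fixes π σ τ) where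
      private
        stays : ∀ {σ τ} → G σ τ → move σ τ π ≡ π
        stays {σ} {τ} g = S₃.fixes⇒move π σ τ (fixed g)

      u∈M : image (u π)
      u∈M = fixed-in-M (u∈ π) λ {σ} {τ} g → ≡.subst (λ ρ → Γ σ τ (u π , u ρ)) (stays g) (proj₁ (uC-related g π))

      C∈M : image (C π)
      C∈M = fixed-in-M (C∈ π) λ {σ} {τ} g → ≡.subst (λ ρ → Γ σ τ (C π , C ρ)) (stays g) (proj₂ (uC-related g π))

      -- With `u π` and `C π` in M, the equation 3y = Cθ(x) expresses each y through an x.
      fixed⇒Lb⊆La : ∀ {z} → Lb z → La z
      fixed⇒Lb⊆La z∈Lb = let t , t≈z = LY.L⊆M[root] z∈Lb in resp t≈z (terms t)
        where
        3·-closed : ∀ {w} → La w → La (3 · w)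
        3·-closed w = +∈ w (+∈ w (+∈ w 0∈))

        divide : ∀ {w} → La (3 · w) → La w
        divide {w} 3w = let t , 3t≈1 = inverseOf 3≉0 in
          resp (trans (Z.solve 2 (λ t w → t :* (3 :× w) := 3 :× Z.con 1ℤ :* t :* w) refl t w) (trans (*-congʳ 3t≈1) (*-identityˡ w)))
            (*∈ (⁻¹∈ 3t≈1 (3·-closed 1∈)) 3w)

        y∈La : ∀ i → La (y (act π i))
        y∈La i = divide (resp (sym (u-match π i)) (*∈ (image⊆La C∈M)
          (+∈ (+∈ (3·-closed (*∈ (LX.root∈L i) (LX.root∈L i))) (*∈ (image⊆La u∈M) (LX.root∈L i)))
              (+∈ (image⊆La (a , refl)) (+∈ (image⊆La (a , refl)) 0∈)))))

        terms : ∀ t → La (⟦ t ⟧ y)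
        terms (var j)   = ≡.subst (λ j → La (y j)) (S₃.act-inv π j) (y∈La (act (inv π) j))
        terms (const m) = image⊆La (m , refl)
        terms (s ⊞ t)   = +∈ (terms s) (terms t)
        terms (s ⊠ t)   = *∈ (terms s) (terms t)
        terms (⊟ t)     = -∈ (terms t)

    -- p = α + β s, where s is the cyclic sum of the x's, and β = (p - q) / (s - s′) and α are fixed by G.
    parity⇒∈La : (∀ {σ τ} → G σ τ → odd σ ≡ odd τ) → ∀ {p q} → M[ roots ] p → M[ roots ] q →
      (∀ {σ τ} → G σ τ → odd τ ≡ false → Γ σ τ (p , p) × Γ σ τ (q , q)) →
      (∀ {σ τ} → G σ τ → odd τ ≡ true → Γ σ τ (p , q) × Γ σ τ (q , p)) → La p
    parity⇒∈La same {p} {q} p∈ q∈ when-even when-odd =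
      resp (Z.solve 2 (λ p w → p :- w :+ w := p) refl p (β * s)) (+∈ (image⊆La α∈M) (*∈ (image⊆La β∈M) s∈La))
      where
      s s′ D : Carrier
      s = cyclic x
      s′ = cyclic′ x
      D = s - s′

      s∈La : La s
      s∈La = +∈ (+∈ (*∈ (*∈ x∈ x∈) x∈) (*∈ (*∈ x∈ x∈) x∈)) (*∈ (*∈ x∈ x∈) x∈)
        where
        x∈ : ∀ {i} → La (x i)
        x∈ {i} = LX.root∈L i

      D≉0 : ¬ (D ≈ 0#)
      D≉0 = cyclic-difference X

      D-inverse : ∃[ k ] (M[ roots ] k × D * k ≈ 1#)
      D-inverse = inverse-closed (M[]-isSubring roots) (λ m → const m , refl)
        (sˢ ⊞ ⊟ sˢ′ , refl) D≉0
        where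
        xᵗ : Fin 3 → Term (Fin 3 ⊎ Fin 3)
        xᵗ i = var (inj₁ i)
        sˢ sˢ′ : Term (Fin 3 ⊎ Fin 3)
        sˢ  = xᵗ 0F ⊠ xᵗ 0F ⊠ xᵗ 1F ⊞ xᵗ 1F ⊠ xᵗ 1F ⊠ xᵗ 2F ⊞ xᵗ 2F ⊠ xᵗ 2F ⊠ xᵗ 0F
        sˢ′ = xᵗ 1F ⊠ xᵗ 1F ⊠ xᵗ 0F ⊞ xᵗ 2F ⊠ xᵗ 2F ⊠ xᵗ 1F ⊞ xᵗ 0F ⊠ xᵗ 0F ⊠ xᵗ 2F

      k β α : Carrier
      k = proj₁ D-inverse
      β = (p - q) * k
      α = p - β * s

      βD : β * D ≈ p - q
      βD = trans (Z.solve 3 (λ d k D → d :* k :* D := d :* (D :* k)) refl (p - q) k D)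
             (trans (*-congˡ (proj₂ (proj₂ D-inverse))) (*-identityʳ _))

      s-related : ∀ {σ τ} → G σ τ → Γ σ τ (s , cyclic (x ∘ act σ)) × Γ σ τ (s′ , cyclic′ (x ∘ act σ))
      s-related {σ} {τ} g =
        +-closed (+-closed (*-closed (*-closed xᵍ xᵍ) xᵍ) (*-closed (*-closed xᵍ xᵍ) xᵍ)) (*-closed (*-closed xᵍ xᵍ) xᵍ) ,
        +-closed (+-closed (*-closed (*-closed xᵍ xᵍ) xᵍ) (*-closed (*-closed xᵍ xᵍ) xᵍ)) (*-closed (*-closed xᵍ xᵍ) xᵍ)
        where
        open IsSpecialization (Γ-isSpecialization g)
        xᵍ : ∀ {i} → Γ σ τ (x i , x (act σ i))
        xᵍ {i} = var (inj₁ i) , refl , refl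

      β∈ : M[ roots ] β
      β∈ = IsSubring.*-closed (M[]-isSubring roots)
        (IsSubring.+-closed (M[]-isSubring roots) p∈ (IsSubring.neg-closed (M[]-isSubring roots) q∈)) (proj₁ (proj₂ D-inverse))

      module _ {σ τ} (g : G σ τ) where
        open IsSpecialization (Γ-isSpecialization g)

        Parity : Set (c ⊔ ℓ₁)
        Parity = (odd τ ≡ false × Γ σ τ (s , s) × Γ σ τ (s′ , s′)) ⊎ (odd τ ≡ true × Γ σ τ (s , s′) × Γ σ τ (s′ , s))

        parity : Parity
        parity with true-or-false (odd τ)
        ... | inj₁ even = let e , e′ = cyclic-even x σ (≡.trans (same g) even) ; r , r′ = s-related g in
          inj₁ (even , ≈-closed (refl , e) r , ≈-closed (refl , e′) r′)
        ... | inj₂ odd′ = let e , e′ = cyclic-odd x σ (≡.trans (same g) odd′) ; r , r′ = s-related g in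
          inj₂ (odd′ , ≈-closed (refl , e) r , ≈-closed (refl , e′) r′)

        -- Odd elements change the sign of both p - q and s - s′, even ones change neither, so the
        -- ratio stays.
        β-fixed : Γ σ τ (β , β)
        β-fixed = let t , t≈β = β∈ in t , t≈β , *-cancelˡ D≉0
          (trans (*-comm D (⟦ t ⟧ (roots ∘ act² σ τ))) (trans (value t t≈β parity) (trans (sym βD) (*-comm β D))))
          where
          value : ∀ t → ⟦ t ⟧ roots ≈ β → Parity → ⟦ t ⟧ (roots ∘ act² σ τ) * D ≈ p - q
          value t t≈β (inj₁ (even , r , r′)) =
            let rp , rq = when-even g even in
            functional (*-closed (t , t≈β , refl) (+-closed r (neg-closed r′))) (+-closed rp (neg-closed rq)) βD
          value t t≈β (inj₂ (odd′ , r , r′)) =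
            let rp , rq = when-odd g odd′ in
            trans (Z.solve 3 (λ b s s′ → b :* (s :- s′) := :- (b :* (s′ :- s))) refl _ s s′)
              (trans (-‿cong (functional (*-closed (t , t≈β , refl) (+-closed r (neg-closed r′))) (+-closed rp (neg-closed rq)) βD))
                (Z.solve 2 (λ p q → :- (q :- p) := p :- q) refl p q))

        α-fixed : Γ σ τ (α , α)
        α-fixed = from-parity parity
          where
          -- An odd element turns α into q - βs′, which is α again because β(s - s′) = p - q.
          swap : q - β * s′ ≈ p - β * s
          swap = trans (Z.solve 5 (λ p q b s s′ → q :- b :* s′ := p :- b :* s :+ (b :* (s :- s′) :- (p :- q))) refl p q β s s′)
                   (trans (+-congˡ (trans (+-congʳ βD) (-‿inverseʳ _))) (+-identityʳ _))

          from-parity : Parity → Γ σ τ (α , α)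
          from-parity (inj₁ (even , r , _)) = +-closed (proj₁ (when-even g even)) (neg-closed (*-closed β-fixed r))
          from-parity (inj₂ (odd′ , r , _)) = ≈-closed (refl , swap) (+-closed (proj₁ (when-odd g odd′)) (neg-closed (*-closed β-fixed r)))

      β∈M : image β
      β∈M = fixed-in-M β∈ (λ g → β-fixed g)

      α∈M : image α
      α∈M = fixed-in-M (IsSubring.+-closed (M[]-isSubring roots) p∈
        (IsSubring.neg-closed (M[]-isSubring roots) (IsSubring.*-closed (M[]-isSubring roots) β∈ (La⊆M[roots] s∈La)))) (λ g → α-fixed g)

    -- On `La` the pair (σ , τ) acts like (σ , 0F), and the latter fixes `Lb` elementwise.
    intersection⊆M : (∀ {σ τ} → G σ τ → G σ 0F) → ∀ {z} → La z → Lb z → image z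
    intersection⊆M first {z} z∈La z∈Lb = fixed-in-M (La⊆M[roots] z∈La) λ {σ} {τ} g →
      stability (La-first {τ = 0F} {τ} z∈La (first g) (Lb-second z∈Lb G-id (Stable-id (La⊆M[roots] z∈La))))

    rotations-first : G 1F 0F → ∀ {σ} → odd σ ≡ false → G σ 0F
    rotations-first r {σ} even = let i , eq = S₃.even⇒power σ even in ≡.subst₂ G eq (S₃.0F-power i) (G-^ (Fin.toℕ i) r)

    -- An element of La ∩ Lb is moved by no g with an even component, since the rotations of the x's fix it.
    moved⇒parity : G 1F 0F → ∀ {z} → La z → Lb z → ¬ image z → ∀ {σ τ} → G σ τ → odd σ ≡ odd τ
    moved⇒parity r {z} z∈La z∈Lb z∉M {σ} {τ} h with odd σ Bool.≟ odd τ
    ... | yes eq = eq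
    ... | no odd≢ = contradiction (fixed-in-M (La⊆M[roots] z∈La) (λ g → stability (all-fixed g))) z∉M
      where
      fixed-0F : ∀ {σ} → Stable σ 0F z
      fixed-0F = Lb-second z∈Lb G-id (Stable-id (La⊆M[roots] z∈La))

      even-first : ∀ {σ τ} → odd σ ≡ false → Stable σ τ z
      even-first even = La-first z∈La (rotations-first r even) fixed-0F

      -- For odd `σ` cubing gives (σ , 0F), which fixes `Lb`; on `La` only `σ` matters.
      even-second : ∀ {σ τ} → G σ τ → odd τ ≡ false → Stable σ τ z
      even-second {σ} {τ} g even with S₃.cube σ | S₃.cube τ
      ... | inj₂ (even-σ , _) | _ = even-first even-σ
      ... | inj₁ _ | inj₁ (odd-τ , _) = contradiction (≡.trans (≡.sym even) odd-τ) λ ()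
      ... | inj₁ (_ , σ³≡σ) | inj₂ (_ , τ³≡0) = La-first z∈La (≡.subst₂ G σ³≡σ τ³≡0 (G-^ 3 g)) fixed-0F

      h-fixed : Stable σ τ z
      h-fixed with true-or-false (odd σ) | true-or-false (odd τ)
      ... | inj₁ even | _         = even-first even
      ... | inj₂ _    | inj₁ even = even-second h even
      ... | inj₂ o    | inj₂ o′   = contradiction (≡.trans o (≡.sym o′)) odd≢

      all-fixed : ∀ {σ₀ τ₀} → G σ₀ τ₀ → Stable σ₀ τ₀ z
      all-fixed {σ₀} {τ₀} g with true-or-false (odd σ₀) | true-or-false (odd τ₀)
      ... | inj₁ even | _         = even-first even
      ... | inj₂ _    | inj₁ even = even-second g even
      -- When both components are odd, divide by `h`: its components have different parities, so the
      -- quotient has an even component.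
      ... | inj₂ o    | inj₂ o′   = ≡.subst₂ (λ σ τ → Stable σ τ z) (S₃.recompose σ σ₀) (S₃.recompose τ τ₀)
          (Stable-∙ h h-fixed (ratio-fixed (true-or-false (odd σ)) (true-or-false (odd τ))))
        where
        ratio : G (σ ^ˢ 5 ∙ σ₀) (τ ^ˢ 5 ∙ τ₀)
        ratio = G-∙ (G-^ 5 h) g

        ratio-fixed : odd σ ≡ false ⊎ odd σ ≡ true → odd τ ≡ false ⊎ odd τ ≡ true → Stable (σ ^ˢ 5 ∙ σ₀) (τ ^ˢ 5 ∙ τ₀) z
        ratio-fixed (inj₂ oσ) _         = even-first (S₃.odd-quotient σ σ₀ oσ o)
        ratio-fixed (inj₁ _)  (inj₂ oτ) = even-second ratio (S₃.odd-quotient τ τ₀ oτ o′)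
        ratio-fixed (inj₁ eσ) (inj₁ eτ) = contradiction (≡.trans eσ (≡.sym eτ)) odd≢

    -- A parameter because one of the two inclusions comes from the construction with the roles of x
    -- and y exchanged.
    module _ (fixed⇒equal : FixedMatching → La ≐ Lb) where
      -- The equation matches the x's with the y's in some order `π`, so `u π` is `ι m` by
      -- uniqueness. Elements of M are not moved, and `u` is injective, so `π` is not moved either.
      value⇒fixed : ¬ (FM.δ b M.≈ M.0#) → ∀ m → ¬ (den (ι a) (ι m) ≈ 0#) →
                    ι b * den (ι a) (ι m) ^ 2 ≈ ι a * num (ι a) (ι m) ^ 3 → FixedMatching
      value⇒fixed δb≉0 m den≉0 equation =
        let Y′ , C , match = match-from-equation 3≉0 a≉0 b≉0 X δb≉0 (ι m) den≉0 equation
        in from-match Y′ C match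
        where
        from-match : ∀ Y′ C → Match 3≉0 X Y′ (ι m) C → FixedMatching
        from-match Y′ C match =
          let j₀ , eq₀ = Y.complete (y′ 0F) (Y′.isRoot 0F)
              j₁ , eq₁ = Y.complete (y′ 1F) (Y′.isRoot 1F)
              j₂ , eq₂ = Y.complete (y′ 2F) (Y′.isRoot 2F)
              π , π₀ , π₁ , π₂ = S₃.act-surjective j₀ j₁ j₂ (different eq₀ eq₁ λ ()) (different eq₁ eq₂ λ ()) (different eq₂ eq₀ λ ())
          in from-permutation π λ { 0F → at eq₀ π₀ ; 1F → at eq₁ π₁ ; 2F → at eq₂ π₂ }
          where
          module Y′ = CubicRoots Y′
          y′ = Y′.root

          different : ∀ {i i′ j j′} → y′ i ≈ y j → y′ i′ ≈ y j′ → ¬ (i ≡ i′) → ¬ (j ≡ j′)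
          different eq eq′ i≢i′ ≡.refl = i≢i′ (Y′.distinct _ _ (trans eq (sym eq′)))

          at : ∀ {z j j′} → z ≈ y j → j′ ≡ j → y j′ ≈ z
          at eq ≡.refl = sym eq

          from-permutation : ∀ π → (∀ i → y (act π i) ≈ y′ i) → FixedMatching
          from-permutation π same = π , λ {σ} {τ} g → S₃.move⇒fixes π σ τ (u-injective (move σ τ π) π
            (trans (IsSpecialization.functional (Γ-isSpecialization g) (u-related g π) (const m , refl , refl) u≈ιm) (sym u≈ιm)))
            where
            u≈ιm : u π ≈ ι m
            u≈ιm = proj₁ (match-unique 3≉0 a≉0 b≉0 X (permute Y π) (u-match π) (λ i → trans (·-cong 3 (same i)) (match i)))

      fixed⇒value : FixedMatching → ∃[ m ] (¬ (FM.den a m M.≈ M.0#) × b M.* FM.den a m FM.^ 2 M.≈ a M.* FM.num a m FM.^ 3)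
      fixed⇒value (π , fixed) =
        let m , ιm≈u = u∈M π fixed
            match : Match 3≉0 X (permute Y π) (ι m) (C π)
            match = λ i → trans (u-match π i) (*-congˡ (θ-cong refl (sym ιm≈u) refl))
        in m , (λ eq → match-den 3≉0 a≉0 b≉0 X (permute Y π) match (trans (sym (ι-hom.den-hom refl refl)) (trans (⟦⟧-cong eq) 0#-homo))) ,
           ι-injective (trans (ι-hom.*-hom refl (ι-hom.^-hom 2 (ι-hom.den-hom refl refl)))
             (trans (match-equation 3≉0 a≉0 b≉0 X (permute Y π) match)
               (sym (ι-hom.*-hom refl (ι-hom.^-hom 3 (ι-hom.num-hom refl refl))))))

      private
        Degrees : List ℕ → Set (c ⊔ ℓ₁ ⊔ ℓ₂)
        Degrees = HasFactorDegrees M (H M a b)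

      degrees-6 : G 1F 0F → (∃[ σ ] ∃[ τ ] (G σ τ × ¬ (odd σ ≡ odd τ))) → Degrees (6 ∷ [])
      degrees-6 r (σ , τ , g , odd≢) =
        degrees-from-orbits ((rotations List.++ reflections) ∷ []) (proj₁ S₃.all-partition) (proj₂ S₃.all-partition) ≡.refl
          (orbit-all r g odd≢ ∷ [])

      degrees-3-3 : G 1F 0F → (∀ {σ τ} → G σ τ → odd σ ≡ odd τ) → Degrees (3 ∷ 3 ∷ [])
      degrees-3-3 r same =
        degrees-from-orbits (rotations ∷ reflections ∷ []) (proj₁ S₃.parity-partition) (proj₂ S₃.parity-partition) ≡.refl
          (proj₁ (orbits-parity r same) ∷ proj₂ (orbits-parity r same) ∷ [])

      module _ (rotation : ∃[ σ ] ∃[ τ ] (G σ τ × IsRotation σ)) (fixed : FixedMatching) where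
        private
          π = proj₁ fixed
          reflections-orbit : IsOrbit (map (π ∙_) reflections)
          reflections-orbit = let _ , _ , g , rot = rotation in orbit-reflections π (proj₂ fixed) g rot

        degrees-1-2-3 : (∃[ σ ] ∃[ τ ] (G σ τ × odd σ ≡ true)) → Degrees (1 ∷ 2 ∷ 3 ∷ [])
        degrees-1-2-3 (σ , τ , g , odd-σ) =
          degrees-from-orbits (map (map (π ∙_)) ((0F ∷ []) ∷ (1F ∷ 2F ∷ []) ∷ reflections ∷ []))
            (proj₁ (S₃.conjugacy-partition π)) (proj₂ (S₃.conjugacy-partition π)) ≡.refl
            (orbit-fixed π (proj₂ fixed) ∷ orbit-rotations π (proj₂ fixed) g odd-σ ∷ reflections-orbit ∷ [])

        degrees-1-1-1-3 : (∀ {σ τ} → G σ τ → odd σ ≡ false) → Degrees (1 ∷ 1 ∷ 1 ∷ 3 ∷ [])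
        degrees-1-1-1-3 even =
          degrees-from-orbits (map (map (π ∙_)) ((0F ∷ []) ∷ (1F ∷ []) ∷ (2F ∷ []) ∷ reflections ∷ []))
            (proj₁ (S₃.centralizer-partition π)) (proj₂ (S₃.centralizer-partition π)) ≡.refl
            (orbit-fixed π (proj₂ fixed) ∷ proj₁ (orbits-even π (proj₂ fixed) even) ∷ proj₂ (orbits-even π (proj₂ fixed) even) ∷ reflections-orbit ∷ [])

      parity-or-not : (∀ {σ τ} → G σ τ → odd σ ≡ odd τ) ⊎ (∃[ σ ] ∃[ τ ] (G σ τ × ¬ (odd σ ≡ odd τ)))
      parity-or-not with decide (∃[ σ ] ∃[ τ ] (G σ τ × ¬ (odd σ ≡ odd τ)))
      ... | yes differ = inj₂ differ
      ... | no agree = inj₁ λ {σ} {τ} g → decidable-stable (odd σ Bool.≟ odd τ) λ odd≢ → agree (σ , τ , g , odd≢)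

      module _ (same : ∀ {σ τ} → G σ τ → odd σ ≡ odd τ) where
        -- Supplies an element common to `La` and `Lb`; by `cyclic∉M` it lies outside M as soon as
        -- some second component is odd. This excludes agreeing parities when the fields intersect
        -- in M.
        cyclic∈La : La (cyclic y)
        cyclic∈La = parity⇒∈La same (Lb⊆M[roots] s∈Lb) (Lb⊆M[roots] s′∈Lb)
          (λ {σ} {τ} g even → let r , r′ = related g ; e , e′ = cyclic-even y τ even in
            IsSpecialization.≈-closed (Γ-isSpecialization g) (refl , e) r , IsSpecialization.≈-closed (Γ-isSpecialization g) (refl , e′) r′)
          (λ {σ} {τ} g odd′ → let r , r′ = related g ; e , e′ = cyclic-odd y τ odd′ in
            IsSpecialization.≈-closed (Γ-isSpecialization g) (refl , e) r , IsSpecialization.≈-closed (Γ-isSpecialization g) (refl , e′) r′)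
          where
          y∈ : ∀ i → Lb (y i)
          y∈ = LY.root∈L
          s∈Lb : Lb (cyclic y)
          s∈Lb = +∈ (+∈ (*∈ (*∈ (y∈ 0F) (y∈ 0F)) (y∈ 1F)) (*∈ (*∈ (y∈ 1F) (y∈ 1F)) (y∈ 2F))) (*∈ (*∈ (y∈ 2F) (y∈ 2F)) (y∈ 0F))
          s′∈Lb : Lb (cyclic′ y)
          s′∈Lb = +∈ (+∈ (*∈ (*∈ (y∈ 1F) (y∈ 1F)) (y∈ 0F)) (*∈ (*∈ (y∈ 2F) (y∈ 2F)) (y∈ 1F))) (*∈ (*∈ (y∈ 0F) (y∈ 0F)) (y∈ 2F))

          related : ∀ {σ τ} → G σ τ → Γ σ τ (cyclic y , cyclic (y ∘ act τ)) × Γ σ τ (cyclic′ y , cyclic′ (y ∘ act τ))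
          related {σ} {τ} g =
            +-closed (+-closed (*-closed (*-closed yᵍ yᵍ) yᵍ) (*-closed (*-closed yᵍ yᵍ) yᵍ)) (*-closed (*-closed yᵍ yᵍ) yᵍ) ,
            +-closed (+-closed (*-closed (*-closed yᵍ yᵍ) yᵍ) (*-closed (*-closed yᵍ yᵍ) yᵍ)) (*-closed (*-closed yᵍ yᵍ) yᵍ)
            where
            open IsSpecialization (Γ-isSpecialization g)
            yᵍ : ∀ {i} → Γ σ τ (y i , y (act τ i))
            yᵍ {i} = var (inj₂ i) , refl , refl

        cyclic∉M : (∃[ σ ] ∃[ τ ] (G σ τ × odd τ ≡ true)) → ¬ image (cyclic y)
        cyclic∉M (σ , τ , g , odd-τ) (m , ιm≈s) = cyclic-difference Y (trans (+-congʳ s≈s′) (-‿inverseʳ _))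
          where
          open IsSpecialization (Γ-isSpecialization g)
          yᵍ : ∀ {i} → Γ σ τ (y i , y (act τ i))
          yᵍ {i} = var (inj₂ i) , refl , refl

          s≈s′ : cyclic y ≈ cyclic′ y
          s≈s′ = trans (sym ιm≈s) (trans
            (functional (constant m)
              (+-closed (+-closed (*-closed (*-closed yᵍ yᵍ) yᵍ) (*-closed (*-closed yᵍ yᵍ) yᵍ)) (*-closed (*-closed yᵍ yᵍ) yᵍ)) ιm≈s)
            (proj₁ (cyclic-odd y τ odd-τ)))

        -- The second components are the identity and the transposition `t`. Each y is exchanged
        -- with its image under `t` by exactly the odd elements, so `parity⇒∈La` applies to this
        -- pair.
        involutions⇒Lb⊆La : (∀ {σ τ} → G σ τ → τ ∙ τ ≡ 0F) → ∀ {σ₀ t} → G σ₀ t → ¬ (t ≡ 0F) → ∀ {z} → Lb z → La z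
        involutions⇒Lb⊆La involution {σ₀} {t} g₀ t≢0 z∈Lb = let s , s≈z = LY.L⊆M[root] z∈Lb in resp s≈z (terms s)
          where
          y∈La : ∀ j → La (y j)
          y∈La j = parity⇒∈La same (var (inj₂ j) , refl) (var (inj₂ (act t j)) , refl)
            (λ {σ} {τ} g even → unmoved g even j , unmoved g even (act t j))
            (λ {σ} {τ} g odd′ →
              let t≡τ : t ≡ τ
                  t≡τ = S₃.involution-product t τ (involution g₀) (involution g) (involution (G-∙ g₀ g)) t≢0 (λ { ≡.refl → case odd′ }) in
              moves g (act t j) (≡.cong (λ ρ → act ρ j) (≡.sym t≡τ)) , moves g j
                (≡.trans (≡.cong (λ ρ → act ρ (act t j)) (≡.sym t≡τ))
                  (≡.trans (≡.sym (S₃.act-∙ t t j)) (≡.trans (≡.cong (λ ρ → act ρ j) (involution g₀)) (S₃.act-id j)))))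
            where
            case : odd 0F ≡ true → _
            case ()

            moves : ∀ {σ τ i} → G σ τ → ∀ k → act τ i ≡ k → Γ σ τ (y i , y k)
            moves {i = i} g k eq = var (inj₂ i) , refl , reflexive (≡.cong y eq)

            unmoved : ∀ {σ τ} → G σ τ → odd τ ≡ false → ∀ i → Γ σ τ (y i , y i)
            unmoved {σ} {τ} g even i = moves g i (≡.trans (≡.cong (λ ρ → act ρ i) τ≡0) (S₃.act-id i))
              where
              τ≡0 : τ ≡ 0F
              τ≡0 = decidable-stable (τ Finₚ.≟ 0F) λ τ≢0 →
                contradiction (≡.trans (≡.sym even) (S₃.involution⇒odd τ (involution g) τ≢0)) λ ()

          terms : ∀ s → La (⟦ s ⟧ y)
          terms (var j)   = y∈La j
          terms (const m) = image⊆La (m , refl)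
          terms (s ⊞ s′)  = +∈ (terms s) (terms s′)
          terms (s ⊠ s′)  = *∈ (terms s) (terms s′)
          terms (⊟ s)     = -∈ (terms s)

      -- An even `σ` with an odd `τ` gives (0F , τ) by cubing. An odd `σ` with an even, hence
      -- trivial, `τ` generates together with (1F , 0F) all pairs with trivial second component,
      -- which clear the first component of (σ₀ , t) and leave (0F , t). Both contradict
      -- `determined`.
      nested⇒parity : G 1F 0F → (∀ {σ τ} → G σ τ → τ ∙ τ ≡ 0F) → (∃[ σ ] ∃[ τ ] (G σ τ × ¬ (τ ≡ 0F))) →
                      (∀ {τ} → G 0F τ → τ ≡ 0F) → ∀ {σ τ} → G σ τ → odd σ ≡ odd τ
      nested⇒parity r involution (σ₀ , t , g₀ , t≢0) determined {σ} {τ} g with true-or-false (odd σ) | true-or-false (odd τ)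
      ... | inj₁ e | inj₁ e′ = ≡.trans e (≡.sym e′)
      ... | inj₂ o | inj₂ o′ = ≡.trans o (≡.sym o′)
      ... | inj₁ e | inj₂ o with S₃.cube σ | S₃.cube τ
      ...   | inj₁ (o′ , _) | _ = contradiction (≡.trans (≡.sym e) o′) λ ()
      ...   | inj₂ _ | inj₂ (e′ , _) = contradiction (≡.trans (≡.sym e′) o) λ ()
      ...   | inj₂ (_ , σ³≡0) | inj₁ (_ , τ³≡τ) with determined (≡.subst₂ G σ³≡0 τ³≡τ (G-^ 3 g))
      ...     | ≡.refl = contradiction o λ ()
      nested⇒parity r involution (σ₀ , t , g₀ , t≢0) determined {σ} {τ} g | inj₂ o | inj₁ e =
        let i , j , eq = S₃.odd-clears σ σ₀ o in
        contradiction (determined (≡.subst₂ G eq (second i j) (G-∙ (G-^ (Fin.toℕ i) r) (G-∙ (G-^ (Fin.toℕ j) (≡.subst (G σ) τ≡0 g)) g₀)))) t≢0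
        where
        τ≡0 : τ ≡ 0F
        τ≡0 = decidable-stable (τ Finₚ.≟ 0F) λ τ≢0 →
          contradiction (≡.trans (≡.sym e) (S₃.involution⇒odd τ (involution g) τ≢0)) λ ()

        second : ∀ (i : Fin 3) (j : Fin 2) → 0F ^ˢ Fin.toℕ i ∙ (0F ^ˢ Fin.toℕ j ∙ t) ≡ t
        second i j = S₃.identity-word i j t

      module _ (irrational : ∀ i → ¬ image (x i)) where
        private
          mover : ∀ i → ∃[ σ ] ∃[ τ ] (G σ τ × ¬ (act σ i ≡ i))
          mover i with decide (∃[ σ ] ∃[ τ ] (G σ τ × ¬ (act σ i ≡ i)))
          ... | yes found = found
          ... | no none = contradiction (fixed-in-M (var (inj₁ i) , refl) λ {σ} {τ} g →
              var (inj₁ i) , refl , reflexive (≡.cong x (decidable-stable (act σ i Finₚ.≟ i) λ moved → none (σ , τ , g , moved))))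
            (irrational i)

        -- Each of the three roots lies outside M and is moved by some element of `G`; three such
        -- elements already produce a 3-cycle.
        rotation-exists : ∃[ σ ] ∃[ τ ] (G σ τ × IsRotation σ)
        rotation-exists =
          let _ , _ , g₀ , m₀ = mover 0F
              _ , _ , g₁ , m₁ = mover 1F
              _ , _ , g₂ , m₂ = mover 2F
          in [ [ (λ r → _ , _ , g₀ , r) , [ (λ r → _ , _ , g₁ , r) , (λ r → _ , _ , g₂ , r) ]′ ]′
             , [ (λ r → _ , _ , G-∙ g₀ g₁ , r) , [ (λ r → _ , _ , G-∙ g₁ g₂ , r) , (λ r → _ , _ , G-∙ g₀ g₂ , r) ]′ ]′ ]′
               (S₃.transitive⇒rotation _ _ _ m₀ m₁ m₂)

        equal-or-rotation : La ≐ Lb ⊎ G 1F 0F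
        equal-or-rotation = let _ , _ , g , rot = rotation-exists in
          Sum.map₁ fixed⇒equal (fixed-or-rotation g rot)

        involutions⇒rotation : (∀ {σ τ} → G σ τ → τ ∙ τ ≡ 0F) → G 1F 0F
        involutions⇒rotation involution =
          let σ , τ , g , rot = rotation-exists
              n , eq , eq′ = S₃.rotation-power σ τ rot (involution g)
          in ≡.subst₂ G eq eq′ (G-^ (Fin.toℕ n) g)

        module _ (degree : HasExtensionDegree closure (La ∩ Lb) image 2) where
          private
            e : Fin 2 → Carrier
            e = proj₁ degree
            e∈ : ∀ i → (La ∩ Lb) (e i)
            e∈ = proj₁ (proj₂ degree)
            spans = proj₁ (proj₂ (proj₂ degree))
            independence = proj₂ (proj₂ (proj₂ degree))

            pair : Carrier → Carrier → Fin 2 → Carrier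
            pair s t 0F = s
            pair s t 1F = t

            pair∈M : ∀ s t → image s → image t → ∀ i → image (pair s t i)
            pair∈M s t s∈M t∈M 0F = s∈M
            pair∈M s t s∈M t∈M 1F = t∈M

            image-0 : image 0#
            image-0 = M.0# , 0#-homo

            coordinates : ∀ {w} → (La ∩ Lb) w → ∃[ s ] ∃[ t ] (image s × image t × w ≈ s * e 0F + t * e 1F)
            coordinates w∈ = let s , s∈M , eq = spans _ w∈ in s 0F , s 1F , s∈M 0F , s∈M 1F , trans eq (+-congˡ (+-identityʳ _))

          intersection⊈M : ∃[ w ] (La w × Lb w × ¬ image w)
          intersection⊈M with decide (image (e 0F)) | decide (image (e 1F))
          ... | no e₀∉M | _ = e 0F , proj₁ (e∈ 0F) , proj₂ (e∈ 0F) , e₀∉M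
          ... | yes _ | no e₁∉M = e 1F , proj₁ (e∈ 1F) , proj₂ (e∈ 1F) , e₁∉M
          ... | yes e₀∈M | yes e₁∈M = contradiction (independence (pair 1# 0#) (pair∈M 1# 0# (M.1# , 1#-homo) image-0) combination≈0 0F) 1≉0
            where
            -- Were both basis vectors in M, the trivial identity e₁e₀ - e₀e₁ = 0 would be a linear
            -- relation with coefficients in M.
            -e₀≈0 : - e 0F ≈ 0#
            -e₀≈0 = independence (pair (e 1F) (- e 0F)) (pair∈M (e 1F) (- e 0F) e₁∈M (IsSubring.neg-closed image-isSubring e₀∈M))
              (Z.solve 2 (λ x y → y :* x :+ (:- x :* y :+ Z.con 0ℤ) := Z.con 0ℤ) refl (e 0F) (e 1F)) 1F

            combination≈0 : 1# * e 0F + (0# * e 1F + 0#) ≈ 0#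
            combination≈0 = trans (Z.solve 2 (λ x y → Z.con 1ℤ :* x :+ (Z.con 0ℤ :* y :+ Z.con 0ℤ) := :- (:- x)) refl (e 0F) (e 1F))
              (trans (-‿cong -e₀≈0) (Z.solve 0 (:- Z.con 0ℤ := Z.con 0ℤ) refl))

          -- 1, x₀ and x₀² would be linearly dependent over M, although x₀ has three conjugates.
          quadratic⇒different : ¬ (La ≐ Lb)
          quadratic⇒different (La⊆Lb , _) =
            let s₀ , s₁ , s₀∈ , s₁∈ , 1≈ = coordinates (both 1∈)
                t₀ , t₁ , t₀∈ , t₁∈ , x≈ = coordinates (both (LX.root∈L 0F))
                r₀ , r₁ , r₀∈ , r₁∈ , x²≈ = coordinates (both (*∈ (LX.root∈L 0F) (LX.root∈L 0F)))
                -- The coefficients are the signed 2 × 2 minors of the 3 × 2 matrix of coordinates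
                -- of 1, x₀ and x₀².
                dependent : t₀ * r₁ - t₁ * r₀ + (r₀ * s₁ - r₁ * s₀) * x 0F + (s₀ * t₁ - s₁ * t₀) * (x 0F * x 0F) ≈ 0#
                dependent = trans (+-cong (+-cong (trans (sym (*-identityʳ _)) (*-congˡ 1≈)) (*-congˡ x≈)) (*-congˡ x²≈))
                  (Z.solve 8 (λ s₀ s₁ t₀ t₁ r₀ r₁ e₀ e₁ →
                    (t₀ :* r₁ :- t₁ :* r₀) :* (s₀ :* e₀ :+ s₁ :* e₁) :+ (r₀ :* s₁ :- r₁ :* s₀) :* (t₀ :* e₀ :+ t₁ :* e₁)
                      :+ (s₀ :* t₁ :- s₁ :* t₀) :* (r₀ :* e₀ :+ r₁ :* e₁) := Z.con 0ℤ) refl s₀ s₁ t₀ t₁ r₀ r₁ (e 0F) (e 1F))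
                minor≈0 = leading-vanishes (minor t₀∈ r₁∈ t₁∈ r₀∈) (minor r₀∈ s₁∈ r₁∈ s₀∈) (minor s₀∈ t₁∈ s₁∈ t₀∈) dependent
            in rational s₀∈ s₁∈ t₀∈ t₁∈ 1≈ x≈ (x-y≈0⇒x≈y _ _ minor≈0)
            where
            both : ∀ {w} → La w → (La ∩ Lb) w
            both w∈La = w∈La , La⊆Lb w∈La

            minor : ∀ {p q p′ q′} → image p → image q → image p′ → image q′ → image (p * q - p′ * q′)
            minor p q p′ q′ = IsSubring.+-closed image-isSubring (IsSubring.*-closed image-isSubring p q)
              (IsSubring.neg-closed image-isSubring (IsSubring.*-closed image-isSubring p′ q′))

            leading-vanishes : ∀ {p q r} → image p → image q → image r → p + q * x 0F + r * (x 0F * x 0F) ≈ 0# → r ≈ 0#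
            leading-vanishes {p} {q} {r} (k , k≈p) (l , l≈q) (m , m≈r) eq =
              let σ , τ , g , rot = rotation-exists
                  d₁ , d₂ , d₁₂ = S₃.rotation-moves σ rot
              in zero-of-roots (p ∷ q ∷ r ∷ []) (x 0F ∷ x (act σ 0F) ∷ x (act (σ ∙ σ) 0F) ∷ [])
                ((X.apart (λ eq → d₁ (≡.sym eq)) ∷ X.apart (λ eq → d₂ (≡.sym eq)) ∷ []) ∷ (X.apart d₁₂ ∷ []) ∷ [] ∷ [])
                (λ { (suc (suc (suc n))) _ → refl ; (suc zero) (s≤s ()) ; (suc (suc zero)) (s≤s (s≤s ())) })
                (horner (x 0F) eq ∷ horner (x (act σ 0F)) (conjugate-root g) ∷ horner (x (act (σ ∙ σ) 0F)) (conjugate-root (G-∙ g g)) ∷ []) 2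
              where
              horner : ∀ z → p + q * z + r * (z * z) ≈ 0# → eval (p ∷ q ∷ r ∷ []) z ≈ 0#
              horner z eq = trans (Z.solve 4 (λ p q r z → p :+ z :* (q :+ z :* (r :+ z :* Z.con 0ℤ)) := p :+ q :* z :+ r :* (z :* z)) refl p q r z) eq

              conjugate-root : ∀ {σ τ} → G σ τ → p + q * x (act σ 0F) + r * (x (act σ 0F) * x (act σ 0F)) ≈ 0#
              conjugate-root {σ} {τ} g = zero-zero (+-closed (+-closed (const k , k≈p , k≈p) (*-closed (const l , l≈q , l≈q) xᵍ))
                  (*-closed (const m , m≈r , m≈r) (*-closed xᵍ xᵍ))) eq
                where
                open IsSpecialization (Γ-isSpecialization g)
                xᵍ : Γ σ τ (x 0F , x (act σ 0F))
                xᵍ = var (inj₁ 0F) , refl , refl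

            quotient∈M : ∀ {s t w} → image s → image t → ¬ (s ≈ 0#) → s * w ≈ t → image w
            quotient∈M {s} {t} {w} s∈ t∈ s≉0 eq =
              let s⁻¹ , s⁻¹∈ , inv = inverse-closed image-isSubring (λ m → m , refl) s∈ s≉0 in
              IsSubring.≈-closed image-isSubring
                (trans (*-congˡ (sym eq)) (trans (Z.solve 3 (λ i s w → i :* (s :* w) := s :* i :* w) refl s⁻¹ s w) (trans (*-congʳ inv) (*-identityˡ w))))
                (IsSubring.*-closed image-isSubring s⁻¹∈ t∈)

            -- The vanishing minor makes the coordinates of x₀ proportional to those of 1, which are
            -- not both zero; so x₀ would lie in M.
            rational : ∀ {s₀ s₁ t₀ t₁} → image s₀ → image s₁ → image t₀ → image t₁ →
                       1# ≈ s₀ * e 0F + s₁ * e 1F → x 0F ≈ t₀ * e 0F + t₁ * e 1F → s₀ * t₁ ≈ s₁ * t₀ → ⊥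
            rational {s₀} {s₁} {t₀} {t₁} s₀∈ s₁∈ t₀∈ t₁∈ 1≈ x≈ minor with s₀ ≟ 0# | s₁ ≟ 0#
            ... | no s₀≉0 | _ = irrational 0F (quotient∈M s₀∈ t₀∈ s₀≉0 (trans (*-congˡ x≈) (trans
                (Z.solve 6 (λ s₀ s₁ t₀ t₁ e₀ e₁ → s₀ :* (t₀ :* e₀ :+ t₁ :* e₁) := t₀ :* (s₀ :* e₀ :+ s₁ :* e₁) :+ (s₀ :* t₁ :- s₁ :* t₀) :* e₁) refl s₀ s₁ t₀ t₁ (e 0F) (e 1F))
                (trans (+-cong (trans (*-congˡ (sym 1≈)) (*-identityʳ t₀)) (trans (*-congʳ (trans (+-congʳ minor) (-‿inverseʳ _))) (zeroˡ _))) (+-identityʳ t₀)))))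
            ... | yes _ | no s₁≉0 = irrational 0F (quotient∈M s₁∈ t₁∈ s₁≉0 (trans (*-congˡ x≈) (trans
                (Z.solve 6 (λ s₀ s₁ t₀ t₁ e₀ e₁ → s₁ :* (t₀ :* e₀ :+ t₁ :* e₁) := t₁ :* (s₀ :* e₀ :+ s₁ :* e₁) :- (s₀ :* t₁ :- s₁ :* t₀) :* e₀) refl s₀ s₁ t₀ t₁ (e 0F) (e 1F))
                (trans (+-cong (trans (*-congˡ (sym 1≈)) (*-identityʳ t₁)) (-‿cong (trans (*-congʳ (trans (+-congʳ minor) (-‿inverseʳ _))) (zeroˡ _))))
                  (Z.solve 1 (λ t → t :- Z.con 0ℤ := t) refl t₁)))))
            ... | yes s₀≈0 | yes s₁≈0 = 1≉0 (trans 1≈ (trans (+-cong (trans (*-congʳ s₀≈0) (zeroˡ _)) (trans (*-congʳ s₁≈0) (zeroˡ _))) (+-identityʳ 0#)))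

        -- The rows of the case table.

        private
          Ga = LX.Gal-L
          Gb = LY.Gal-L

          odd-first : Ga ≅ 𝔖 3 → ∃[ σ ] ∃[ τ ] (G σ τ × odd σ ≡ true)
          odd-first iso = choose (LX.symmetric⇒ iso)
            where
            extend-first : ∀ {σ} → PreservesRelations x (act σ) → odd σ ≡ true → ∃[ σ ] ∃[ τ ] (G σ τ × odd σ ≡ true)
            extend-first {σ} σ-preserves o = let τ , g = first⇒G {σ} σ-preserves in σ , τ , g , o

            choose : (∃[ σ ] ∃[ τ ] (PreservesRelations x (act σ) × PreservesRelations x (act τ) × ¬ (σ ∙ τ ≡ τ ∙ σ))) →
                     ∃[ σ ] ∃[ τ ] (G σ τ × odd σ ≡ true)
            choose (σ , τ , σ-preserves , τ-preserves , noncommuting) =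
              [ extend-first {σ} σ-preserves , extend-first {τ} τ-preserves ]′ (S₃.noncommuting⇒odd σ τ noncommuting)

          odd-second : Gb ≅ 𝔖 3 → ∃[ σ ] ∃[ τ ] (G σ τ × odd τ ≡ true)
          odd-second iso = choose (LY.symmetric⇒ iso)
            where
            extend-second : ∀ {τ} → PreservesRelations y (act τ) → odd τ ≡ true → ∃[ σ ] ∃[ τ ] (G σ τ × odd τ ≡ true)
            extend-second {τ} τ-preserves o = let σ , g = second⇒G {τ} τ-preserves in σ , τ , g , o

            choose : (∃[ σ ] ∃[ τ ] (PreservesRelations y (act σ) × PreservesRelations y (act τ) × ¬ (σ ∙ τ ≡ τ ∙ σ))) →
                     ∃[ σ ] ∃[ τ ] (G σ τ × odd τ ≡ true)
            choose (σ , τ , σ-preserves , τ-preserves , noncommuting) =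
              [ extend-second {σ} σ-preserves , extend-second {τ} τ-preserves ]′ (S₃.noncommuting⇒odd σ τ noncommuting)

          even-first : Ga ≅ Cyclic 3 → ∀ {σ τ} → G σ τ → odd σ ≡ false
          even-first iso {σ} {τ} g = S₃.order-3⇒even σ (LX.cyclic-3⇒ iso {σ} (G⇒first {σ} {τ} g))

          even-second : Gb ≅ Cyclic 3 → ∀ {σ τ} → G σ τ → odd τ ≡ false
          even-second iso {σ} {τ} g = S₃.order-3⇒even τ (LY.cyclic-3⇒ iso {τ} (G⇒second {σ} {τ} g))

          involutions : Gb ≅ Cyclic 2 → ∀ {σ τ} → G σ τ → τ ∙ τ ≡ 0F
          involutions iso {σ} {τ} g = LY.cyclic-2⇒ iso {τ} (G⇒second {σ} {τ} g)

          nontrivial-second : Gb ≅ Cyclic 2 → ∃[ σ ] ∃[ τ ] (G σ τ × ¬ (τ ≡ 0F))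
          nontrivial-second iso = extend-second (LY.cyclic-nontrivial 2 2∤1 iso)
            where
            2∤1 : ¬ (ℤ.+ 2 ℤ∣.∣ ℤ.+ 1)
            2∤1 2∣1 = contradiction (ℕ∣.∣⇒≤ (ℤ∣.∣⇒∣ᵤ 2∣1)) λ { (s≤s ()) }

            extend-second : (∃[ τ ] (PreservesRelations y (act τ) × ¬ (τ ≡ 0F))) → ∃[ σ ] ∃[ τ ] (G σ τ × ¬ (τ ≡ 0F))
            extend-second (τ , τ-preserves , τ≢0) = let σ , g = second⇒G {τ} τ-preserves in σ , τ , g , τ≢0

          trivial-second : IsTrivial Gb → ∀ {σ τ} → G σ τ → τ ≡ 0F
          trivial-second trivial {σ} {τ} g = LY.trivial⇒ trivial {τ} (G⇒second {σ} {τ} g)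

          trivial-involutions : IsTrivial Gb → ∀ {σ τ} → G σ τ → τ ∙ τ ≡ 0F
          trivial-involutions trivial g = ≡.cong (λ τ → τ ∙ τ) (trivial-second trivial g)

          differ : ∀ {σ τ b b′} → G σ τ → odd σ ≡ b → odd τ ≡ b′ → ¬ (b ≡ b′) → ∃[ σ ] ∃[ τ ] (G σ τ × ¬ (odd σ ≡ odd τ))
          differ g p q b≢b′ = _ , _ , g , λ eq → b≢b′ (≡.trans (≡.sym p) (≡.trans eq q))

          intersection : (∀ {σ τ} → G σ τ → G σ 0F) → (La ∩ Lb) ≐ image
          intersection first = (λ (z∈La , z∈Lb) → intersection⊆M first z∈La z∈Lb) , λ z∈M → image⊆La z∈M , image⊆Lb z∈M

          rotation-unless-equal : ¬ (La ≐ Lb) → G 1F 0F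
          rotation-unless-equal different = [ (λ equal → contradiction equal different) , id ]′ equal-or-rotation

        S₃S₃ : Ga ≅ 𝔖 3 → Gb ≅ 𝔖 3 →
          ((La ∩ Lb) ≐ image → Degrees (6 ∷ []))
          × (HasExtensionDegree closure (La ∩ Lb) image 2 → Degrees (3 ∷ 3 ∷ []))
          × (La ≐ Lb → Degrees (1 ∷ 2 ∷ 3 ∷ []))
        S₃S₃ ga gb = disjoint , quadratic , λ equal → degrees-1-2-3 rotation-exists (equal⇒fixed equal) (odd-first ga)
          where
          disjoint : (La ∩ Lb) ≐ image → Degrees (6 ∷ [])
          disjoint (⊆M , _) = degrees-6
            (rotation-unless-equal λ (La⊆Lb , _) → irrational 0F (⊆M (LX.root∈L 0F , La⊆Lb (LX.root∈L 0F))))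
            ([ (λ same → contradiction (⊆M (cyclic∈La (λ {σ} {τ} → same {σ} {τ}) , cyclic∈Lb)) (cyclic∉M (λ {σ} {τ} → same {σ} {τ}) (odd-second gb))) , id ]′ parity-or-not)
            where
            cyclic∈Lb : Lb (cyclic y)
            cyclic∈Lb = +∈ (+∈ (*∈ (*∈ (y∈ 0F) (y∈ 0F)) (y∈ 1F)) (*∈ (*∈ (y∈ 1F) (y∈ 1F)) (y∈ 2F))) (*∈ (*∈ (y∈ 2F) (y∈ 2F)) (y∈ 0F))
              where
              y∈ : ∀ i → Lb (y i)
              y∈ = LY.root∈L

          quadratic : HasExtensionDegree closure (La ∩ Lb) image 2 → Degrees (3 ∷ 3 ∷ [])
          quadratic degree =
            from (rotation-unless-equal (quadratic⇒different degree)) (intersection⊈M degree)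
            where
            from : G 1F 0F → ∃[ w ] (La w × Lb w × ¬ image w) → Degrees (3 ∷ 3 ∷ [])
            from r (w , w∈La , w∈Lb , w∉M) = degrees-3-3 r (moved⇒parity r w∈La w∈Lb w∉M)

        S₃C₃ : Ga ≅ 𝔖 3 → Gb ≅ Cyclic 3 → ((La ∩ Lb) ≐ image) × Degrees (6 ∷ [])
        S₃C₃ ga gb = intersection first , degrees-6 r (parity-differs (odd-first ga))
          where
          r : G 1F 0F
          -- A fixed `π` conjugates first components into second ones and preserves parity, but here
          -- only the first ones can be odd.
          r = rotation-unless-equal λ equal → no-fixed (equal⇒fixed equal) (odd-first ga)
            where
            no-fixed : FixedMatching → ¬ (∃[ σ ] ∃[ τ ] (G σ τ × odd σ ≡ true))
            no-fixed (π , fixed) (σ , τ , g , o) =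
              contradiction (≡.trans (≡.sym o) (≡.trans (S₃.fixes-parity π σ τ (fixed g)) (even-second gb g))) λ ()

          parity-differs : ∃[ σ ] ∃[ τ ] (G σ τ × odd σ ≡ true) → ∃[ σ ] ∃[ τ ] (G σ τ × ¬ (odd σ ≡ odd τ))
          parity-differs (_ , _ , g , o) = differ g o (even-second gb g) λ ()

          first : ∀ {σ τ} → G σ τ → G σ 0F
          first {σ} {τ} g with S₃.cube σ | S₃.cube τ
          ... | inj₂ (even , _)   | _                = rotations-first r even
          ... | inj₁ (_ , σ³≡σ) | inj₂ (_ , τ³≡0) = ≡.subst₂ G σ³≡σ τ³≡0 (G-^ 3 g)
          ... | inj₁ _            | inj₁ (o , _)     = contradiction (≡.trans (≡.sym (even-second gb g)) o) λ ()

        S₃C₂ : Ga ≅ 𝔖 3 → Gb ≅ Cyclic 2 → (¬ (Lb ⊆ La) → Degrees (6 ∷ [])) × (Lb ⊆ La → Degrees (3 ∷ 3 ∷ []))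
        S₃C₂ ga gb =
          (λ Lb⊈La → degrees-6 r ([ (λ same → contradiction (λ {z} → nested (λ {σ} {τ} → same {σ} {τ}) {z}) Lb⊈La) , id ]′ parity-or-not)) ,
          (λ Lb⊆La → degrees-3-3 r (nested⇒parity r (involutions gb) (nontrivial-second gb) (first-determines Lb⊆La)))
          where
          r : G 1F 0F
          r = involutions⇒rotation (involutions gb)

          nested : (∀ {σ τ} → G σ τ → odd σ ≡ odd τ) → Lb ⊆ La
          nested same = from (nontrivial-second gb)
            where
            from : ∃[ σ ] ∃[ τ ] (G σ τ × ¬ (τ ≡ 0F)) → Lb ⊆ La
            from (_ , _ , g , t≢0) = involutions⇒Lb⊆La same (involutions gb) g t≢0

        S₃1 : Ga ≅ 𝔖 3 → IsTrivial Gb → Degrees (6 ∷ [])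
        S₃1 ga trivial = degrees-6 (involutions⇒rotation (trivial-involutions trivial)) (parity-differs (odd-first ga))
          where
          parity-differs : ∃[ σ ] ∃[ τ ] (G σ τ × odd σ ≡ true) → ∃[ σ ] ∃[ τ ] (G σ τ × ¬ (odd σ ≡ odd τ))
          parity-differs (_ , _ , g , o) = differ g o (≡.cong odd (trivial-second trivial g)) λ ()

        C₃C₃ : Ga ≅ Cyclic 3 → Gb ≅ Cyclic 3 → (¬ (La ≐ Lb) → Degrees (3 ∷ 3 ∷ [])) × (La ≐ Lb → Degrees (1 ∷ 1 ∷ 1 ∷ 3 ∷ []))
        C₃C₃ ga gb =
          (λ different → degrees-3-3 (rotation-unless-equal different) λ g → ≡.trans (even-first ga g) (≡.sym (even-second gb g))) ,
          (λ equal → degrees-1-1-1-3 rotation-exists (equal⇒fixed equal) (even-first ga))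

        C₃C₂ : Ga ≅ Cyclic 3 → Gb ≅ Cyclic 2 → ((La ∩ Lb) ≐ image) × Degrees (6 ∷ [])
        C₃C₂ ga gb = intersection (λ g → rotations-first r (even-first ga g)) , degrees-6 r (parity-differs (nontrivial-second gb))
          where
          parity-differs : ∃[ σ ] ∃[ τ ] (G σ τ × ¬ (τ ≡ 0F)) → ∃[ σ ] ∃[ τ ] (G σ τ × ¬ (odd σ ≡ odd τ))
          parity-differs (_ , τ , g , τ≢0) = differ g (even-first ga g) (S₃.involution⇒odd τ (involutions gb g) τ≢0) λ ()

          r : G 1F 0F
          r = involutions⇒rotation (involutions gb)

        C₃1 : Ga ≅ Cyclic 3 → IsTrivial Gb → Degrees (3 ∷ 3 ∷ [])
        C₃1 ga trivial = degrees-3-3 (involutions⇒rotation (trivial-involutions trivial))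
          λ g → ≡.trans (even-first ga g) (≡.sym (≡.cong odd (trivial-second trivial g)))

        cases = (λ (ga : Ga ≅ 𝔖 3) → S₃S₃ ga ,′ S₃C₃ ga ,′ S₃C₂ ga ,′ S₃1 ga) ,′
                (λ (ga : Ga ≅ Cyclic 3) → C₃C₃ ga ,′ C₃C₂ ga ,′ C₃1 ga)

      Value : Set (c ⊔ ℓ₁ ⊔ ℓ₂)
      Value = ∃[ m ] Σ[ d#0 ∈ FM.den a m FM.^ 2 M.# M.0# ] (b M.≈ (a M.* FM.num a m FM.^ 3) M.* inverse M (FM.den a m FM.^ 2) d#0)

      fixed⇒Value : FixedMatching → Value
      fixed⇒Value fixed =
        let m , den≉0 , eq = fixed⇒value fixed
            d = FM.den a m FM.^ 2
            d#0 = M.≉⇒# (M.*-nonzero den≉0 (M.*-nonzero den≉0 M.1≉0))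
        in m , d#0 , M.trans (M.sym (M.*-identityʳ b)) (M.trans (M.*-congˡ (M.sym (M.inverse-law d d#0)))
             (M.trans (M.sym (M.*-assoc b d (inverse M d d#0))) (M.*-congʳ eq)))

      Value⇒fixed : ¬ (FM.δ b M.≈ M.0#) → Value → FixedMatching
      Value⇒fixed δb≉0 (m , d#0 , eq) = value⇒fixed δb≉0 m
        (λ den≈0 → M.#⇒≉ d#0 (M.trans (M.*-congʳ (ι-injective (trans (ι-hom.den-hom refl refl) (trans den≈0 (sym 0#-homo))))) (M.zeroˡ _)))
        (trans (sym (ι-hom.*-hom refl (ι-hom.^-hom 2 (ι-hom.den-hom refl refl))))
          (trans (⟦⟧-cong equation) (ι-hom.*-hom refl (ι-hom.^-hom 3 (ι-hom.num-hom refl refl)))))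
        where
        d = FM.den a m FM.^ 2
        equation : b M.* d M.≈ a M.* FM.num a m FM.^ 3
        equation = M.trans (M.*-congʳ eq) (M.trans (M.*-assoc _ (inverse M d d#0) d)
          (M.trans (M.*-congˡ (M.trans (M.*-comm (inverse M d d#0) d) (M.inverse-law d d#0))) (M.*-identityʳ _)))

      equal⇔Value : ¬ (FM.δ b M.≈ M.0#) → (La ≐ Lb) ⇔ Value
      equal⇔Value δb≉0 = mk⇔ (λ equal → fixed⇒Value (equal⇒fixed equal)) (λ value → fixed⇒equal (Value⇒fixed δb≉0 value))

  module _ (3≉0ᴹ : ¬ (3 FM.· M.1# M.≈ M.0#)) (a b : M.Carrier) (a#b : a M.# b) (δa#0 : FM.δ a M.# M.0#) (δb#0 : FM.δ b M.# M.0#) where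
    private
      δb≉0 : ¬ (FM.δ b M.≈ M.0#)
      δb≉0 = M.#⇒≉ δb#0

      nonzero : ∀ p → FM.δ p M.# M.0# → ¬ (ι p ≈ 0#)
      nonzero p δp#0 = ι-nonzero λ p≈0 → M.#⇒≉ δp#0 (M.trans (M.*-congʳ p≈0) (M.zeroˡ _))

      3≉0 : ¬ (3 · 1# ≈ 0#)
      3≉0 eq = ι-nonzero 3≉0ᴹ (trans (ι-hom.·-hom 3 1#-homo) eq)

      a≉b : ¬ (ι a ≈ ι b)
      a≉b eq = M.#⇒≉ a#b (ι-injective eq)

      a≉0 = nonzero a δa#0
      b≉0 = nonzero b δb#0
      X = cubic-roots a (M.#⇒≉ δa#0)
      Y = cubic-roots b δb≉0

      -- The inverse of a fixed bijection is fixed for the exchanged roles, which gives the second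
      -- inclusion.
      fixed⇒equal : Comparison.FixedMatching 3≉0 a≉b a≉0 b≉0 X Y →
                    Comparison.La 3≉0 a≉b a≉0 b≉0 X Y ≐ Comparison.Lb 3≉0 a≉b a≉0 b≉0 X Y
      fixed⇒equal (π , fixed) =
        (λ {z} → Comparison.fixed⇒Lb⊆La 3≉0 (λ eq → a≉b (sym eq)) b≉0 a≉0 Y X (inv π)
          (λ {τ} {σ} g → S₃.fixes-swap π σ τ (fixed (swap-conjugation X Y g))) {z}) ,
        (λ {z} → Comparison.fixed⇒Lb⊆La 3≉0 a≉b a≉0 b≉0 X Y π fixed {z})

    conclusion = (λ (irreducible : IrreducibleOver M (cubic M a)) (_ : Gal (Spl Ω (cubic M b)) image ≼ Gal (Spl Ω (cubic M a)) image) →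
                    Comparison.cases 3≉0 a≉b a≉0 b≉0 X Y fixed⇒equal (root-not-in-M X irreducible)) ,′
                 Comparison.equal⇔Value 3≉0 a≉b a≉0 b≉0 X Y fixed⇒equal δb≉0

theorem4p10 :
  ∀ {c ℓ₁ ℓ₂} →
  ExcludedMiddle (c ⊔ ℓ₁ ⊔ ℓ₂) →
  (k M : HeytingField c ℓ₁ ℓ₂)
  (k⊂M : HeytingField.Carrier k → HeytingField.Carrier M) →
  IsRingHomomorphism (rawRing k) (rawRing M) k⊂M →
  ¬ HasCharacteristic k 3 →
  Infinite (setoid M) →
  (Ω : AlgebraicClosure M) →
  let open HeytingField M
      open Formulas (rawRing M)
      open AlgebraicClosure Ω
  in
  (a b : Carrier) → a # b → δ a # 0# → δ b # 0# →
  let L′a = Spl Ω (cubic M a)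
      L′b = Spl Ω (cubic M b)
      La = Subfield.Member L′a
      Lb = Subfield.Member L′b
      Ga = Gal L′a image
      Gb = Gal L′b image
      Degrees = HasFactorDegrees M (H M a b)
  in
  ( IrreducibleOver M (cubic M a) → Gb ≼ Ga →
    ( Ga ≅ 𝔖 3 →
        ( Gb ≅ 𝔖 3 →
            ((La ∩ Lb) ≐ image → Degrees (6 ∷ []))
          × (HasExtensionDegree closure (La ∩ Lb) image 2 → Degrees (3 ∷ 3 ∷ []))
          × (La ≐ Lb → Degrees (1 ∷ 2 ∷ 3 ∷ [])))
      × ( Gb ≅ Cyclic 3 → ((La ∩ Lb) ≐ image) × Degrees (6 ∷ []))
      × ( Gb ≅ Cyclic 2 →
            (¬ (Lb ⊆ La) → Degrees (6 ∷ []))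
          × (Lb ⊆ La → Degrees (3 ∷ 3 ∷ [])))
      × ( IsTrivial Gb → Degrees (6 ∷ [])))
  × ( Ga ≅ Cyclic 3 →
        ( Gb ≅ Cyclic 3 →
            (¬ (La ≐ Lb) → Degrees (3 ∷ 3 ∷ []))
          × (La ≐ Lb → Degrees (1 ∷ 1 ∷ 1 ∷ 3 ∷ [])))
      × ( Gb ≅ Cyclic 2 → ((La ∩ Lb) ≐ image) × Degrees (6 ∷ []))
      × ( IsTrivial Gb → Degrees (3 ∷ 3 ∷ []))))
  × ( (La ≐ Lb) ⇔
      (∃[ u ] Σ[ d#0 ∈ den a u ^ 2 # 0# ]
         (b ≈ (a * num a u ^ 3) * inverse M (den a u ^ 2) d#0)))
theorem4p10 em k M k⊂M k⊂M-hom not-3 _ Ω a b a#b δa#0 δb#0 =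
  Development.conclusion em M Ω (three-nonzero em k M k⊂M k⊂M-hom not-3) a b a#b δa#0 δb#0
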